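{- Let $\dot G$ be a bipartite $(2n,r)$-SR2SE with underlying graph $G$. Then: (i) $n\geqslant\binom{r}{2}+1$, and in case of equality $G$ is the incidence graph of a symmetric BIBD with parameters $(n,r,2)$; (ii) if $n$ is odd, then (a) $r$ is a perfect square, (b) $n\leqslant (n-r)^2+n-r+1$, and (c) $r(r-1)\equiv 0\pmod 4$; if $n\equiv 2\pmod 4$, then $r$ is a sum of two squares of integers.
   Context: A signed graph $\dot G=(G,\sigma)$ consists of a simple graph $G$ and $\sigma:E(G)\to\{1,-1\}$; its adjacency matrix is that of $G$ with entries of negative edges replaced by $-1$, and its eigenvalues are those of this matrix; it is bipartite if $G$ is. A signed $(0,2)$-graph is a connected signed graph in which any two distinct vertices have $0$ or $2$ common neighbours; a signed rectagraph is a triangle-free one. An SR2SE is a signed rectagraph whose spectrum consists of exactly two distinct eigenvalues $\pm\lambda$; a $(2n,r)$-SR2SE has $2n$ vertices and is $r$-regular. A symmetric BIBD with parameters $(n,r,l)$ is an arrangement of $n$ points into $n$ blocks of size $r$ such that every point lies in $r$ blocks and every pair of distinct points lies together in exactly $l$ blocks; its incidence graph has the points and blocks as vertices, a point being adjacent to a block iff it lies in it. -}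

module Defs where

open import Level using (Level; _⊔_) renaming (suc to lsuc)
open import Data.Nat as ℕ using (ℕ; zero; suc)
open import Data.Integer as ℤ using (ℤ; +_; -[1+_])
open import Data.Fin using (Fin)
open import Data.List as List using (List; []; _∷_; _++_; allFin)
open import Data.Nat.ListAction using (sum)
open import Data.Vec as Vec using (Vec)
open import Data.Bool using (Bool; true; false; _∧_; if_then_else_)
open import Data.Sum using (_⊎_; inj₁; inj₂)
open import Data.Product using (_×_; ∃; Σ; _,_)
open import Data.Empty using (⊥)
open import Relation.Nullary using (¬_)
open import Relation.Binary.PropositionalEquality using (_≡_; _≢_)
open import Relation.Binary.Structures using (IsTotalOrder)
open import Algebra.Bundles using (CommutativeRing)
open import Function.Bundles using (_↔_; Inverse)

-- Real closed fields (stand-in for ℝ, which the stdlib lacks).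
-- Axiomatised as: a nontrivial ordered field in which every
-- nonnegative element has a square root and every monic polynomial of
-- odd degree has a root (a standard characterisation).

module _ {c ℓ} (R : CommutativeRing c ℓ) where
  open CommutativeRing R
  evalPoly : List Carrier → Carrier → Carrier
  evalPoly []       x = 0#
  evalPoly (a ∷ as) x = a + x * evalPoly as x

record RealClosedField c ℓ : Set (lsuc (c ⊔ ℓ)) where
  field
    commutativeRing : CommutativeRing c ℓ
  open CommutativeRing commutativeRing public
  field
    _≤_          : Carrier → Carrier → Set ℓ
    isTotalOrder : IsTotalOrder _≈_ _≤_
    +-mono-≤     : ∀ {x y} z → x ≤ y → (x + z) ≤ (y + z)
    *-nonneg     : ∀ {x y} → 0# ≤ x → 0# ≤ y → 0# ≤ (x * y)
    0≉1          : ¬ (0# ≈ 1#)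
    inverse      : ∀ x → ¬ (x ≈ 0#) → ∃ λ y → (x * y) ≈ 1#
    sqrt         : ∀ x → 0# ≤ x → ∃ λ y → (y * y) ≈ x
    oddRoot      : ∀ k (as : Vec Carrier (suc (2 ℕ.* k))) →
                   ∃ λ x → evalPoly commutativeRing (Vec.toList as ++ (1# ∷ [])) x ≈ 0#

sumℕ : ∀ {m} → (Fin m → ℕ) → ℕ
sumℕ {m} f = sum (List.map f (allFin m))

record SignedGraph (m : ℕ) : Set where
  field
    A        : Fin m → Fin m → ℤ
    entries  : ∀ i j → (A i j ≡ + 0) ⊎ (A i j ≡ + 1) ⊎ (A i j ≡ ℤ.- (+ 1))
    symm     : ∀ i j → A i j ≡ A j i
    loopless : ∀ i → A i i ≡ + 0

module _ {m : ℕ} (G : SignedGraph m) where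
  open SignedGraph G

  Adj : Fin m → Fin m → Set
  Adj i j = A i j ≢ + 0

  isEdge : Fin m → Fin m → Bool
  isEdge i j with A i j
  ... | + zero = false
  ... | _      = true

  degree : Fin m → ℕ
  degree i = sumℕ (λ k → if isEdge i k then 1 else 0)

  commonNeighbours : Fin m → Fin m → ℕ
  commonNeighbours i j = sumℕ (λ k → if isEdge i k ∧ isEdge j k then 1 else 0)

  data Reachable (i : Fin m) : Fin m → Set where
    here : Reachable i i
    step : ∀ {j k} → Reachable i j → Adj j k → Reachable i k

  Connected : Set
  Connected = ∀ i j → Reachable i j

  Regular : ℕ → Set
  Regular r = ∀ i → degree i ≡ r

  TriangleFree : Set
  TriangleFree = ∀ i j k → ¬ (Adj i j × Adj j k × Adj i k)

  Bipartite : Set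
  Bipartite = ∃ λ (col : Fin m → Bool) → ∀ i j → Adj i j → col i ≢ col j

  Is02Graph : Set
  Is02Graph = Connected × (∀ i j → i ≢ j →
                (commonNeighbours i j ≡ 0) ⊎ (commonNeighbours i j ≡ 2))

  IsRectagraph : Set
  IsRectagraph = Is02Graph × TriangleFree

  module _ {c ℓ} (R : RealClosedField c ℓ) where
    open RealClosedField R renaming (Carrier to K)

    fromℕ : ℕ → K
    fromℕ zero    = 0#
    fromℕ (suc n) = 1# + fromℕ n

    fromℤ : ℤ → K
    fromℤ (+ n)      = fromℕ n
    fromℤ -[1+ n ]   = - fromℕ (suc n)

    sumK : ∀ {k} → (Fin k → K) → K
    sumK {k} f = List.foldr _+_ 0# (List.map f (allFin k))

    IsEigenvalue : K → Set (c ⊔ ℓ)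
    IsEigenvalue μ = ∃ λ (x : Fin m → K) →
      (∃ λ i → ¬ (x i ≈ 0#)) ×
      (∀ i → sumK (λ j → fromℤ (A i j) * x j) ≈ (μ * x i))

    HasSpectrumPM : Set (c ⊔ ℓ)
    HasSpectrumPM = ∃ λ (λ₀ : K) →
      ¬ (λ₀ ≈ - λ₀) × IsEigenvalue λ₀ × IsEigenvalue (- λ₀) ×
      (∀ μ → IsEigenvalue μ → (μ ≈ λ₀) ⊎ (μ ≈ - λ₀))

IsSR2SE : ∀ {c ℓ} (R : RealClosedField c ℓ) (n r : ℕ) → SignedGraph (2 ℕ.* n) → Set (c ⊔ ℓ)
IsSR2SE R n r G = IsRectagraph G × Regular G r × HasSpectrumPM G R

record SymmetricBIBD (n r l : ℕ) : Set where
  field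
    incidence    : Fin n → Fin n → Bool
    blockSize    : ∀ b → sumℕ (λ p → if incidence p b then 1 else 0) ≡ r
    replication  : ∀ p → sumℕ (λ b → if incidence p b then 1 else 0) ≡ r
    pairCount    : ∀ p q → p ≢ q →
                   sumℕ (λ b → if incidence p b ∧ incidence q b then 1 else 0) ≡ l

IncAdj : ∀ {n r l} → SymmetricBIBD n r l → Fin n ⊎ Fin n → Fin n ⊎ Fin n → Set
IncAdj D (inj₁ p) (inj₂ b) = SymmetricBIBD.incidence D p b ≡ true
IncAdj D (inj₂ b) (inj₁ p) = SymmetricBIBD.incidence D p b ≡ true
IncAdj D (inj₁ _) (inj₁ _) = ⊥
IncAdj D (inj₂ _) (inj₂ _) = ⊥

IsIncidenceGraphOfSBIBD : ∀ {m} → SignedGraph m → (n r l : ℕ) → Set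
IsIncidenceGraphOfSBIBD {m} G n r l =
  ∃ λ (D : SymmetricBIBD n r l) → Σ (Fin m ↔ (Fin n ⊎ Fin n)) λ φ →
    ∀ i j → (Adj G i j → IncAdj D (Inverse.to φ i) (Inverse.to φ j)) ×
            (IncAdj D (Inverse.to φ i) (Inverse.to φ j) → Adj G i j)

module Submission where

-- The eigenvalues of a symmetric operator over a real closed field lie in the field; hence a
-- symmetric matrix whose only eigenvalues are ±ρ satisfies A² = ρ². The existence of
-- eigenvectors is shown as in Derksen's proof of the fundamental theorem of algebra, by
-- induction on the power of two dividing the dimension: in odd dimension a Krylov subspace
-- yields a polynomial of odd degree, and otherwise A acts on the skew matrices, whose
-- dimension d(d-1)/2 is divisible by one power of two less, by the commuting operators
-- B ↦ AB + BA and B ↦ ABA; a common eigenvector gives a quadratic relation for A.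
--
-- For the signed graph this means that the rows of the biadjacency matrix N are orthogonal,
-- N Nᵀ = r. Counting walks of length two between vertices of one colour gives (i). For (ii),
-- N Nᵀ = r says that r(x₁² + ⋯ + xₙ²) and x₁² + ⋯ + xₙ² are isometric over ℚ. By Pfister the same
-- holds for 2ᵏ variables if r ≤ 2ᵏ, and by Witt cancellation for gcd(n, 2ᵏ) variables, that is
-- for one variable (r is a square) or for two (r is a sum of two squares). The remaining claims
-- follow arithmetically from (i) and from r being a square.

open import Defs
open import Level using (_⊔_)
open import Data.Nat as ℕ using (ℕ; zero; suc)
open import Data.Integer as ℤ using (ℤ; +_; -[1+_])
import Data.Nat.Properties as ℕ
import Data.Integer.Properties as ℤ
open import Data.Fin using (Fin; zero; suc; splitAt; _↑ˡ_; _↑ʳ_; punchIn; punchOut)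
open import Data.Product using (_×_; ∃; ∃₂; Σ; _,_; proj₁; proj₂)
open import Data.Sum as Sum using (_⊎_; inj₁; inj₂; [_,_]′)
open import Data.Maybe using (Maybe; just; nothing)
open import Relation.Nullary using (¬_; yes; no; contradiction)
open import Relation.Binary.PropositionalEquality as ≡ using (_≡_; _≢_)
open import Relation.Binary.Structures using (IsTotalOrder)
open import Algebra.Bundles using (CommutativeRing; CommutativeMonoid)
open import Function using (_∘_; id)
open import Algebra.Solver.Ring.AlmostCommutativeRing using (fromCommutativeRing; _-Raw-AlmostCommutative⟶_)
import Algebra.Solver.Ring
open import Data.List as List using (List; []; _∷_; allFin)
open import Data.Vec as Vec using (Vec; []; _∷_; lookup; tabulate)
open import Data.Vec.Functional as F using (tail)
open import Relation.Binary.Bundles using (Setoid)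
open import Data.Nat.Divisibility using (_∣_; _∣?_; ∣m∣n⇒∣m+n; ∣m+n∣m⇒∣n; *-monoʳ-∣; *-pres-∣; ∣-trans; ∣⇒≤; 1∣_; m∣m*n; divides; ∣1⇒≡1; 0∣⇒≡0; n∣m⇒m%n≡0; ∣m⇒∣m*n; ∣n⇒∣m*n)
open import Data.Nat.Induction using (<-wellFounded)
open import Induction.WellFounded using (Acc; acc)
open import Data.Nat.Tactic.RingSolver using (solve-∀)
open import Data.Empty using (⊥)
open import Data.Fin.Properties using (splitAt-↑ˡ; splitAt-↑ʳ; punchInᵢ≢i; punchIn-punchOut; suc-injective; ¬Fin0)
open import Data.Bool as Bool using (Bool; true; false; _∧_; if_then_else_)
import Data.List.Properties as List
open import Relation.Nullary.Decidable using (decidable-stable)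
import Algebra.Properties.Semiring.Sum
open import Data.Nat.Combinatorics using (_C_; nCk+nC[k+1]≡[n+1]C[k+1]; nC1≡n)
open import Function.Bundles using (mk↔ₛ′)
import Algebra.Properties.CommutativeMonoid.Sum
open import Data.Integer.Tactic.RingSolver using () renaming (solve-∀ to ℤ-solve-∀)
import Data.Vec.Properties as Vec
open import Data.Nat.GCD using (GCD; module Bézout; gcd; gcd-GCD; gcd[m,n]∣m; gcd[m,n]∣n; c*gcd[m,n]≡gcd[cm,cn])
open import Data.Nat.Coprimality using (Coprime; coprime-divisor)
open import Data.Nat.DivMod using (m≡m%n+[m/n]*n)
open import Data.Integer.DivMod using (_/ℕ_; _%ℕ_; n%ℕd<d; a≡a%ℕn+[a/ℕn]*n)

-- Equality in the field is neither decidable nor stable, yet the search for an eigenvector keeps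
-- asking whether a vector vanishes. The linear algebra is therefore done under a double negation,
-- over a field whose equality has been made stable. Nothing is lost: only equations between
-- integers and the negation r ≠ 0 are extracted from it, and both survive a double negation. No
-- bases or dimension theory occur. A linear map is a function with an adjoint, a subspace is an
-- isometric image of some `V s`, and subspaces are split off by Householder reflections. These need
-- square roots of squared lengths; apart from them the field supplies only roots of odd polynomials
-- and of one nonnegative discriminant. The arithmetic part stays over the integers: an isometry
-- over ℚ becomes an integral linear map that multiplies the form by a nonzero square. Pfister's
-- theorem applies to r ≤ 2^k because r = 1 + ⋯ + 1 is then a value of the form in 2^k variables.

module DoubleNegation where
  infixl 1 _>>=_
  _>>=_ : ∀ {a b} {P : Set a} {Q : Set b} → ¬ ¬ P → (P → ¬ ¬ Q) → ¬ ¬ Q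
  (m >>= f) k = m (λ p → f p k)

  return : ∀ {a} {P : Set a} → P → ¬ ¬ P
  return p k = k p

  lem : ∀ {a} (P : Set a) → ¬ ¬ (P ⊎ ¬ P)
  lem P k = k (inj₂ (k ∘ inj₁))

  ∀-Fin : ∀ {a} n {P : Fin n → Set a} → (∀ i → ¬ ¬ P i) → ¬ ¬ (∀ i → P i)
  ∀-Fin zero    h k = k λ ()
  ∀-Fin (suc n) h k = h zero λ p → ∀-Fin n (h ∘ suc) λ ps → k λ { zero → p ; (suc i) → ps i }

-- Ring solving over an abstract commutative ring

module IntegerCoefficients {c ℓ} (R : CommutativeRing c ℓ) where
  open CommutativeRing R
  open import Algebra.Properties.Ring ring
    using (-‿distribˡ-*; -‿distribʳ-*; -0#≈0#; -‿involutive)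
  open import Algebra.Properties.AbelianGroup +-abelianGroup using (⁻¹-∙-comm)
  open import Algebra.Properties.Semiring.Mult semiring using (×-homo-+; ×1-homo-*) renaming (_×_ to _×′_)
  open import Relation.Binary.Reasoning.Setoid setoid

  -- The canonical map from ℤ. With coefficients in ℤ the solver can recognise those that cancel,
  -- although equality in `R` cannot be tested.
  embed : ℤ → Carrier
  embed (+ n)    = n ×′ 1#
  embed -[1+ n ] = - (suc n ×′ 1#)

  embed-⊖ : ∀ m n → embed (m ℤ.⊖ n) ≈ (m ×′ 1#) + - (n ×′ 1#)
  embed-⊖ m zero = sym (trans (+-congˡ -0#≈0#) (+-identityʳ _))
  embed-⊖ zero (suc n) = sym (+-identityˡ _)
  embed-⊖ (suc m) (suc n) = begin
    embed (suc m ℤ.⊖ suc n)                        ≡⟨ ≡.cong embed (ℤ.[1+m]⊖[1+n]≡m⊖n m n) ⟩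
    embed (m ℤ.⊖ n)                                ≈⟨ embed-⊖ m n ⟩
    M + - N                                        ≈⟨ +-congʳ (+-identityʳ M) ⟨
    (M + 0#) + - N                                 ≈⟨ +-congʳ (+-congˡ (-‿inverseʳ 1#)) ⟨
    (M + (1# + - 1#)) + - N                        ≈⟨ +-congʳ (+-assoc M 1# (- 1#)) ⟨
    ((M + 1#) + - 1#) + - N                        ≈⟨ +-assoc _ _ _ ⟩
    (M + 1#) + (- 1# + - N)                        ≈⟨ +-cong (+-comm M 1#) (⁻¹-∙-comm 1# N) ⟩
    (1# + M) + - (1# + N)                          ∎
    where
    M = m ×′ 1#
    N = n ×′ 1#

  embed-neg : ∀ i → embed (ℤ.- i) ≈ - embed i
  embed-neg (+ zero)  = sym -0#≈0#
  embed-neg (+ suc n) = refl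
  embed-neg -[1+ n ]  = sym (-‿involutive _)

  embed-+ : ∀ i j → embed (i ℤ.+ j) ≈ embed i + embed j
  embed-+ (+ m)    (+ n)    = ×-homo-+ 1# m n
  embed-+ (+ m)    -[1+ n ] = embed-⊖ m (suc n)
  embed-+ -[1+ m ] (+ n)    = trans (embed-⊖ n (suc m)) (+-comm _ _)
  embed-+ -[1+ m ] -[1+ n ] = begin
    - (suc (suc (m ℕ.+ n)) ×′ 1#)      ≡⟨ ≡.cong (λ k → - (k ×′ 1#)) (≡.cong suc (≡.sym (ℕ.+-suc m n))) ⟩
    - ((suc m ℕ.+ suc n) ×′ 1#)        ≈⟨ -‿cong (×-homo-+ 1# (suc m) (suc n)) ⟩
    - (suc m ×′ 1# + suc n ×′ 1#)      ≈⟨ ⁻¹-∙-comm _ _ ⟨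
    - (suc m ×′ 1#) + - (suc n ×′ 1#)  ∎

  embed-pos-* : ∀ m n → embed (+ m ℤ.* + n) ≈ embed (+ m) * embed (+ n)
  embed-pos-* m n = trans (reflexive (≡.cong embed (≡.sym (ℤ.pos-* m n)))) (×1-homo-* m n)

  embed-*ʳ : ∀ m j → embed (+ m ℤ.* j) ≈ embed (+ m) * embed j
  embed-*ʳ m (+ n)    = embed-pos-* m n
  embed-*ʳ m -[1+ n ] = begin
    embed (+ m ℤ.* ℤ.- + suc n)       ≡⟨ ≡.cong embed (ℤ.neg-distribʳ-* (+ m) (+ suc n)) ⟨
    embed (ℤ.- (+ m ℤ.* + suc n))     ≈⟨ embed-neg (+ m ℤ.* + suc n) ⟩
    - embed (+ m ℤ.* + suc n)         ≈⟨ -‿cong (embed-pos-* m (suc n)) ⟩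
    - (embed (+ m) * embed (+ suc n)) ≈⟨ -‿distribʳ-* _ _ ⟩
    embed (+ m) * embed -[1+ n ]      ∎

  embed-* : ∀ i j → embed (i ℤ.* j) ≈ embed i * embed j
  embed-* (+ m)    j = embed-*ʳ m j
  embed-* -[1+ m ] j = begin
    embed (ℤ.- + suc m ℤ.* j)       ≡⟨ ≡.cong embed (ℤ.neg-distribˡ-* (+ suc m) j) ⟨
    embed (ℤ.- (+ suc m ℤ.* j))     ≈⟨ embed-neg (+ suc m ℤ.* j) ⟩
    - embed (+ suc m ℤ.* j)         ≈⟨ -‿cong (embed-*ʳ (suc m) j) ⟩
    - (embed (+ suc m) * embed j)   ≈⟨ -‿distribˡ-* _ _ ⟩
    embed -[1+ m ] * embed j        ∎

  embed-1 : embed (+ 1) ≈ 1#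
  embed-1 = +-identityʳ 1#

  morphism : ℤ.+-*-rawRing -Raw-AlmostCommutative⟶ fromCommutativeRing R
  morphism = record
    { ⟦_⟧    = embed
    ; +-homo = embed-+
    ; *-homo = embed-*
    ; -‿homo = embed-neg
    ; 0-homo = refl
    ; 1-homo = embed-1
    }

  embed-≟ : ∀ i j → Maybe (embed i ≈ embed j)
  embed-≟ i j with i ℤ.≟ j
  ... | yes i≡j = just (reflexive (≡.cong embed i≡j))
  ... | no _    = nothing

  open Algebra.Solver.Ring ℤ.+-*-rawRing (fromCommutativeRing R) morphism embed-≟ public
    using (solve; _:=_; con; _:+_; _:*_; _:-_; :-_)

-- Replacing ≈ by its double negation makes equality stable without changing
-- which elements are apart from each other.
module Stabilisation {c ℓ} (R : RealClosedField c ℓ) where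
  open RealClosedField R
  open DoubleNegation

  private
    _≈′_ _≤′_ : Carrier → Carrier → Set ℓ
    x ≈′ y = ¬ ¬ (x ≈ y)
    x ≤′ y = ¬ ¬ (x ≤ y)

    module O = IsTotalOrder isTotalOrder

    η : ∀ {a} {P : Set a} → P → ¬ ¬ P
    η = return

    stableRing : CommutativeRing c ℓ
    stableRing = record
      { Carrier = Carrier ; _≈_ = _≈′_ ; _+_ = _+_ ; _*_ = _*_ ; -_ = -_ ; 0# = 0# ; 1# = 1#
      ; isCommutativeRing = record
        { isRing = record
          { +-isAbelianGroup = record
            { isGroup = record
              { isMonoid = record
                { isSemigroup = record
                  { isMagma = record
                    { isEquivalence = ≈′-isEquivalence
                    ; ∙-cong = λ p q → p >>= λ p → q >>= λ q → η (+-cong p q) }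
                  ; assoc = λ x y z → η (+-assoc x y z) }
                ; identity = (λ x → η (+-identityˡ x)) , (λ x → η (+-identityʳ x)) }
              ; inverse = (λ x → η (-‿inverseˡ x)) , (λ x → η (-‿inverseʳ x))
              ; ⁻¹-cong = λ p → p >>= λ p → η (-‿cong p) }
            ; comm = λ x y → η (+-comm x y) }
          ; *-cong = λ p q → p >>= λ p → q >>= λ q → η (*-cong p q)
          ; *-assoc = λ x y z → η (*-assoc x y z)
          ; *-identity = (λ x → η (*-identityˡ x)) , (λ x → η (*-identityʳ x))
          ; distrib = (λ x y z → η (distribˡ x y z)) , (λ x y z → η (distribʳ x y z)) }
        ; *-comm = λ x y → η (*-comm x y) } }
      where
      ≈′-isEquivalence = record
        { refl  = η refl
        ; sym   = λ p → p >>= λ p → η (sym p)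
        ; trans = λ p q → p >>= λ p → q >>= λ q → η (trans p q) }

    evalPoly-stable : ∀ as x → evalPoly stableRing as x ≡ evalPoly commutativeRing as x
    evalPoly-stable [] x = ≡.refl
    evalPoly-stable (a ∷ as) x = ≡.cong (λ t → a + x * t) (evalPoly-stable as x)

    sqrt′ : ∀ x → 0# ≤′ x → ∃ λ y → (y * y) ≈′ x
    sqrt′ x 0≤x with O.total 0# x
    ... | inj₁ 0≤x = let y , eq = sqrt x 0≤x in y , η eq
    -- Only the double negation of 0 ≤ x is given, so `sqrt` does not apply; but together with x ≤ 0
    -- it makes x vanish in the new sense, and 0 is a root.
    ... | inj₂ x≤0 = 0# , (0≤x >>= λ 0≤x → η (trans (zeroˡ 0#) (O.antisym 0≤x x≤0)))

  stableField : RealClosedField c ℓ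
  stableField = record
    { commutativeRing = stableRing
    ; _≤_ = _≤′_
    ; isTotalOrder = record
      { isPartialOrder = record
        { isPreorder = record
          { isEquivalence = CommutativeRing.isEquivalence stableRing
          ; reflexive = λ p → p >>= λ p → η (O.reflexive p)
          ; trans = λ p q → p >>= λ p → q >>= λ q → η (O.trans p q) }
        ; antisym = λ p q → p >>= λ p → q >>= λ q → η (O.antisym p q) }
      ; total = λ x y → Sum.map η η (O.total x y) }
    ; +-mono-≤ = λ z p → p >>= λ p → η (+-mono-≤ z p)
    ; *-nonneg = λ p q → p >>= λ p → q >>= λ q → η (*-nonneg p q)
    ; 0≉1 = λ p → p 0≉1
    ; inverse = λ x x≉0 → let y , eq = inverse x (x≉0 ∘ η) in y , η eq
    ; sqrt = sqrt′
    ; oddRoot = λ k as → let x , eq = oddRoot k as in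
        x , ≡.subst (_≈′ 0#) (≡.sym (evalPoly-stable (Vec.toList as List.++ 1# ∷ []) x)) (η eq)
    }

Stable : ∀ {c ℓ} → RealClosedField c ℓ → Set (c ⊔ ℓ)
Stable R = ∀ {x y} → ¬ ¬ (x ≈ y) → x ≈ y
  where open RealClosedField R

stableField-stable : ∀ {c ℓ} (R : RealClosedField c ℓ) → Stable (Stabilisation.stableField R)
stableField-stable R ¬¬p k = ¬¬p (λ p → p k)

-- Ordered fields

module OrderedField {c ℓ} (R : RealClosedField c ℓ) where
  open RealClosedField R
  open IsTotalOrder isTotalOrder public
    using (total; antisym) renaming (trans to ≤-trans; ≤-respˡ-≈ to ≤-respˡ; ≤-respʳ-≈ to ≤-respʳ; reflexive to ≤-reflexive)
  open IntegerCoefficients commutativeRing public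
  open import Data.Integer using (+_)

  0≤-neg : ∀ {x} → x ≤ 0# → 0# ≤ (- x)
  0≤-neg {x} x≤0 = ≤-respˡ (-‿inverseʳ x) (≤-respʳ (+-identityˡ _) (+-mono-≤ (- x) x≤0))

  +-nonneg : ∀ {x y} → 0# ≤ x → 0# ≤ y → 0# ≤ (x + y)
  +-nonneg {x} {y} 0≤x 0≤y = ≤-trans 0≤y (≤-respˡ (+-identityˡ y) (+-mono-≤ y 0≤x))

  square-nonneg : ∀ x → 0# ≤ (x * x)
  square-nonneg x with total 0# x
  ... | inj₁ 0≤x = *-nonneg 0≤x 0≤x
  ... | inj₂ x≤0 = ≤-respʳ (solve 1 (λ x → :- x :* :- x := x :* x) refl x)
                     (*-nonneg (0≤-neg x≤0) (0≤-neg x≤0))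

  nonneg-sum≈0ˡ : ∀ {x y} → 0# ≤ x → 0# ≤ y → (x + y) ≈ 0# → x ≈ 0#
  nonneg-sum≈0ˡ {x} {y} 0≤x 0≤y x+y≈0 =
    antisym (≤-respʳ x+y≈0 (≤-respʳ (+-comm y x) (≤-respˡ (+-identityˡ x) (+-mono-≤ x 0≤y)))) 0≤x

  nonneg-sum≈0ʳ : ∀ {x y} → 0# ≤ x → 0# ≤ y → (x + y) ≈ 0# → y ≈ 0#
  nonneg-sum≈0ʳ 0≤x 0≤y x+y≈0 = nonneg-sum≈0ˡ 0≤y 0≤x (trans (+-comm _ _) x+y≈0)

  0≤1 : 0# ≤ 1#
  0≤1 = ≤-respʳ (*-identityˡ 1#) (square-nonneg 1#)

  0≤embed : ∀ n → 0# ≤ embed (+ n)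
  0≤embed zero    = ≤-reflexive refl
  0≤embed (suc n) = +-nonneg 0≤1 (0≤embed n)

  -- Characteristic zero: in 1 + n = 0 both summands are nonnegative, so 1 would vanish.
  embed-suc≉0 : ∀ n → ¬ (embed (+ suc n) ≈ 0#)
  embed-suc≉0 n eq = 0≉1 (sym (nonneg-sum≈0ˡ 0≤1 (0≤embed n) eq))

  2≉0 : ¬ ((1# + 1#) ≈ 0#)
  2≉0 eq = 0≉1 (sym (nonneg-sum≈0ˡ 0≤1 0≤1 eq))

  module _ where
    open import Relation.Binary.Reasoning.Setoid setoid

    *-cancelˡ : ∀ {a x y} → ¬ (a ≈ 0#) → (a * x) ≈ (a * y) → x ≈ y
    *-cancelˡ {a} {x} {y} a≉0 ax≈ay with inverse a a≉0
    ... | a⁻¹ , aa⁻¹≈1 = trans (sym (undo x)) (trans (*-congˡ ax≈ay) (undo y))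
      where
      undo : ∀ z → (a⁻¹ * (a * z)) ≈ z
      undo z = begin
        a⁻¹ * (a * z)  ≈⟨ solve 3 (λ a b z → b :* (a :* z) := a :* b :* z) refl a a⁻¹ z ⟩
        a * a⁻¹ * z    ≈⟨ *-congʳ aa⁻¹≈1 ⟩
        1# * z         ≈⟨ *-identityˡ z ⟩
        z              ∎

  x*y≈0⇒y≈0 : ∀ {x y} → ¬ (x ≈ 0#) → (x * y) ≈ 0# → y ≈ 0#
  x*y≈0⇒y≈0 {x} x≉0 xy≈0 = *-cancelˡ x≉0 (trans xy≈0 (sym (zeroʳ x)))

  *-≉0 : ∀ {x y} → ¬ (x ≈ 0#) → ¬ (y ≈ 0#) → ¬ ((x * y) ≈ 0#)
  *-≉0 x≉0 y≉0 = y≉0 ∘ x*y≈0⇒y≈0 x≉0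

  x-y≈0⇒x≈y : ∀ {x y} → (x + - y) ≈ 0# → x ≈ y
  x-y≈0⇒x≈y {x} {y} eq = begin
    x               ≈⟨ solve 2 (λ x y → x := (x :+ :- y) :+ y) refl x y ⟩
    (x + - y) + y   ≈⟨ +-congʳ eq ⟩
    0# + y          ≈⟨ +-identityˡ y ⟩
    y               ∎
    where open import Relation.Binary.Reasoning.Setoid setoid

-- Euclidean vectors over a real closed field

module Vectors {c ℓ} (R : RealClosedField c ℓ) (stable : Stable R) where
  open RealClosedField R hiding (zero)
  open OrderedField R
  open DoubleNegation
  open import Algebra.Properties.Semiring.Sum semiring public
    using (sum; sum-cong-≋; ∑-comm; ∑-distrib-+; *-distribˡ-sum; *-distribʳ-sum; sum-replicate-zero)
  open import Relation.Binary.Reasoning.Setoid setoid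

  square≈0 : ∀ {x} → (x * x) ≈ 0# → x ≈ 0#
  square≈0 xx≈0 = stable λ x≉0 → *-≉0 x≉0 x≉0 xx≈0

  V : ℕ → Set c
  V d = Fin d → Carrier

  infix 4 _≋_
  -- A record, so that the two vectors can be inferred from a proof of their equality.
  record _≋_ {d} (x y : V d) : Set ℓ where
    constructor ptw
    field at : ∀ i → x i ≈ y i
  open _≋_ public

  infixl 6 _⊕_
  infixr 7 _·_
  _⊕_ : ∀ {d} → V d → V d → V d
  (x ⊕ y) i = x i + y i

  _·_ : ∀ {d} → Carrier → V d → V d
  (a · x) i = a * x i

  0v : ∀ {d} → V d
  0v _ = 0#

  δ : ∀ {d} → Fin d → V d
  δ zero    zero    = 1#
  δ zero    (suc j) = 0#
  δ (suc i) zero    = 0#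
  δ (suc i) (suc j) = δ i j

  ≋-refl : ∀ {d} {x : V d} → x ≋ x
  ≋-refl .at i = refl

  ≋-sym : ∀ {d} {x y : V d} → x ≋ y → y ≋ x
  ≋-sym p .at i = sym (p .at i)

  ≋-trans : ∀ {d} {x y z : V d} → x ≋ y → y ≋ z → x ≋ z
  ≋-trans p q .at i = trans (p .at i) (q .at i)

  ≋-setoid : ℕ → Setoid c ℓ
  ≋-setoid d = record
    { Carrier = V d ; _≈_ = _≋_
    ; isEquivalence = record { refl = ≋-refl ; sym = ≋-sym ; trans = ≋-trans } }

  ⊕-cong : ∀ {d} {x x′ y y′ : V d} → x ≋ x′ → y ≋ y′ → x ⊕ y ≋ x′ ⊕ y′
  ⊕-cong p q .at i = +-cong (p .at i) (q .at i)

  ·-cong : ∀ {d} {a b} {x y : V d} → a ≈ b → x ≋ y → a · x ≋ b · y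
  ·-cong p q .at i = *-cong p (q .at i)

  ·-congˡ : ∀ {d a} {x y : V d} → x ≋ y → a · x ≋ a · y
  ·-congˡ = ·-cong refl

  dot : ∀ {d} → V d → V d → Carrier
  dot x y = sum (λ i → x i * y i)

  dot-cong : ∀ {d} {x x′ y y′ : V d} → x ≋ x′ → y ≋ y′ → dot x y ≈ dot x′ y′
  dot-cong p q = sum-cong-≋ (λ i → *-cong (p .at i) (q .at i))

  dot-comm : ∀ {d} (x y : V d) → dot x y ≈ dot y x
  dot-comm x y = sum-cong-≋ (λ i → *-comm (x i) (y i))

  dot-⊕ˡ : ∀ {d} (x y z : V d) → dot (x ⊕ y) z ≈ dot x z + dot y z
  dot-⊕ˡ x y z = trans (sum-cong-≋ (λ i → distribʳ (z i) (x i) (y i)))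
                       (∑-distrib-+ (λ i → x i * z i) (λ i → y i * z i))

  dot-·ˡ : ∀ {d} a (x y : V d) → dot (a · x) y ≈ a * dot x y
  dot-·ˡ a x y = trans (sum-cong-≋ (λ i → *-assoc a (x i) (y i)))
                       (sym (*-distribˡ-sum a (λ i → x i * y i)))

  dot-⊕ʳ : ∀ {d} (x y z : V d) → dot x (y ⊕ z) ≈ dot x y + dot x z
  dot-⊕ʳ x y z = trans (dot-comm x (y ⊕ z)) (trans (dot-⊕ˡ y z x) (+-cong (dot-comm y x) (dot-comm z x)))

  dot-·ʳ : ∀ {d} a (x y : V d) → dot x (a · y) ≈ a * dot x y
  dot-·ʳ a x y = trans (dot-comm x (a · y)) (trans (dot-·ˡ a y x) (*-congˡ (dot-comm y x)))

  dot-0ˡ : ∀ {d} {z : V d} (y : V d) → z ≋ 0v → dot z y ≈ 0#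
  dot-0ˡ {d} y z≋0 = trans (sum-cong-≋ (λ i → trans (*-congʳ (z≋0 .at i)) (zeroˡ (y i)))) (sum-replicate-zero d)

  dot-0ʳ : ∀ {d} (x : V d) {z} → z ≋ 0v → dot x z ≈ 0#
  dot-0ʳ x {z} z≋0 = trans (dot-comm x z) (dot-0ˡ x z≋0)

  dot-δ : ∀ {d} (x : V d) i → dot x (δ i) ≈ x i
  dot-δ {suc d} x zero    = trans (+-cong (*-identityʳ _) (dot-0ʳ (tail x) ≋-refl)) (+-identityʳ _)
  dot-δ {suc d} x (suc i) = trans (+-cong (zeroʳ _) (dot-δ (tail x) i)) (+-identityˡ _)

  dot-ext : ∀ {d} {x y : V d} → (∀ z → dot x z ≈ dot y z) → x ≋ y
  dot-ext {x = x} {y} h .at i = trans (sym (dot-δ x i)) (trans (h (δ i)) (dot-δ y i))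

  dot-nonneg : ∀ {d} (x : V d) → 0# ≤ dot x x
  dot-nonneg {zero}  x = ≤-reflexive refl
  dot-nonneg {suc d} x = +-nonneg (square-nonneg (x zero)) (dot-nonneg (tail x))

  -- A vanishing sum of squares vanishes termwise by the order; that a square vanishes only at zero
  -- rests on stable equality.
  dot-definite : ∀ {d} {x : V d} → dot x x ≈ 0# → x ≋ 0v
  dot-definite {x = x} eq .at zero =
    square≈0 (nonneg-sum≈0ˡ (square-nonneg (x zero)) (dot-nonneg (tail x)) eq)
  dot-definite {x = x} eq .at (suc i) =
    dot-definite (nonneg-sum≈0ʳ (square-nonneg (x zero)) (dot-nonneg (tail x)) eq) .at i

  Nonzero : ∀ {d} → V d → Set ℓ
  Nonzero x = ¬ (x ≋ 0v)

  nonzero-· : ∀ {d} {x : V d} {a} → ¬ (a ≈ 0#) → Nonzero x → Nonzero (a · x)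
  nonzero-· a≉0 x≠0 ax≋0 = x≠0 (ptw λ i → x*y≈0⇒y≈0 a≉0 (ax≋0 .at i))

  δ-nonzero : ∀ {d} (i : Fin d) → Nonzero (δ i)
  δ-nonzero {suc d} zero    δ≋0 = 0≉1 (sym (δ≋0 .at zero))
  δ-nonzero {suc d} (suc i) δ≋0 = δ-nonzero i (ptw (λ j → δ≋0 .at (suc j)))

  -- Linearity is never assumed: a function with an adjoint respects equality, sums and scalars
  -- because the dot product is nondegenerate. For an isometric embedding the adjoint is at the same
  -- time the projection back to coordinates.
  record Adjoint {s d} (f : V s → V d) (g : V d → V s) : Set (c ⊔ ℓ) where
    constructor adjoint
    field adj : ∀ x y → dot (f x) y ≈ dot x (g y)
  open Adjoint public

  SelfAdjoint : ∀ {d} → (V d → V d) → Set (c ⊔ ℓ)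
  SelfAdjoint f = Adjoint f f

  adjoint-sym : ∀ {s d} {f : V s → V d} {g : V d → V s} → Adjoint f g → Adjoint g f
  adjoint-sym {f = f} {g} a .adj x y =
    trans (dot-comm (g x) y) (trans (sym (a .adj y x)) (dot-comm (f y) x))

  module _ {s d} {f : V s → V d} {g : V d → V s} (a : Adjoint f g) where
    lin-cong : ∀ {x y} → x ≋ y → f x ≋ f y
    lin-cong {x} {y} x≋y = dot-ext λ z → begin
      dot (f x) z  ≈⟨ a .adj x z ⟩
      dot x (g z)  ≈⟨ dot-cong x≋y ≋-refl ⟩
      dot y (g z)  ≈⟨ a .adj y z ⟨
      dot (f y) z  ∎

    lin-⊕ : ∀ x y → f (x ⊕ y) ≋ f x ⊕ f y
    lin-⊕ x y = dot-ext λ z → begin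
      dot (f (x ⊕ y)) z            ≈⟨ a .adj (x ⊕ y) z ⟩
      dot (x ⊕ y) (g z)            ≈⟨ dot-⊕ˡ x y (g z) ⟩
      dot x (g z) + dot y (g z)    ≈⟨ +-cong (a .adj x z) (a .adj y z) ⟨
      dot (f x) z + dot (f y) z    ≈⟨ dot-⊕ˡ (f x) (f y) z ⟨
      dot (f x ⊕ f y) z            ∎

    lin-· : ∀ k x → f (k · x) ≋ k · f x
    lin-· k x = dot-ext λ z → begin
      dot (f (k · x)) z    ≈⟨ a .adj (k · x) z ⟩
      dot (k · x) (g z)    ≈⟨ dot-·ˡ k x (g z) ⟩
      k * dot x (g z)      ≈⟨ *-congˡ (a .adj x z) ⟨
      k * dot (f x) z      ≈⟨ dot-·ˡ k (f x) z ⟨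
      dot (k · f x) z      ∎

    lin-0 : ∀ {x} → x ≋ 0v → f x ≋ 0v
    lin-0 {x} x≋0 = ≋-trans (lin-cong {x} {0# · x} (ptw λ i → trans (x≋0 .at i) (sym (zeroˡ _))))
                      (≋-trans (lin-· 0# x) (ptw λ i → zeroˡ (f x i)))

  adjoint-∘ : ∀ {r s d} {f : V s → V d} {g} {f′ : V r → V s} {g′} →
              Adjoint f g → Adjoint f′ g′ → Adjoint (f ∘ f′) (g′ ∘ g)
  adjoint-∘ a a′ .adj x y = trans (a .adj _ y) (a′ .adj x _)

  -- The compression of `A` to the range of `S`, which is how an operator is restricted to a
  -- subspace.
  restrict-self : ∀ {s d} {A : V d → V d} {S : V s → V d} {S* : V d → V s} →
                  SelfAdjoint A → Adjoint S S* → SelfAdjoint (S* ∘ A ∘ S)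
  restrict-self A-self S-adj = adjoint-∘ (adjoint-sym S-adj) (adjoint-∘ A-self S-adj)

  EigenPair : ∀ {d} → (V d → V d) → Carrier → V d → Set ℓ
  EigenPair A μ x = Nonzero x × A x ≋ μ · x

  HasEigen : ∀ {d} → (V d → V d) → Set (c ⊔ ℓ)
  HasEigen A = ∃₂ (EigenPair A)

  -- The reflection in the hyperplane orthogonal to u - γ e₀, where γ² = ⟨u,u⟩.
  record Reflection {d} (u : V (suc d)) : Set (c ⊔ ℓ) where
    field
      H           : V (suc d) → V (suc d)
      self        : SelfAdjoint H
      involutive  : ∀ x → H (H x) ≋ x
      γ           : Carrier
      γ≉0         : ¬ (γ ≈ 0#)
      image       : H u ≋ γ · δ zero

    image⁻¹ : γ · H (δ zero) ≋ u
    image⁻¹ = ≋-trans (≋-sym (lin-· self γ (δ zero)))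
                (≋-trans (lin-cong self (≋-sym image)) (involutive u))

    H-nonzero : ∀ {x} → Nonzero x → Nonzero (H x)
    H-nonzero {x} x≠0 Hx≋0 = x≠0 (≋-trans (≋-sym (involutive x)) (lin-0 self Hx≋0))

  -- The sign of γ is chosen so that γ u₀ ≤ 0, which makes u - γ e₀ nonzero.
  reflection : ∀ {d} (u : V (suc d)) → Nonzero u → Reflection u
  reflection {d} u u≠0 = record
    { H = H ; self = adjoint H-adj ; involutive = H-inv ; γ = γ ; γ≉0 = γ≉0 ; image = H-image }
    where
    s u₀ : Carrier
    s = dot u u
    u₀ = u zero

    choice : ∃ λ γ → γ * γ ≈ s × 0# ≤ (- (γ * u₀))
    choice with sqrt s (dot-nonneg u)
    ... | y , yy≈s with total 0# (y * u₀)
    ...   | inj₁ 0≤yu = - y , trans (solve 1 (λ y → :- y :* :- y := y :* y) refl y) yy≈s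
                        , ≤-respʳ (solve 2 (λ y u → y :* u := :- (:- y :* u)) refl y u₀) 0≤yu
    ...   | inj₂ yu≤0 = y , yy≈s , 0≤-neg yu≤0

    γ = proj₁ choice
    γγ≈s = proj₁ (proj₂ choice)

    s≉0 : ¬ (s ≈ 0#)
    s≉0 = u≠0 ∘ dot-definite

    γ≉0 : ¬ (γ ≈ 0#)
    γ≉0 γ≈0 = s≉0 (trans (sym γγ≈s) (trans (*-congʳ γ≈0) (zeroˡ γ)))

    -- By `dot-w-w` this is half of ⟨w,w⟩ for w = u - γ e₀. Hence x - ⟨w,x⟩ w / k is the reflection
    -- along w.
    k : Carrier
    k = s + - (γ * u₀)

    k≉0 : ¬ (k ≈ 0#)
    k≉0 = s≉0 ∘ nonneg-sum≈0ˡ (dot-nonneg u) (proj₂ (proj₂ choice))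

    h : Carrier
    h = proj₁ (inverse k k≉0)

    kh≈1 : k * h ≈ 1#
    kh≈1 = proj₂ (inverse k k≉0)

    w : V (suc d)
    w = u ⊕ (- γ) · δ zero

    dot-w : ∀ x → dot w x ≈ dot u x + - γ * x zero
    dot-w x = begin
      dot w x                                  ≈⟨ dot-⊕ˡ u ((- γ) · δ zero) x ⟩
      dot u x + dot ((- γ) · δ zero) x         ≈⟨ +-congˡ (dot-·ˡ (- γ) (δ zero) x) ⟩
      dot u x + - γ * dot (δ zero) x           ≈⟨ +-congˡ (*-congˡ (trans (dot-comm (δ zero) x) (dot-δ x zero))) ⟩
      dot u x + - γ * x zero                   ∎

    dot-w-u : dot w u ≈ k
    dot-w-u = trans (dot-w u) (solve 3 (λ s γ u → s :+ :- γ :* u := s :+ :- (γ :* u)) refl s γ u₀)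

    dot-w-w : dot w w ≈ k + k
    dot-w-w = begin
      dot w w                                   ≈⟨ dot-w w ⟩
      dot u w + - γ * (u₀ + - γ * 1#)           ≈⟨ +-cong (trans (dot-comm u w) dot-w-u) (*-congˡ (+-congˡ (*-identityʳ _))) ⟩
      k + - γ * (u₀ + - γ)                      ≈⟨ +-congˡ (solve 2 (λ γ u → :- γ :* (u :+ :- γ) := γ :* γ :+ :- (γ :* u)) refl γ u₀) ⟩
      k + (γ * γ + - (γ * u₀))                  ≈⟨ +-congˡ (+-congʳ γγ≈s) ⟩
      k + k                                     ∎

    H : V (suc d) → V (suc d)
    H x = x ⊕ (- (h * dot w x)) · w

    H-adj : ∀ x y → dot (H x) y ≈ dot x (H y)
    H-adj x y = begin
      dot (H x) y                                  ≈⟨ dot-⊕ˡ x ((- (h * dot w x)) · w) y ⟩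
      dot x y + dot ((- (h * dot w x)) · w) y      ≈⟨ +-congˡ (dot-·ˡ _ w y) ⟩
      dot x y + - (h * dot w x) * dot w y          ≈⟨ +-congˡ (solve 3 (λ h a b → :- (h :* a) :* b := :- (h :* b) :* a) refl h (dot w x) (dot w y)) ⟩
      dot x y + - (h * dot w y) * dot w x          ≈⟨ +-congˡ (*-congˡ (dot-comm w x)) ⟩
      dot x y + - (h * dot w y) * dot x w          ≈⟨ +-congˡ (dot-·ʳ _ x w) ⟨
      dot x y + dot x ((- (h * dot w y)) · w)      ≈⟨ dot-⊕ʳ x y ((- (h * dot w y)) · w) ⟨
      dot x (H y)                                  ∎

    dot-w-H : ∀ x → dot w (H x) ≈ - dot w x
    dot-w-H x = begin
      dot w (H x)                                       ≈⟨ dot-⊕ʳ w x ((- (h * dot w x)) · w) ⟩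
      dot w x + dot w ((- (h * dot w x)) · w)           ≈⟨ +-congˡ (dot-·ʳ _ w w) ⟩
      dot w x + - (h * dot w x) * dot w w               ≈⟨ +-congˡ (*-congˡ dot-w-w) ⟩
      dot w x + - (h * dot w x) * (k + k)               ≈⟨ solve 3 (λ a h k → a :+ :- (h :* a) :* (k :+ k) := a :+ :- (k :* h :* a :+ k :* h :* a)) refl (dot w x) h k ⟩
      dot w x + - (k * h * dot w x + k * h * dot w x)   ≈⟨ +-congˡ (-‿cong (+-cong (trans (*-congʳ kh≈1) (*-identityˡ _)) (trans (*-congʳ kh≈1) (*-identityˡ _)))) ⟩
      dot w x + - (dot w x + dot w x)                   ≈⟨ solve 1 (λ a → a :+ :- (a :+ a) := :- a) refl (dot w x) ⟩
      - dot w x                                         ∎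

    H-inv : ∀ x → H (H x) ≋ x
    H-inv x .at i = begin
      x i + - (h * dot w x) * w i + - (h * dot w (H x)) * w i  ≈⟨ +-congˡ (*-congʳ (-‿cong (*-congˡ (dot-w-H x)))) ⟩
      x i + - (h * dot w x) * w i + - (h * - dot w x) * w i    ≈⟨ solve 4 (λ x h a w → x :+ :- (h :* a) :* w :+ :- (h :* :- a) :* w := x) refl (x i) h (dot w x) (w i) ⟩
      x i                                                       ∎

    H-image : H u ≋ γ · δ zero
    H-image .at i = begin
      u i + - (h * dot w u) * w i              ≈⟨ +-congˡ (*-congʳ (-‿cong (trans (*-congˡ dot-w-u) (trans (*-comm h k) kh≈1)))) ⟩
      u i + - 1# * (u i + - γ * δ zero i)      ≈⟨ +-congˡ (-1*x≈-x _) ⟩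
      u i + - (u i + - γ * δ zero i)           ≈⟨ solve 3 (λ u γ e → u :+ :- (u :+ :- γ :* e) := γ :* e) refl (u i) γ (δ zero i) ⟩
      γ * δ zero i                             ∎
      where open import Algebra.Properties.Ring ring using (-1*x≈-x)

-- Eigenvectors in odd dimension

Odd : ℕ → Set
Odd k = ∃ λ j → k ≡ suc (2 ℕ.* j)

odd-suc-suc : ∀ {k} → Odd k → Odd (suc (suc k))
odd-suc-suc (j , ≡.refl) = suc j , ≡.cong (λ m → suc (suc m)) (≡.sym (ℕ.+-suc j (j ℕ.+ 0)))

odd-suc-suc⁻¹ : ∀ {k} → Odd (suc (suc k)) → Odd k
odd-suc-suc⁻¹ (suc j , eq) =
  j , ℕ.suc-injective (ℕ.suc-injective (≡.trans eq (≡.cong (λ m → suc (suc m)) (ℕ.+-suc j (j ℕ.+ 0)))))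

odd-+ : ∀ e k → Odd (e ℕ.+ k) → Odd e ⊎ Odd k
odd-+ zero          k odd = inj₂ odd
odd-+ (suc zero)    k odd = inj₁ (0 , ≡.refl)
odd-+ (suc (suc e)) k odd with odd-+ e k (odd-suc-suc⁻¹ odd)
... | inj₁ p = inj₁ (odd-suc-suc p)
... | inj₂ q = inj₂ q

module Krylov {c ℓ} (R : RealClosedField c ℓ) (stable : Stable R) where
  open RealClosedField R hiding (zero)
  open OrderedField R
  open Vectors R stable
  open DoubleNegation
  open import Relation.Binary.Reasoning.Setoid setoid

  private
    eval : List Carrier → Carrier → Carrier
    eval = evalPoly commutativeRing

  -- Polynomials are handled as functions. The coefficient vector bounds the degree and, in the
  -- monic case, is what `oddRoot` takes as input.
  record Poly< (e : ℕ) (q : Carrier → Carrier) : Set (c ⊔ ℓ) where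
    field
      coeffs : Vec Carrier e
      spec   : ∀ x → eval (Vec.toList coeffs) x ≈ q x
  open Poly<

  record Monic (e : ℕ) (p : Carrier → Carrier) : Set (c ⊔ ℓ) where
    field
      coeffs : Vec Carrier e
      spec   : ∀ x → eval (Vec.toList coeffs List.++ 1# List.∷ List.[]) x ≈ p x
  open Monic

  const : ∀ k → Poly< 1 (λ _ → k)
  const k .coeffs = k ∷ []
  const k .spec x = trans (+-congˡ (zeroʳ x)) (+-identityʳ k)

  scale : ∀ {e q} k → Poly< e q → Poly< e (λ x → k * q x)
  scale k P .coeffs = Vec.map (k *_) (P .coeffs)
  scale k P .spec x = trans (lemma (P .coeffs)) (*-congˡ (P .spec x))
    where
    lemma : ∀ {e} (as : Vec Carrier e) → eval (Vec.toList (Vec.map (k *_) as)) x ≈ k * eval (Vec.toList as) x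
    lemma [] = sym (zeroʳ k)
    lemma (a ∷ as) = trans (+-congˡ (*-congˡ (lemma as)))
      (solve 4 (λ k a x t → k :* a :+ x :* (k :* t) := k :* (a :+ x :* t)) refl k a x _)

  add : ∀ {e q q′} → Poly< e q → Poly< e q′ → Poly< e (λ x → q x + q′ x)
  add P Q .coeffs = Vec.zipWith _+_ (P .coeffs) (Q .coeffs)
  add P Q .spec x = trans (lemma (P .coeffs) (Q .coeffs)) (+-cong (P .spec x) (Q .spec x))
    where
    lemma : ∀ {e} (as bs : Vec Carrier e) →
            eval (Vec.toList (Vec.zipWith _+_ as bs)) x ≈ eval (Vec.toList as) x + eval (Vec.toList bs) x
    lemma [] [] = sym (+-identityˡ 0#)
    lemma (a ∷ as) (b ∷ bs) = trans (+-congˡ (*-congˡ (lemma as bs)))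
      (solve 5 (λ a b x s t → a :+ b :+ x :* (s :+ t) := a :+ x :* s :+ (b :+ x :* t)) refl a b x _ _)

  weaken : ∀ {e q} → Poly< e q → Poly< (suc e) q
  weaken P .coeffs = P .coeffs Vec.∷ʳ 0#
  weaken P .spec x = trans (lemma (P .coeffs)) (P .spec x)
    where
    lemma : ∀ {e} (as : Vec Carrier e) → eval (Vec.toList (as Vec.∷ʳ 0#)) x ≈ eval (Vec.toList as) x
    lemma [] = trans (+-identityˡ _) (zeroʳ x)
    lemma (a ∷ as) = +-congˡ (*-congˡ (lemma as))

  monic⇒< : ∀ {e p} → Monic e p → Poly< (suc e) p
  monic⇒< P .coeffs = P .coeffs Vec.∷ʳ 1#
  monic⇒< P .spec x = trans (lemma (P .coeffs)) (P .spec x)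
    where
    lemma : ∀ {e} (as : Vec Carrier e) →
            eval (Vec.toList (as Vec.∷ʳ 1#)) x ≈ eval (Vec.toList as List.++ 1# List.∷ List.[]) x
    lemma [] = refl
    lemma (a ∷ as) = +-congˡ (*-congˡ (lemma as))

  monic-shift : ∀ {e p} → Monic e p → Monic (suc e) (λ x → x * p x)
  monic-shift P .coeffs = 0# ∷ P .coeffs
  monic-shift P .spec x = trans (+-identityˡ _) (*-congˡ (P .spec x))

  monic-+ : ∀ {e p q} → Monic e p → Poly< e q → Monic e (λ x → p x + q x)
  monic-+ P Q .coeffs = Vec.zipWith _+_ (P .coeffs) (Q .coeffs)
  monic-+ P Q .spec x = trans (lemma (P .coeffs) (Q .coeffs)) (+-cong (P .spec x) (Q .spec x))
    where
    lemma : ∀ {e} (as bs : Vec Carrier e) →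
            eval (Vec.toList (Vec.zipWith _+_ as bs) List.++ 1# List.∷ List.[]) x ≈
            eval (Vec.toList as List.++ 1# List.∷ List.[]) x + eval (Vec.toList bs) x
    lemma [] [] = sym (+-identityʳ _)
    lemma (a ∷ as) (b ∷ bs) = trans (+-congˡ (*-congˡ (lemma as bs)))
      (solve 5 (λ a b x s t → a :+ b :+ x :* (s :+ t) := a :+ x :* s :+ (b :+ x :* t)) refl a b x _ _)

  monic-linear : ∀ a → Monic 1 (λ x → x + - a)
  monic-linear a .coeffs = - a ∷ []
  monic-linear a .spec x = trans (+-congˡ (*-congˡ (trans (+-congˡ (zeroʳ x)) (+-identityʳ 1#))))
    (trans (+-congˡ (*-identityʳ x)) (+-comm (- a) x))

  odd-root : ∀ {e p} → Odd e → Monic e p → ∃ λ μ → p μ ≈ 0#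
  odd-root (j , ≡.refl) P with oddRoot j (P .coeffs)
  ... | μ , eq = μ , trans (sym (P .spec μ)) eq

  embed-tail : ∀ {d} → V d → V (suc d)
  embed-tail y = 0# F.∷ y

  embed-tail-adjoint : ∀ {d} → Adjoint (embed-tail {d}) tail
  embed-tail-adjoint .adj x y = trans (+-congʳ (zeroˡ _)) (+-identityˡ _)

  embed-tail-nonzero : ∀ {d} {y : V d} → Nonzero y → Nonzero (embed-tail y)
  embed-tail-nonzero y≠0 eq = y≠0 (ptw λ i → eq .at (suc i))

  minor : ∀ {d} → (V (suc d) → V (suc d)) → V d → V d
  minor A = tail ∘ A ∘ embed-tail

  module _ {d} {A : V (suc d) → V (suc d)} (A-self : SelfAdjoint A) where
    minor-self : SelfAdjoint (minor A)
    minor-self = restrict-self A-self embed-tail-adjoint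

    -- The first row of a symmetric matrix is its first column.
    head-embed-tail : ∀ y → A (embed-tail y) zero ≈ dot (tail (A (δ zero))) y
    head-embed-tail y = begin
      A (embed-tail y) zero                  ≈⟨ dot-δ (A (embed-tail y)) zero ⟨
      dot (A (embed-tail y)) (δ zero)        ≈⟨ A-self .adj _ _ ⟩
      dot (embed-tail y) (A (δ zero))        ≈⟨ embed-tail-adjoint .adj y (A (δ zero)) ⟩
      dot y (tail (A (δ zero)))              ≈⟨ dot-comm y (tail (A (δ zero))) ⟩
      dot (tail (A (δ zero))) y              ∎

    apply-cons : ∀ t y → A (t F.∷ y) ≋ t · A (δ zero) ⊕ A (embed-tail y)
    apply-cons t y = ≋-trans (lin-cong A-self split)
      (≋-trans (lin-⊕ A-self (t · δ zero) (embed-tail y)) (⊕-cong (lin-· A-self t (δ zero)) ≋-refl))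
      where
      split : t F.∷ y ≋ t · δ zero ⊕ embed-tail y
      split .at zero    = sym (trans (+-identityʳ _) (*-identityʳ t))
      split .at (suc i) = sym (trans (+-congʳ (zeroʳ t)) (+-identityˡ _))

    -- Orthogonality to the coupling vector `tail (A (δ zero))` kills the head coordinate of the
    -- image. For this reason `complement` in `Cyclic` asks for eigenvectors orthogonal to u.
    lift-eigen : ∀ {μ y} → dot (tail (A (δ zero))) y ≈ 0# → EigenPair (minor A) μ y →
                 EigenPair A μ (embed-tail y)
    lift-eigen {μ} {y} y⊥b (y≠0 , eq) = embed-tail-nonzero y≠0 , ptw λ
      { zero    → trans (head-embed-tail y) (trans y⊥b (sym (zeroʳ μ)))
      ; (suc i) → eq .at i }

  -- The cyclic subspace generated by u: p is the minimal polynomial of u, and x μ is the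
  -- value at u of the quotient (p(A) - p(μ)) / (A - μ).
  record Cyclic {d} (A : V d → V d) (u : V d) : Set (c ⊔ ℓ) where
    field
      e k          : ℕ
      dimension    : e ℕ.+ k ≡ d
      p ψ          : Carrier → Carrier
      p-monic      : Monic e p
      ψ-degree     : Poly< e ψ
      x            : Carrier → V d
      x-nonzero    : ∀ μ → Nonzero (x μ)
      x-resolvent  : ∀ μ → A (x μ) ≋ μ · x μ ⊕ (- p μ) · u
      x-moment     : ∀ μ → dot u (x μ) ≈ ψ μ
      complement   : Odd k → ¬ ¬ ∃₂ λ μ y → dot u y ≈ 0# × EigenPair A μ y

  -- As e + k is odd, one of the two is. If e is, `p` has a root μ, at which the error term of
  -- `x-resolvent` disappears; if k is, the orthogonal complement of the cyclic subspace contributes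
  -- an eigenvector.
  cyclic⇒eigen : ∀ {d A u} → Odd d → Cyclic {d} A u → ¬ ¬ HasEigen A
  cyclic⇒eigen {A = A} {u} odd-d C = helper (odd-+ e k (≡.subst Odd (≡.sym dimension) odd-d))
    where
    open Cyclic C
    helper : Odd e ⊎ Odd k → ¬ ¬ HasEigen A
    helper (inj₁ odd-e) with odd-root odd-e p-monic
    ... | μ , pμ≈0 = return (μ , x μ , x-nonzero μ , ptw λ i →
      trans (x-resolvent μ .at i) (trans (+-congˡ (trans (*-congʳ (trans (-‿cong pμ≈0) -0#≈0#)) (zeroˡ _))) (+-identityʳ _)))
      where open import Algebra.Properties.Ring ring using (-0#≈0#)
    helper (inj₂ odd-k) = complement odd-k >>= λ (μ , y , _ , pair) → return (μ , y , pair)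

  module _ {d} {A : V (suc d) → V (suc d)} (A-self : SelfAdjoint A) {u} (r : Reflection {d} u) where
    open Reflection r

    conjugate : V (suc d) → V (suc d)
    conjugate = H ∘ A ∘ H

    conjugate-self : SelfAdjoint conjugate
    conjugate-self = adjoint-∘ self (adjoint-∘ A-self self)

    A∘H : ∀ x → A (H x) ≋ H (conjugate x)
    A∘H x = ≋-sym (involutive (A (H x)))

    unconjugate-eigen : ∀ {μ x} → EigenPair conjugate μ x → EigenPair A μ (H x)
    unconjugate-eigen {μ} {x} (x≠0 , eq) = H-nonzero x≠0 ,
      ≋-trans (A∘H x) (≋-trans (lin-cong self eq) (lin-· self μ x))

    dot-u-H : ∀ x → dot u (H x) ≈ γ * dot (δ zero) x
    dot-u-H x = begin
      dot u (H x)            ≈⟨ self .adj u x ⟨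
      dot (H u) x            ≈⟨ dot-cong image (≋-refl {x = x}) ⟩
      dot (γ · δ zero) x     ≈⟨ dot-·ˡ γ (δ zero) x ⟩
      γ * dot (δ zero) x     ∎

    -- `H` carries e₀ to u / γ. Scaling the vectors by γ turns the inhomogeneous term into a
    -- multiple of u itself; the moment acquires a second γ from `dot-u-H`.
    cyclic-reflect : Cyclic conjugate (δ zero) → Cyclic A u
    cyclic-reflect C = record
      { e = e ; k = k ; dimension = dimension ; p = p ; ψ = λ μ → γ * (γ * ψ μ)
      ; p-monic = p-monic ; ψ-degree = scale γ (scale γ ψ-degree)
      ; x = λ μ → γ · H (x μ)
      ; x-nonzero = λ μ → nonzero-· γ≉0 (H-nonzero (x-nonzero μ))
      ; x-resolvent = resolvent
      ; x-moment = λ μ → trans (dot-·ʳ γ u (H (x μ))) (*-congˡ (trans (dot-u-H (x μ)) (*-congˡ (x-moment μ))))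
      ; complement = λ odd-k → complement odd-k >>= λ (μ , y , y⊥ , pair) →
          return (μ , H y , trans (dot-u-H y) (trans (*-congˡ y⊥) (zeroʳ γ)) , unconjugate-eigen pair)
      }
      where
      open Cyclic C
      resolvent : ∀ μ → A (γ · H (x μ)) ≋ μ · γ · H (x μ) ⊕ (- p μ) · u
      resolvent μ .at i = begin
        A (γ · H (x μ)) i                                     ≈⟨ lin-· A-self γ (H (x μ)) .at i ⟩
        γ * A (H (x μ)) i                                     ≈⟨ *-congˡ (A∘H (x μ) .at i) ⟩
        γ * H (conjugate (x μ)) i                             ≈⟨ *-congˡ (lin-cong self (x-resolvent μ) .at i) ⟩
        γ * H (μ · x μ ⊕ (- p μ) · δ zero) i                  ≈⟨ *-congˡ (lin-⊕ self (μ · x μ) ((- p μ) · δ zero) .at i) ⟩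
        γ * (H (μ · x μ) i + H ((- p μ) · δ zero) i)          ≈⟨ *-congˡ (+-cong (lin-· self μ (x μ) .at i) (lin-· self (- p μ) (δ zero) .at i)) ⟩
        γ * (μ * H (x μ) i + - p μ * H (δ zero) i)            ≈⟨ solve 5 (λ g m h p d → g :* (m :* h :+ p :* d) := m :* (g :* h) :+ p :* (g :* d)) refl γ μ (H (x μ) i) (- p μ) (H (δ zero) i) ⟩
        μ * (γ * H (x μ) i) + - p μ * (γ * H (δ zero) i)      ≈⟨ +-congˡ (*-congˡ (image⁻¹ .at i)) ⟩
        μ * (γ * H (x μ) i) + - p μ * u i                     ∎

  module _ {d} {B : V (suc d) → V (suc d)} (B-self : SelfAdjoint B) where
    private
      a : Carrier
      a = B (δ zero) zero
      b : V d
      b = tail (B (δ zero))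

    -- The three-term recurrence of the orthogonal polynomials of B.
    cyclic-extend : Cyclic (minor B) b → Cyclic B (δ zero)
    cyclic-extend C = record
      { e = suc e ; k = k ; dimension = ≡.cong suc dimension
      ; p = λ μ → μ * p μ + (- a * p μ + - 1# * ψ μ) ; ψ = p
      ; p-monic = monic-+ (monic-shift p-monic) (add (scale (- a) (monic⇒< p-monic)) (scale (- 1#) (weaken ψ-degree)))
      ; ψ-degree = monic⇒< p-monic
      ; x = λ μ → p μ F.∷ x μ
      ; x-nonzero = λ μ eq → x-nonzero μ (ptw λ i → eq .at (suc i))
      ; x-resolvent = λ μ → ≋-trans (apply-cons B-self (p μ) (x μ)) (resolvent μ)
      ; x-moment = λ μ → trans (dot-comm (δ zero) (p μ F.∷ x μ)) (dot-δ (p μ F.∷ x μ) zero)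
      ; complement = λ odd-k → complement odd-k >>= λ (μ , y , y⊥b , pair) →
          return (μ , embed-tail y , trans (dot-comm (δ zero) (embed-tail y)) (dot-δ (embed-tail y) zero)
                 , lift-eigen B-self y⊥b pair)
      }
      where
      open Cyclic C
      resolvent : ∀ μ → p μ · B (δ zero) ⊕ B (embed-tail (x μ)) ≋
                  μ · (p μ F.∷ x μ) ⊕ (- (μ * p μ + (- a * p μ + - 1# * ψ μ))) · δ zero
      resolvent μ .at zero = begin
        p μ * a + B (embed-tail (x μ)) zero    ≈⟨ +-congˡ (trans (head-embed-tail B-self (x μ)) (x-moment μ)) ⟩
        p μ * a + ψ μ                          ≈⟨ +-congˡ (*-identityʳ _) ⟨
        p μ * a + ψ μ * 1#                     ≈⟨ solve 5 (λ o m p a q → p :* a :+ q :* o := m :* p :+ (:- (m :* p :+ (:- a :* p :+ :- o :* q)))) refl 1# μ (p μ) a (ψ μ) ⟩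
        μ * p μ + - (μ * p μ + (- a * p μ + - 1# * ψ μ))         ≈⟨ +-congˡ (*-identityʳ _) ⟨
        μ * p μ + - (μ * p μ + (- a * p μ + - 1# * ψ μ)) * 1#    ∎
      resolvent μ .at (suc i) = begin
        p μ * b i + minor B (x μ) i                      ≈⟨ +-congˡ (x-resolvent μ .at i) ⟩
        p μ * b i + (μ * x μ i + - p μ * b i)            ≈⟨ solve 4 (λ p b m x → p :* b :+ (m :* x :+ :- p :* b) := m :* x) refl (p μ) (b i) μ (x μ i) ⟩
        μ * x μ i                                        ≈⟨ +-identityʳ _ ⟨
        μ * x μ i + 0#                                   ≈⟨ +-congˡ (zeroʳ _) ⟨
        μ * x μ i + (- (μ * p μ + (- a * p μ + - 1# * ψ μ))) * 0#   ∎

    -- Without coupling e₀ is an eigenvector for a: the cyclic subspace is a line with minimal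
    -- polynomial μ - a, and the minor acts on the complement.
    cyclic-decouple : b ≋ 0v → (Odd d → ¬ ¬ HasEigen (minor B)) → Cyclic B (δ zero)
    cyclic-decouple b≋0 rest = record
      { e = 1 ; k = d ; dimension = ≡.refl ; p = λ μ → μ + - a ; ψ = λ _ → 1#
      ; p-monic = monic-linear a ; ψ-degree = const 1#
      ; x = λ _ → δ zero ; x-nonzero = λ _ → δ-nonzero zero
      ; x-resolvent = resolvent
      ; x-moment = λ _ → dot-δ {suc d} (δ zero) zero
      ; complement = λ odd-d → rest odd-d >>= λ (μ , y , pair) →
          return (μ , embed-tail y , trans (dot-comm (δ zero) (embed-tail y)) (dot-δ (embed-tail y) zero)
                 , lift-eigen B-self (dot-0ˡ y b≋0) pair)
      }
      where
      resolvent : ∀ μ → B (δ zero) ≋ μ · δ zero ⊕ (- (μ + - a)) · δ zero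
      resolvent μ .at zero = sym (trans (+-cong (*-identityʳ μ) (*-identityʳ _))
        (solve 2 (λ m a → m :+ :- (m :+ :- a) := a) refl μ a))
      resolvent μ .at (suc i) = trans (b≋0 .at i) (sym (trans (+-cong (zeroʳ μ) (zeroʳ _)) (+-identityʳ 0#)))

  -- One step of Householder tridiagonalisation: u is reflected onto a multiple of e₀, and b, the
  -- coupling of e₀ to the other coordinates, becomes the next starting vector. Whether b vanishes
  -- cannot be decided, whence the double negation. If it does, the cyclic subspace ends, and its
  -- complement is left to `odd⇒eigen` in one dimension less.
  cyclic : ∀ d {A : V d → V d} → SelfAdjoint A → ∀ u → Nonzero u → ¬ ¬ Cyclic A u
  odd⇒eigen : ∀ d {A : V d → V d} → SelfAdjoint A → Odd d → ¬ ¬ HasEigen A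

  cyclic zero A-self u u≠0 = contradiction (ptw λ ()) u≠0
  cyclic (suc d) {A} A-self u u≠0 =
    lem (b ≋ 0v) >>= λ where
      (inj₁ b≋0) → return (cyclic-reflect A-self r
                     (cyclic-decouple B-self b≋0 (odd⇒eigen d (minor-self B-self))))
      (inj₂ b≠0) → cyclic d (minor-self B-self) b b≠0 >>= λ C →
                     return (cyclic-reflect A-self r (cyclic-extend B-self C))
    where
    r = reflection u u≠0
    B-self = conjugate-self A-self r
    b : V d
    b = tail (conjugate A-self r (δ zero))

  odd⇒eigen zero    A-self (_ , ())
  odd⇒eigen (suc d) A-self odd-d =
    cyclic (suc d) A-self (δ zero) (δ-nonzero zero) >>= λ C → cyclic⇒eigen odd-d C

-- Common eigenvectors of commuting operators

module CommutingPairs {c ℓ} (R : RealClosedField c ℓ) (stable : Stable R) where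
  open RealClosedField R hiding (zero)
  open OrderedField R
  open Vectors R stable
  open Krylov R stable
  open DoubleNegation

  ≋-stable : ∀ {d} {x y : V d} → ¬ ¬ (x ≋ y) → x ≋ y
  ≋-stable p .at i = stable λ q → p λ x≋y → q (x≋y .at i)

  private module ≋-Reasoning {d : ℕ} where
    open import Relation.Binary.Reasoning.Setoid (≋-setoid d) public

  -- The orthogonal splitting into the α-eigenspace, the range of `S`, and its complement, the range
  -- of `T`. By `kernel` the eigenspace is no larger than the range of `S`.
  record Decomposition {d} (A : V d → V d) (α : Carrier) : Set (c ⊔ ℓ) where
    field
      s t       : ℕ
      dimension : s ℕ.+ t ≡ d
      S         : V s → V d
      S*        : V d → V s
      T         : V t → V d
      T*        : V d → V t
      S-adj     : Adjoint S S*
      T-adj     : Adjoint T T*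
      S-iso     : ∀ x → S* (S x) ≋ x
      T-iso     : ∀ x → T* (T x) ≋ x
      eigen     : ∀ x → A (S x) ≋ α · S x
      complete  : ∀ x → S (S* x) ⊕ T (T* x) ≋ x
      kernel    : ∀ y → A y ≋ α · y → T* y ≋ 0v

  -- A solution of A y = α y is then not nonzero, hence zero by stability, so the complement is
  -- everything.
  trivial-decomposition : ∀ {d} {A : V d → V d} → SelfAdjoint A → ∀ α → ¬ ∃ (EigenPair A α) → Decomposition A α
  trivial-decomposition {d} A-self α no-eigen = record
    { s = 0 ; t = d ; dimension = ≡.refl
    ; S = λ _ → 0v ; S* = λ _ () ; T = id ; T* = id
    ; S-adj = adjoint λ x y → dot-0ˡ y ≋-refl
    ; T-adj = adjoint λ x y → refl
    ; S-iso = λ x → ptw λ () ; T-iso = λ x → ≋-refl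
    ; eigen = λ x → ptw λ i → trans (lin-0 A-self ≋-refl .at i) (sym (zeroʳ α))
    ; complete = λ x → ptw λ i → +-identityˡ _
    ; kernel = λ y eq → ≋-stable λ y≠0 → no-eigen (y , y≠0 , eq)
    }

  lift : ∀ {s d} → (V s → V d) → V (suc s) → V (suc d)
  lift f x = x zero F.∷ f (tail x)

  lift-adjoint : ∀ {s d} {f : V s → V d} {g} → Adjoint f g → Adjoint (lift f) (lift g)
  lift-adjoint a .adj x y = +-congˡ (a .adj (tail x) (tail y))

  cons-cong : ∀ {d} {s t} {x y : V d} → s ≈ t → x ≋ y → s F.∷ x ≋ t F.∷ y
  cons-cong p q .at zero    = p
  cons-cong p q .at (suc i) = q .at i

  cons-head-tail : ∀ {d} (x : V (suc d)) → x zero F.∷ tail x ≋ x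
  cons-head-tail x .at zero    = refl
  cons-head-tail x .at (suc i) = refl

  tail-cong : ∀ {d} {x y : V (suc d)} → x ≋ y → tail x ≋ tail y
  tail-cong p .at i = p .at (suc i)

  module _ {d} {B : V (suc d) → V (suc d)} (B-self : SelfAdjoint B) {α} (eq : B (δ zero) ≋ α · δ zero) where
    tail≋0 : tail (B (δ zero)) ≋ 0v
    tail≋0 .at i = trans (eq .at (suc i)) (zeroʳ α)

    -- If e₀ is an eigenvector, the first column has no entry off the diagonal, and by symmetry
    -- neither has the first row: `B` is block diagonal.
    decoupled : ∀ t y → B (t F.∷ y) ≋ α * t F.∷ minor B y
    decoupled t y = ≋-trans (apply-cons B-self t y) (ptw λ
      { zero → trans (+-cong (*-congˡ (trans (eq .at zero) (*-identityʳ α))) (trans (head-embed-tail B-self y) (dot-0ˡ y tail≋0)))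
                     (trans (+-identityʳ _) (*-comm t α))
      ; (suc i) → trans (+-congʳ (trans (*-congˡ (tail≋0 .at i)) (zeroʳ t))) (+-identityˡ _) })

  module _ {d} {A : V (suc d) → V (suc d)} (A-self : SelfAdjoint A) {α} {v} (v≠0 : Nonzero v) (Av≋αv : A v ≋ α · v) where
    private
      r = reflection v v≠0
      open Reflection r
      B = conjugate A-self r
      B-self = conjugate-self A-self r

    conjugate-δ : B (δ zero) ≋ α · δ zero
    conjugate-δ .at i = *-cancelˡ γ≉0 (lemma .at i)
      where
      open ≋-Reasoning
      lemma : γ · B (δ zero) ≋ γ · α · δ zero
      lemma = begin
        γ · B (δ zero)        ≈⟨ lin-· B-self γ (δ zero) ⟨
        B (γ · δ zero)        ≈⟨ lin-cong B-self image ⟨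
        B (H v)               ≈⟨ lin-cong self (lin-cong A-self (involutive v)) ⟩
        H (A v)               ≈⟨ lin-cong self Av≋αv ⟩
        H (α · v)             ≈⟨ lin-· self α v ⟩
        α · H v               ≈⟨ ·-congˡ image ⟩
        α · γ · δ zero        ≈⟨ ptw (λ i → solve 3 (λ a g x → a :* (g :* x) := g :* (a :* x)) refl α γ (δ zero i)) ⟩
        γ · α · δ zero        ∎

    -- In the coordinates reflected by `H`, v is a multiple of e₀. The eigenspace consists of e₀ and
    -- the one of the minor; the complement lives on the remaining coordinates.
    extend-decomposition : Decomposition (minor B) α → Decomposition A α
    extend-decomposition D = record
      { s = suc s ; t = t ; dimension = ≡.cong suc dimension
      ; S = H ∘ lift S ; S* = lift S* ∘ H ; T = H ∘ embed-tail ∘ T ; T* = T* ∘ tail ∘ H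
      ; S-adj = adjoint-∘ self (lift-adjoint S-adj)
      ; T-adj = adjoint-∘ self (adjoint-∘ embed-tail-adjoint T-adj)
      ; S-iso = λ x → ≋-trans (lin-cong (adjoint-sym (lift-adjoint S-adj)) (involutive (lift S x)))
                  (≋-trans (cons-cong refl (S-iso (tail x))) (cons-head-tail x))
      ; T-iso = λ x → ≋-trans (lin-cong (adjoint-sym T-adj) (tail-cong (involutive (embed-tail (T x))))) (T-iso x)
      ; eigen = eigen′ ; complete = complete′ ; kernel = kernel′ }
      where
      open Decomposition D
      open ≋-Reasoning

      eigen′ : ∀ x → A (H (lift S x)) ≋ α · H (lift S x)
      eigen′ x = begin
        A (H (lift S x))                                   ≈⟨ A∘H A-self r (lift S x) ⟩
        H (B (lift S x))                                   ≈⟨ lin-cong self (decoupled B-self conjugate-δ (x zero) (S (tail x))) ⟩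
        H (α * x zero F.∷ minor B (S (tail x)))            ≈⟨ lin-cong self (cons-cong refl (eigen (tail x))) ⟩
        H (α * x zero F.∷ α · S (tail x))                  ≈⟨ lin-cong self (ptw λ { zero → refl ; (suc i) → refl }) ⟩
        H (α · lift S x)                                   ≈⟨ lin-· self α (lift S x) ⟩
        α · H (lift S x)                                   ∎

      complete′ : ∀ x → H (lift S (lift S* (H x))) ⊕ H (embed-tail (T (T* (tail (H x))))) ≋ x
      complete′ x = begin
        H (lift S (lift S* (H x))) ⊕ H (embed-tail (T (T* (tail (H x)))))   ≈⟨ lin-⊕ self _ _ ⟨
        H (lift S (lift S* (H x)) ⊕ embed-tail (T (T* (tail (H x)))))       ≈⟨ lin-cong self (ptw λ { zero → +-identityʳ _ ; (suc i) → complete (tail (H x)) .at i }) ⟩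
        H (H x)                                                              ≈⟨ involutive x ⟩
        x                                                                    ∎

      kernel′ : ∀ y → A y ≋ α · y → T* (tail (H y)) ≋ 0v
      kernel′ y Ay≋αy = kernel (tail (H y)) (begin
        minor B (tail (H y))                                     ≡⟨⟩
        tail (α * H y zero F.∷ minor B (tail (H y)))             ≈⟨ tail-cong (decoupled B-self conjugate-δ (H y zero) (tail (H y))) ⟨
        tail (B (H y zero F.∷ tail (H y)))                       ≈⟨ tail-cong (lin-cong B-self (cons-head-tail (H y))) ⟩
        tail (B (H y))                                           ≈⟨ tail-cong (lin-cong self (lin-cong A-self (involutive y))) ⟩
        tail (H (A y))                                           ≈⟨ tail-cong (lin-cong self Ay≋αy) ⟩
        tail (H (α · y))                                         ≈⟨ tail-cong (lin-· self α y) ⟩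
        α · tail (H y)                                           ∎)

  -- As long as an eigenvector for α exists it is split off and the dimension drops; what is left
  -- when there is none is the complement.
  decompose : ∀ d {A : V d → V d} → SelfAdjoint A → ∀ α → ¬ ¬ Decomposition A α
  decompose d {A} A-self α = lem (∃ (EigenPair A α)) >>= helper d A-self
    where
    helper : ∀ d {A : V d → V d} → SelfAdjoint A → ∃ (EigenPair A α) ⊎ ¬ ∃ (EigenPair A α) → ¬ ¬ Decomposition A α
    helper d       A-self (inj₂ none) = return (trivial-decomposition A-self α none)
    helper zero    A-self (inj₁ (v , v≠0 , _)) = contradiction (ptw λ ()) v≠0
    helper (suc d) A-self (inj₁ (v , v≠0 , Av≋αv)) =
      decompose d (minor-self (conjugate-self A-self (reflection v v≠0))) α >>= λ D →
      return (extend-decomposition A-self v≠0 Av≋αv D)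

  Commute : ∀ {d} → (A B : V d → V d) → Set (c ⊔ ℓ)
  Commute A B = ∀ x → A (B x) ≋ B (A x)

  module Invariance {d} {A : V d → V d} (A-self : SelfAdjoint A) {α} (D : Decomposition A α)
                    {B : V d → V d} (B-self : SelfAdjoint B) (comm : Commute A B) where
    open Decomposition D
    open ≋-Reasoning

    -- Since `B` commutes with `A`, it preserves the α-eigenspace.
    T*BS : ∀ z → T* (B (S z)) ≋ 0v
    T*BS z = kernel (B (S z)) (begin
      A (B (S z))      ≈⟨ comm (S z) ⟩
      B (A (S z))      ≈⟨ lin-cong B-self (eigen z) ⟩
      B (α · S z)      ≈⟨ lin-· B-self α (S z) ⟩
      α · B (S z)      ∎)

    S-invariant : ∀ z → S (S* (B (S z))) ≋ B (S z)
    S-invariant z = begin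
      S (S* y)                    ≈⟨ ptw (λ i → trans (+-congˡ (lin-0 T-adj (T*BS z) .at i)) (+-identityʳ _)) ⟨
      S (S* y) ⊕ T (T* y)         ≈⟨ complete y ⟩
      y                           ∎
      where y = B (S z)

    -- The adjoint statement of `T*BS`: a self-adjoint operator preserves the complement of an
    -- invariant subspace.
    S*BT : ∀ z → S* (B (T z)) ≋ 0v
    S*BT z = dot-ext λ w →
      trans (adjoint-sym S-adj .adj (B (T z)) w) (trans (B-self .adj (T z) (S w))
      (trans (T-adj .adj z (B (S w))) (trans (dot-0ʳ z (T*BS w)) (sym (dot-0ˡ w ≋-refl)))))

    T-invariant : ∀ z → T (T* (B (T z))) ≋ B (T z)
    T-invariant z = begin
      T (T* y)                    ≈⟨ ptw (λ i → trans (+-congʳ (lin-0 S-adj (S*BT z) .at i)) (+-identityˡ _)) ⟨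
      S (S* y) ⊕ T (T* y)         ≈⟨ complete y ⟩
      y                           ∎
      where y = B (T z)

    T-nonzero : ∀ {x} → Nonzero x → Nonzero (T x)
    T-nonzero x≠0 Tx≋0 = x≠0 (≋-trans (≋-sym (T-iso _)) (lin-0 (adjoint-sym T-adj) Tx≋0))

    S-nonzero : ∀ {x} → Nonzero x → Nonzero (S x)
    S-nonzero x≠0 Sx≋0 = x≠0 (≋-trans (≋-sym (S-iso _)) (lin-0 (adjoint-sym S-adj) Sx≋0))

    lift-T : ∀ {μ x} → EigenPair (T* ∘ B ∘ T) μ x → EigenPair B μ (T x)
    lift-T {μ} {x} (x≠0 , eq) = T-nonzero x≠0 ,
      ≋-trans (≋-sym (T-invariant x)) (≋-trans (lin-cong T-adj eq) (lin-· T-adj μ x))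

    lift-S : ∀ {μ x} → EigenPair (S* ∘ B ∘ S) μ x → EigenPair B μ (S x)
    lift-S {μ} {x} (x≠0 , eq) = S-nonzero x≠0 ,
      ≋-trans (≋-sym (S-invariant x)) (≋-trans (lin-cong S-adj eq) (lin-· S-adj μ x))

    -- Makes the recursion in `common-eigen` terminate: the complement of a nonzero eigenspace has
    -- dimension less than d.
    s-positive : ∀ {v} → EigenPair A α v → s ≢ 0
    s-positive {v} (v≠0 , Av≋αv) ≡.refl = v≠0 (begin
      v                       ≈⟨ complete v ⟨
      S (S* v) ⊕ T (T* v)     ≈⟨ ⊕-cong (lin-0 S-adj (ptw λ ())) (lin-0 T-adj (kernel v Av≋αv)) ⟩
      0v ⊕ 0v                 ≈⟨ ptw (λ _ → +-identityʳ 0#) ⟩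
      0v                      ∎)

  HaveEigen : ℕ → Set (c ⊔ ℓ)
  HaveEigen k = ∀ d {A : V d → V d} → SelfAdjoint A → ¬ (2 ℕ.^ k ∣ d) → ¬ ¬ HasEigen A

  CommonEigen : ∀ {d} → (A B : V d → V d) → Set (c ⊔ ℓ)
  CommonEigen A B = ∃₂ λ α β → ∃ λ x → Nonzero x × A x ≋ α · x × B x ≋ β · x

  -- From s + t = d, the eigenspace of `A` or its complement has dimension not divisible by 2^k. In
  -- the first case `B` has an eigenvector within the eigenspace. In the second both operators are
  -- compressed to the complement, which they preserve, and the argument is repeated there.
  common-eigen : ∀ {k} → HaveEigen k → ∀ d {A B : V d → V d} → SelfAdjoint A → SelfAdjoint B →
                 Commute A B → ¬ (2 ℕ.^ k ∣ d) → ¬ ¬ CommonEigen A B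
  common-eigen {k} have d = go d (<-wellFounded d)
    where
    go : ∀ d → Acc ℕ._<_ d → {A B : V d → V d} → SelfAdjoint A → SelfAdjoint B →
         Commute A B → ¬ (2 ℕ.^ k ∣ d) → ¬ ¬ CommonEigen A B
    go d (acc rs) {A} {B} A-self B-self comm ∤d =
      have d A-self ∤d >>= λ (α , v , pair) → decompose d A-self α >>= split α pair
      where
      split : ∀ α {v} → EigenPair A α v → Decomposition A α → ¬ ¬ CommonEigen A B
      split α pair D with 2 ℕ.^ k ∣? Decomposition.s D
      ... | no ∤s = have s (restrict-self B-self S-adj) ∤s >>= λ (β , x , pair′) →
                    let Sx≠0 , BSx = IB.lift-S pair′ in
                    return (α , β , S x , Sx≠0 , eigen x , BSx)
        where
        open Decomposition D
        module IB = Invariance A-self D B-self comm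
      ... | yes ∣s = go t (rs t<d) (restrict-self A-self T-adj) (restrict-self B-self T-adj) comm′ ∤t >>=
                     λ (α , β , x , x≠0 , Ax , Bx) →
                     return (α , β , T x , IA.T-nonzero x≠0 , proj₂ (IA.lift-T (x≠0 , Ax)) , proj₂ (IB.lift-T (x≠0 , Bx)))
        where
        open Decomposition D
        module IA = Invariance A-self D A-self (λ _ → ≋-refl)
        module IB = Invariance A-self D B-self comm
        open ≋-Reasoning
        ∤t : ¬ (2 ℕ.^ k ∣ t)
        ∤t ∣t = ∤d (≡.subst (2 ℕ.^ k ∣_) dimension (∣m∣n⇒∣m+n ∣s ∣t))
        t<d : t ℕ.< d
        t<d = ≡.subst (t ℕ.<_) dimension (ℕ.m<n+m t (ℕ.n≢0⇒n>0 (IA.s-positive pair)))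
        comm′ : Commute (T* ∘ A ∘ T) (T* ∘ B ∘ T)
        comm′ z = lin-cong (adjoint-sym T-adj) (begin
          A (T (T* (B (T z))))    ≈⟨ lin-cong A-self (IB.T-invariant z) ⟩
          A (B (T z))             ≈⟨ comm (T z) ⟩
          B (A (T z))             ≈⟨ lin-cong B-self (IA.T-invariant z) ⟨
          B (T (T* (A (T z))))    ∎)

-- The spectral theorem

triangle : ℕ → ℕ
triangle zero    = 0
triangle (suc d) = d ℕ.+ triangle d

2*triangle : ∀ d → 2 ℕ.* triangle d ℕ.+ d ≡ d ℕ.* d
2*triangle zero    = ≡.refl
2*triangle (suc d) = ≡.trans (rearrange d (triangle d)) (≡.trans (≡.cong (λ m → m ℕ.+ d ℕ.+ suc d) (2*triangle d)) (square d))
  where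
  rearrange : ∀ d t → 2 ℕ.* (d ℕ.+ t) ℕ.+ suc d ≡ 2 ℕ.* t ℕ.+ d ℕ.+ d ℕ.+ suc d
  rearrange = solve-∀
  square : ∀ d → d ℕ.* d ℕ.+ d ℕ.+ suc d ≡ suc d ℕ.* suc d
  square = solve-∀

-- By `2*triangle`, d is d² minus twice the triangle. As d is even, 2^(k+2) divides d²; if 2^(k+1)
-- divided the triangle, 2^(k+2) would divide d.
triangle-∤ : ∀ k {d} → 2 ℕ.^ suc k ∣ d → ¬ (2 ℕ.^ suc (suc k) ∣ d) → ¬ (2 ℕ.^ suc k ∣ triangle d)
triangle-∤ k {d} ∣d ∤d ∣t = ∤d (∣m+n∣m⇒∣n (≡.subst (2 ℕ.^ suc (suc k) ∣_) (≡.sym (2*triangle d)) ∣d²) (*-monoʳ-∣ 2 ∣t))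
  where
  ∣d² : 2 ℕ.^ suc (suc k) ∣ d ℕ.* d
  ∣d² = *-pres-∣ {2} {d} (∣-trans (m∣m*n (2 ℕ.^ k)) ∣d) ∣d

n<2^n : ∀ n → n ℕ.< 2 ℕ.^ n
n<2^n zero    = ℕ.s≤s ℕ.z≤n
n<2^n (suc n) = ℕ.+-mono-≤ (ℕ.≤-trans (ℕ.s≤s ℕ.z≤n) (n<2^n n)) (≡.subst (suc n ℕ.≤_) (≡.sym (ℕ.+-identityʳ _)) (n<2^n n))

module SpectralTheorem {c ℓ} (R : RealClosedField c ℓ) (stable : Stable R) where
  open RealClosedField R hiding (zero)
  open OrderedField R
  open Vectors R stable
  open Krylov R stable
  open CommutingPairs R stable
  open DoubleNegation
  open import Algebra.Properties.Ring ring using (-‿distribʳ-*; -0#≈0#; -‿involutive)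
  open import Relation.Binary.Reasoning.Setoid setoid

  sum-++ : ∀ m {n} (f : Fin (m ℕ.+ n) → Carrier) → sum f ≈ sum (λ i → f (i ↑ˡ n)) + sum (λ j → f (m ↑ʳ j))
  sum-++ zero    f = sym (+-identityˡ _)
  sum-++ (suc m) f = trans (+-congˡ (sum-++ m (f ∘ suc))) (sym (+-assoc _ _ _))

  Mat : ℕ → Set c
  Mat d = Fin d → Fin d → Carrier

  infix 4 _≋ₘ_
  record _≋ₘ_ {d} (M N : Mat d) : Set ℓ where
    constructor entries
    field entry : ∀ i j → M i j ≈ N i j
  open _≋ₘ_

  transpose : ∀ {d} → Mat d → Mat d
  transpose M i j = M j i

  Skew : ∀ {d} → Mat d → Set ℓ
  Skew M = ∀ i j → M i j ≈ - M j i

  hs : ∀ {d} → Mat d → Mat d → Carrier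
  hs M N = sum λ i → dot (M i) (N i)

  hs-cong : ∀ {d} {M M′ N N′ : Mat d} → M ≋ₘ M′ → N ≋ₘ N′ → hs M N ≈ hs M′ N′
  hs-cong p q = sum-cong-≋ λ i → dot-cong (ptw (p .entry i)) (ptw (q .entry i))

  hs-transpose : ∀ {d} (M N : Mat d) → hs (transpose M) (transpose N) ≈ hs M N
  hs-transpose M N = ∑-comm (λ i j → M j i * N j i)

  -- Coordinates on Λ²: z lists the entries strictly below the diagonal, column by column.
  skew-matrix : ∀ d → V (triangle d) → Mat d
  skew-matrix (suc d) z zero    zero    = 0#
  skew-matrix (suc d) z zero    (suc j) = - z (j ↑ˡ triangle d)
  skew-matrix (suc d) z (suc i) zero    = z (i ↑ˡ triangle d)
  skew-matrix (suc d) z (suc i) (suc j) = skew-matrix d (λ k → z (d ↑ʳ k)) i j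

  below-diagonal : ∀ {d} → Mat d → V (triangle d)
  below-diagonal {zero}  M = λ ()
  below-diagonal {suc d} M = (λ i → M (suc i) zero) F.++ below-diagonal (λ i j → M (suc i) (suc j))

  ++-↑ˡ : ∀ {m n} (x : V m) (y : V n) i → (x F.++ y) (i ↑ˡ n) ≡ x i
  ++-↑ˡ {m} {n} x y i rewrite splitAt-↑ˡ m i n = ≡.refl

  ++-↑ʳ : ∀ {m n} (x : V m) (y : V n) i → (x F.++ y) (m ↑ʳ i) ≡ y i
  ++-↑ʳ {m} {n} x y i rewrite splitAt-↑ʳ m n i = ≡.refl

  skew-matrix-cong : ∀ d {z w : V (triangle d)} → z ≋ w → skew-matrix d z ≋ₘ skew-matrix d w
  skew-matrix-cong (suc d) p .entry zero    zero    = refl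
  skew-matrix-cong (suc d) p .entry zero    (suc j) = -‿cong (p .at _)
  skew-matrix-cong (suc d) p .entry (suc i) zero    = p .at _
  skew-matrix-cong (suc d) p .entry (suc i) (suc j) = skew-matrix-cong d (ptw λ k → p .at (d ↑ʳ k)) .entry i j

  skew-matrix-skew : ∀ d (z : V (triangle d)) → Skew (skew-matrix d z)
  skew-matrix-skew (suc d) z zero    zero    = sym -0#≈0#
  skew-matrix-skew (suc d) z zero    (suc j) = refl
  skew-matrix-skew (suc d) z (suc i) zero    = sym (-‿involutive _)
  skew-matrix-skew (suc d) z (suc i) (suc j) = skew-matrix-skew d (λ k → z (d ↑ʳ k)) i j

  skew-matrix-· : ∀ d a (z : V (triangle d)) i j → skew-matrix d (a · z) i j ≈ a * skew-matrix d z i j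
  skew-matrix-· (suc d) a z zero    zero    = sym (zeroʳ a)
  skew-matrix-· (suc d) a z zero    (suc j) = -‿distribʳ-* a _
  skew-matrix-· (suc d) a z (suc i) zero    = refl
  skew-matrix-· (suc d) a z (suc i) (suc j) = skew-matrix-· d a (λ k → z (d ↑ʳ k)) i j

  self-negative : ∀ {x} → x ≈ - x → x ≈ 0#
  self-negative {x} x≈-x = x*y≈0⇒y≈0 2≉0 (begin
    (1# + 1#) * x        ≈⟨ distribʳ x 1# 1# ⟩
    1# * x + 1# * x      ≈⟨ +-cong (*-identityˡ x) (*-identityˡ x) ⟩
    x + x                ≈⟨ +-congˡ x≈-x ⟩
    x + - x              ≈⟨ -‿inverseʳ x ⟩
    0#                   ∎)

  skew-matrix-below : ∀ {d} {M : Mat d} → Skew M → skew-matrix d (below-diagonal M) ≋ₘ M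
  skew-matrix-below {suc d} {M} sk .entry zero    zero    = sym (self-negative (sk zero zero))
  skew-matrix-below {suc d} {M} sk .entry zero    (suc j) =
    trans (-‿cong (reflexive (++-↑ˡ (λ i → M (suc i) zero) _ j))) (sym (sk zero (suc j)))
  skew-matrix-below {suc d} {M} sk .entry (suc i) zero    = reflexive (++-↑ˡ (λ i → M (suc i) zero) _ i)
  skew-matrix-below {suc d} {M} sk .entry (suc i) (suc j) =
    trans (skew-matrix-cong d (ptw λ k → reflexive (++-↑ʳ (λ i → M (suc i) zero) _ k)) .entry i j)
          (skew-matrix-below (λ i j → sk (suc i) (suc j)) .entry i j)

  -- Each coordinate occurs twice, with opposite signs, so the Frobenius form is twice the dot
  -- product. Self-adjointness can thus be checked on matrices and brought back by `double-cancel`.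
  hs-skew-matrix : ∀ d (z w : V (triangle d)) → hs (skew-matrix d z) (skew-matrix d w) ≈ dot z w + dot z w
  hs-skew-matrix zero  z w = sym (+-identityˡ 0#)
  hs-skew-matrix (suc d) z w = begin
    0# * 0# + sum (λ j → - z₁ j * - w₁ j) + sum (λ i → z₁ i * w₁ i + dot (skew-matrix d z₂ i) (skew-matrix d w₂ i))
      ≈⟨ +-cong (trans (+-cong (zeroˡ 0#) (sum-cong-≋ λ j → solve 2 (λ x y → :- x :* :- y := x :* y) refl (z₁ j) (w₁ j))) (+-identityˡ _))
                (trans (∑-distrib-+ (λ i → z₁ i * w₁ i) (λ i → dot (skew-matrix d z₂ i) (skew-matrix d w₂ i))) (+-congˡ (hs-skew-matrix d z₂ w₂))) ⟩
    dot z₁ w₁ + (dot z₁ w₁ + (dot z₂ w₂ + dot z₂ w₂))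
      ≈⟨ solve 2 (λ a b → a :+ (a :+ (b :+ b)) := a :+ b :+ (a :+ b)) refl (dot z₁ w₁) (dot z₂ w₂) ⟩
    (dot z₁ w₁ + dot z₂ w₂) + (dot z₁ w₁ + dot z₂ w₂)
      ≈⟨ +-cong (sum-++ d (λ i → z i * w i)) (sum-++ d (λ i → z i * w i)) ⟨
    dot z w + dot z w ∎
    where
    z₁ w₁ : V d
    z₁ i = z (i ↑ˡ triangle d)
    w₁ i = w (i ↑ˡ triangle d)
    z₂ w₂ : V (triangle d)
    z₂ k = z (d ↑ʳ k)
    w₂ k = w (d ↑ʳ k)

  double-cancel : ∀ {x y} → x + x ≈ y + y → x ≈ y
  double-cancel {x} {y} eq = *-cancelˡ 2≉0 (trans (double x) (trans eq (sym (double y))))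
    where
    double : ∀ z → (1# + 1#) * z ≈ z + z
    double z = trans (distribʳ z 1# 1#) (+-cong (*-identityˡ z) (*-identityˡ z))

  -- Operators on Λ²(K^d), realised as the skew matrices.
  module SkewOperator {d} (L : Mat d → Mat d)
    (L-cong : ∀ {M N} → M ≋ₘ N → L M ≋ₘ L N)
    (L-skew : ∀ {M} → Skew M → Skew (L M))
    (L-self : ∀ {M N} → Skew M → Skew N → hs (L M) N ≈ hs M (L N)) where

    op : V (triangle d) → V (triangle d)
    op z = below-diagonal (L (skew-matrix d z))

    matrix-op : ∀ z → skew-matrix d (op z) ≋ₘ L (skew-matrix d z)
    matrix-op z = skew-matrix-below (L-skew (skew-matrix-skew d z))

    op-self : SelfAdjoint op
    op-self .adj z w = double-cancel (begin
      dot (op z) w + dot (op z) w                    ≈⟨ hs-skew-matrix d (op z) w ⟨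
      hs (skew-matrix d (op z)) (skew-matrix d w)        ≈⟨ hs-cong (matrix-op z) (entries λ _ _ → refl) ⟩
      hs (L (skew-matrix d z)) (skew-matrix d w)         ≈⟨ L-self (skew-matrix-skew d z) (skew-matrix-skew d w) ⟩
      hs (skew-matrix d z) (L (skew-matrix d w))         ≈⟨ hs-cong {M = skew-matrix d z} (entries λ _ _ → refl) (matrix-op w) ⟨
      hs (skew-matrix d z) (skew-matrix d (op w))        ≈⟨ hs-skew-matrix d z (op w) ⟩
      dot z (op w) + dot z (op w)                    ∎)

  below-diagonal-cong : ∀ {d} {M N : Mat d} → M ≋ₘ N → below-diagonal M ≋ below-diagonal N
  below-diagonal-cong {suc d} p .at i with splitAt d i
  ... | inj₁ j = p .entry (suc j) zero
  ... | inj₂ k = below-diagonal-cong (entries λ i j → p .entry (suc i) (suc j)) .at k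

  module _ {d} {A : V d → V d} (A-self : SelfAdjoint A) where
    apply-δ : ∀ x i → A x i ≈ dot x (A (δ i))
    apply-δ x i = trans (sym (dot-δ (A x) i)) (A-self .adj x (δ i))

    lin-neg : ∀ {x y} → (∀ i → x i ≈ - y i) → ∀ i → A x i ≈ - A y i
    lin-neg {x} {y} p i = begin
      A x i                 ≈⟨ lin-cong A-self (ptw λ k → trans (p k) (sym (-1*x≈-x (y k)))) .at i ⟩
      A ((- 1#) · y) i      ≈⟨ lin-· A-self (- 1#) y .at i ⟩
      - 1# * A y i          ≈⟨ -1*x≈-x (A y i) ⟩
      - A y i               ∎
      where open import Algebra.Properties.Ring ring using (-1*x≈-x)

    -- Multiplication by the matrix of `A`: `l M` is AM, acting on columns, and `r M` is MA, acting
    -- on rows, as A is symmetric.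
    l r : Mat d → Mat d
    l M i j = A (λ k → M k j) i
    r M i j = A (M i) j

    l-cong : ∀ {M N} → M ≋ₘ N → l M ≋ₘ l N
    l-cong p .entry i j = lin-cong A-self (ptw λ k → p .entry k j) .at i

    r-cong : ∀ {M N} → M ≋ₘ N → r M ≋ₘ r N
    r-cong p .entry i j = lin-cong A-self (ptw λ k → p .entry i k) .at j

    -- Associativity A(MA) = (AM)A, with the entries of `A` read off by `apply-δ`.
    l-r-comm : ∀ M → l (r M) ≋ₘ r (l M)
    l-r-comm M .entry i j = begin
      A (λ k → A (M k) j) i                                           ≈⟨ apply-δ _ i ⟩
      sum (λ k → A (M k) j * A (δ i) k)                               ≈⟨ sum-cong-≋ (λ k → *-congʳ (apply-δ (M k) j)) ⟩
      sum (λ k → dot (M k) (A (δ j)) * A (δ i) k)                     ≈⟨ sum-cong-≋ (λ k → *-distribʳ-sum (A (δ i) k) (λ l → M k l * A (δ j) l)) ⟩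
      sum (λ k → sum λ l → M k l * A (δ j) l * A (δ i) k)             ≈⟨ ∑-comm (λ k l → M k l * A (δ j) l * A (δ i) k) ⟩
      sum (λ l → sum λ k → M k l * A (δ j) l * A (δ i) k)             ≈⟨ sum-cong-≋ (λ l → sum-cong-≋ λ k → solve 3 (λ m a b → m :* a :* b := m :* b :* a) refl (M k l) (A (δ j) l) (A (δ i) k)) ⟩
      sum (λ l → sum λ k → M k l * A (δ i) k * A (δ j) l)             ≈⟨ sum-cong-≋ (λ l → *-distribʳ-sum (A (δ j) l) (λ k → M k l * A (δ i) k)) ⟨
      sum (λ l → dot (λ k → M k l) (A (δ i)) * A (δ j) l)             ≈⟨ sum-cong-≋ (λ l → *-congʳ (apply-δ (λ k → M k l) i)) ⟨
      sum (λ l → A (λ k → M k l) i * A (δ j) l)                       ≈⟨ apply-δ _ j ⟨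
      A (λ l → A (λ k → M k l) i) j                                   ∎

    r-self : ∀ M N → hs (r M) N ≈ hs M (r N)
    r-self M N = sum-cong-≋ λ i → A-self .adj (M i) (N i)

    -- Transposition preserves the form and exchanges `l` with `r`.
    l-self : ∀ M N → hs (l M) N ≈ hs M (l N)
    l-self M N = trans (sym (hs-transpose (l M) N))
      (trans (r-self (transpose M) (transpose N)) (hs-transpose M (l N)))

    plus product : Mat d → Mat d
    plus M i j = l M i j + r M i j
    product M = l (r M)

    plus-cong : ∀ {M N} → M ≋ₘ N → plus M ≋ₘ plus N
    plus-cong p .entry i j = +-cong (l-cong p .entry i j) (r-cong p .entry i j)

    product-cong : ∀ {M N} → M ≋ₘ N → product M ≋ₘ product N
    product-cong p = l-cong (r-cong p)

    plus-skew : ∀ {M} → Skew M → Skew (plus M)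
    plus-skew {M} sk i j = begin
      l M i j + r M i j            ≈⟨ +-cong (lin-neg (λ k → sk k j) i) (lin-neg (λ k → sk i k) j) ⟩
      - r M j i + - l M j i        ≈⟨ solve 2 (λ a b → :- a :+ :- b := :- (b :+ a)) refl (r M j i) (l M j i) ⟩
      - plus M j i                 ∎

    product-skew : ∀ {M} → Skew M → Skew (product M)
    product-skew {M} sk i j = begin
      A (λ k → A (M k) j) i        ≈⟨ lin-neg (λ k → lin-neg (λ m → sk k m) j) i ⟩
      - r (l M) j i                ≈⟨ -‿cong (l-r-comm M .entry j i) ⟨
      - product M j i              ∎

    hs-+ˡ : ∀ (M M′ N : Mat d) → hs (λ i j → M i j + M′ i j) N ≈ hs M N + hs M′ N
    hs-+ˡ M M′ N = trans (sum-cong-≋ λ i → dot-⊕ˡ (M i) (M′ i) (N i))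
                         (∑-distrib-+ (λ i → dot (M i) (N i)) (λ i → dot (M′ i) (N i)))

    hs-comm : ∀ (M N : Mat d) → hs M N ≈ hs N M
    hs-comm M N = sum-cong-≋ λ i → dot-comm (M i) (N i)

    plus-self : ∀ M N → hs (plus M) N ≈ hs M (plus N)
    plus-self M N = begin
      hs (plus M) N                  ≈⟨ hs-+ˡ (l M) (r M) N ⟩
      hs (l M) N + hs (r M) N        ≈⟨ +-cong (trans (l-self M N) (hs-comm M (l N))) (trans (r-self M N) (hs-comm M (r N))) ⟩
      hs (l N) M + hs (r N) M        ≈⟨ hs-+ˡ (l N) (r N) M ⟨
      hs (plus N) M                  ≈⟨ hs-comm (plus N) M ⟩
      hs M (plus N)                  ∎

    product-self : ∀ M N → hs (product M) N ≈ hs M (product N)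
    product-self M N = begin
      hs (l (r M)) N       ≈⟨ l-self (r M) N ⟩
      hs (r M) (l N)       ≈⟨ r-self M (l N) ⟩
      hs M (r (l N))       ≈⟨ hs-cong {M = M} (entries λ _ _ → refl) (l-r-comm N) ⟨
      hs M (l (r N))       ∎

    -- `plus` is the sum and `product` the composite of `l` and `r`, which commute.
    plus-product-comm : ∀ M → plus (product M) ≋ₘ product (plus M)
    plus-product-comm M .entry i j = begin
      l (l (r M)) i j + r (l (r M)) i j          ≈⟨ +-cong (l-cong (l-r-comm M) .entry i j) (sym (l-r-comm (r M) .entry i j)) ⟩
      l (r (l M)) i j + l (r (r M)) i j          ≈⟨ lin-⊕ A-self (λ k → r (l M) k j) (λ k → r (r M) k j) .at i ⟨
      A (λ k → r (l M) k j + r (r M) k j) i      ≈⟨ lin-cong A-self (ptw λ k → lin-⊕ A-self (l M k) (r M k) .at j) .at i ⟨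
      l (r (plus M)) i j                         ∎

    module Plus    = SkewOperator plus plus-cong plus-skew (λ {M} {N} _ _ → plus-self M N)
    module Product = SkewOperator product product-cong product-skew (λ {M} {N} _ _ → product-self M N)

    Plus-Product-commute : Commute Plus.op Product.op
    Plus-Product-commute z = below-diagonal-cong (entries λ i j → begin
      plus (skew-matrix d (Product.op z)) i j     ≈⟨ plus-cong (Product.matrix-op z) .entry i j ⟩
      plus (product (skew-matrix d z)) i j        ≈⟨ plus-product-comm (skew-matrix d z) .entry i j ⟩
      product (plus (skew-matrix d z)) i j        ≈⟨ product-cong (Plus.matrix-op z) .entry i j ⟨
      product (skew-matrix d (Plus.op z)) i j     ∎)

    -- The discriminant is nonnegative because (A - α/2)² b = (α²/4 - β) b.
    quadratic⇒eigen : ∀ {α β b} → Nonzero b → A (A b) ≋ α · A b ⊕ (- β) · b → ¬ ¬ HasEigen A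
    quadratic⇒eigen {α} {β} {b} b≠0 quad = lem (w ≋ 0v) >>= λ p → return (found p)
      where
      half = inverse (1# + 1#) 2≉0
      h D : Carrier
      h = α * proj₁ half
      D = h * h + - β
      h+h≈α : h + h ≈ α
      h+h≈α = begin
        h + h                          ≈⟨ solve 3 (λ o a t → a :* t :+ a :* t := a :* (t :+ t)) refl 1# α (proj₁ half) ⟩
        α * (proj₁ half + proj₁ half)  ≈⟨ *-congˡ (trans (sym (trans (distribʳ _ 1# 1#) (+-cong (*-identityˡ _) (*-identityˡ _)))) (proj₂ half)) ⟩
        α * 1#                         ≈⟨ *-identityʳ α ⟩
        α                              ∎
      y : V d
      y = A b ⊕ (- h) · b
      A-y : ∀ i → A y i ≈ D * b i + h * y i
      A-y i = begin
        A y i                                               ≈⟨ lin-⊕ A-self (A b) ((- h) · b) .at i ⟩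
        A (A b) i + A ((- h) · b) i                         ≈⟨ +-cong (quad .at i) (lin-· A-self (- h) b .at i) ⟩
        α * A b i + - β * b i + - h * A b i                 ≈⟨ +-congʳ (+-congʳ (*-congʳ (sym h+h≈α))) ⟩
        (h + h) * A b i + - β * b i + - h * A b i           ≈⟨ solve 4 (λ h a t b → (h :+ h) :* a :+ :- t :* b :+ :- h :* a := (h :* h :+ :- t) :* b :+ h :* (a :+ :- h :* b)) refl h (A b i) β (b i) ⟩
        D * b i + h * y i                                   ∎
      yy≈Dbb : dot y y ≈ D * dot b b
      yy≈Dbb = begin
        dot y y                                       ≈⟨ dot-⊕ˡ (A b) ((- h) · b) y ⟩
        dot (A b) y + dot ((- h) · b) y               ≈⟨ +-cong (A-self .adj b y) (dot-·ˡ (- h) b y) ⟩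
        dot b (A y) + - h * dot b y                   ≈⟨ +-congʳ (dot-cong (≋-refl {x = b}) (ptw A-y)) ⟩
        dot b (D · b ⊕ h · y) + - h * dot b y         ≈⟨ +-congʳ (trans (dot-⊕ʳ b (D · b) (h · y)) (+-cong (dot-·ʳ D b b) (dot-·ʳ h b y))) ⟩
        D * dot b b + h * dot b y + - h * dot b y     ≈⟨ solve 3 (λ x h t → x :+ h :* t :+ :- h :* t := x) refl (D * dot b b) h (dot b y) ⟩
        D * dot b b                                   ∎
      0≤D : 0# ≤ D
      0≤D with total 0# D
      ... | inj₁ 0≤D = 0≤D
      ... | inj₂ D≤0 = ≤-reflexive (sym (x*y≈0⇒y≈0 (b≠0 ∘ dot-definite) (trans (*-comm _ D)
              (nonneg-sum≈0ˡ (≤-respʳ yy≈Dbb (dot-nonneg y)) (*-nonneg (0≤-neg D≤0) (dot-nonneg b))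
                (solve 2 (λ d b → d :* b :+ :- d :* b := con (ℤ.+ 0)) refl D (dot b b))))))
      s : Carrier
      s = proj₁ (sqrt D 0≤D)
      ss≈D : s * s ≈ D
      ss≈D = proj₂ (sqrt D 0≤D)
      -- This is (A - h + s) b. Since (A - h)² b = D b = s² b, it is annihilated by A - h - s; if it
      -- vanishes, b itself is an eigenvector for h - s.
      w : V d
      w = y ⊕ s · b
      found : w ≋ 0v ⊎ Nonzero w → HasEigen A
      degenerate : w ≋ 0v → A b ≋ (h + - s) · b
      degenerate w≋0 .at i = begin
        A b i                     ≈⟨ solve 4 (λ a h s b → a := (a :+ :- h :* b :+ s :* b) :+ (h :+ :- s) :* b) refl (A b i) h s (b i) ⟩
        w i + (h + - s) * b i     ≈⟨ +-congʳ (w≋0 .at i) ⟩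
        0# + (h + - s) * b i      ≈⟨ +-identityˡ _ ⟩
        (h + - s) * b i           ∎
      A-w : A w ≋ (h + s) · w
      found (inj₁ w≋0) = h + - s , b , b≠0 , degenerate w≋0
      found (inj₂ w≠0) = h + s , w , w≠0 , A-w
      A-w .at i = begin
        A w i                                                        ≈⟨ lin-⊕ A-self y (s · b) .at i ⟩
        A y i + A (s · b) i                                          ≈⟨ +-cong (A-y i) (lin-· A-self s b .at i) ⟩
        D * b i + h * y i + s * A b i                                ≈⟨ +-congʳ (+-congʳ (*-congʳ (sym ss≈D))) ⟩
        s * s * b i + h * (A b i + - h * b i) + s * A b i            ≈⟨ solve 4 (λ a h s b → s :* s :* b :+ h :* (a :+ :- h :* b) :+ s :* a := (h :+ s) :* (a :+ :- h :* b :+ s :* b)) refl (A b i) h s (b i) ⟩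
        (h + s) * w i                                                ∎

    -- If AM + MA = αM and AMA = βM, then A²M = αAM - AMA = αAM - βM, so each column of M satisfies
    -- the quadratic relation. If `A` had no eigenvector, all columns would vanish, and with them z.
    exterior⇒eigen : ¬ ¬ CommonEigen Plus.op Product.op → ¬ ¬ HasEigen A
    exterior⇒eigen common = common >>= λ (α , β , z , z≠0 , plus-z , product-z) no-eigen →
      let
        M = skew-matrix d z
        plus-M : ∀ i j → plus M i j ≈ α * M i j
        plus-M i j = trans (sym (Plus.matrix-op z .entry i j))
                       (trans (skew-matrix-cong d plus-z .entry i j) (skew-matrix-· d α z i j))
        product-M : ∀ i j → product M i j ≈ β * M i j
        product-M i j = trans (sym (Product.matrix-op z .entry i j))
                          (trans (skew-matrix-cong d product-z .entry i j) (skew-matrix-· d β z i j))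
        column : Fin d → V d
        column j i = M i j
        l-M : ∀ i j → l M i j ≈ α * M i j + - r M i j
        l-M i j = trans (solve 2 (λ a b → a := a :+ b :+ :- b) refl (l M i j) (r M i j)) (+-congʳ (plus-M i j))
        quad : ∀ j → A (A (column j)) ≋ α · A (column j) ⊕ (- β) · column j
        quad j = ptw λ i → begin
          A (A (column j)) i                                           ≈⟨ lin-cong A-self (ptw λ k → l-M k j) .at i ⟩
          A (α · column j ⊕ (λ k → - r M k j)) i                       ≈⟨ lin-⊕ A-self (α · column j) (λ k → - r M k j) .at i ⟩
          A (α · column j) i + A (λ k → - r M k j) i                   ≈⟨ +-cong (lin-· A-self α (column j) .at i) (trans (lin-neg (λ k → refl) i) (-‿cong (product-M i j))) ⟩
          α * A (column j) i + - (β * M i j)                           ≈⟨ +-congˡ (solve 2 (λ b m → :- (b :* m) := :- b :* m) refl β (M i j)) ⟩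
          α * A (column j) i + - β * M i j                             ∎
        column≋0 : ∀ j → column j ≋ 0v
        column≋0 j = ≋-stable λ column≠0 → quadratic⇒eigen column≠0 (quad j) no-eigen
        hs≈0 : hs M M ≈ 0#
        hs≈0 = trans (sum-cong-≋ λ i → dot-0ˡ (M i) (ptw λ j → column≋0 j .at i)) (sum-replicate-zero d)
      in z≠0 (dot-definite (double-cancel (trans (trans (sym (hs-skew-matrix d z z)) hs≈0) (sym (+-identityˡ 0#)))))

  have-eigen-suc : ∀ k → HaveEigen (suc k) → HaveEigen (suc (suc k))
  have-eigen-suc k have d A-self ∤d with 2 ℕ.^ suc k ∣? d
  ... | no ∤d′ = have d A-self ∤d′
  ... | yes ∣d = exterior⇒eigen A-self
    (common-eigen {suc k} have (triangle d) (Plus.op-self A-self) (Product.op-self A-self)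
      (Plus-Product-commute A-self) (triangle-∤ k ∣d ∤d))

  ∤2⇒odd : ∀ d → ¬ (2 ∣ d) → Odd d
  ∤2⇒odd zero          ∤d = contradiction (divides 0 ≡.refl) ∤d
  ∤2⇒odd (suc zero)    ∤d = 0 , ≡.refl
  ∤2⇒odd (suc (suc d)) ∤d = odd-suc-suc (∤2⇒odd d λ ∣d → ∤d (∣m∣n⇒∣m+n {2} {2} (divides 1 ≡.refl) ∣d))

  have-eigen : ∀ k → HaveEigen k
  have-eigen zero          d A-self ∤d = contradiction (1∣ d) ∤d
  have-eigen (suc zero)    d A-self ∤d = odd⇒eigen d A-self (∤2⇒odd d ∤d)
  have-eigen (suc (suc k)) = have-eigen-suc k (have-eigen (suc k))

  -- Every positive dimension is reached, since 2^(d+1) exceeds d + 1 and so cannot divide it.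
  spectral : ∀ d {A : V (suc d) → V (suc d)} → SelfAdjoint A → ¬ ¬ HasEigen A
  spectral d A-self = have-eigen (suc d) (suc d) A-self λ ∣d → ℕ.<⇒≱ (n<2^n (suc d)) (∣⇒≤ ∣d)

  -- If A² - ρ² did not vanish then A would have an eigenvector in its range.
  two-eigenvalues : ∀ {d} {A : V d → V d} → SelfAdjoint A → ∀ ρ →
    (∀ μ x → EigenPair A μ x → ¬ ¬ (μ ≈ ρ ⊎ μ ≈ - ρ)) → ∀ x → A (A x) ≋ (ρ * ρ) · x
  two-eigenvalues {d} {A} A-self ρ only x = ≋-stable (decompose d Q-self 0# >>= λ D → return (conclude D))
    where
    Q : V d → V d
    Q x = A (A x) ⊕ (- (ρ * ρ)) · x

    Q-self : SelfAdjoint Q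
    Q-self .adj x y = begin
      dot (Q x) y                                           ≈⟨ dot-⊕ˡ (A (A x)) ((- (ρ * ρ)) · x) y ⟩
      dot (A (A x)) y + dot ((- (ρ * ρ)) · x) y             ≈⟨ +-cong (trans (A-self .adj (A x) y) (A-self .adj x (A y))) (dot-·ˡ _ x y) ⟩
      dot x (A (A y)) + - (ρ * ρ) * dot x y                 ≈⟨ +-congˡ (dot-·ʳ _ x y) ⟨
      dot x (A (A y)) + dot x ((- (ρ * ρ)) · y)             ≈⟨ dot-⊕ʳ x (A (A y)) ((- (ρ * ρ)) · y) ⟨
      dot x (Q y)                                           ∎

    Q-A : Commute Q A
    Q-A x .at i = sym (trans (lin-⊕ A-self (A (A x)) ((- (ρ * ρ)) · x) .at i) (+-congˡ (lin-· A-self (- (ρ * ρ)) x .at i)))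

    Q-eigen : ∀ {μ v} → μ ≈ ρ ⊎ μ ≈ - ρ → A v ≋ μ · v → Q v ≋ 0# · v
    Q-eigen {μ} {v} μ≈ Av .at i = begin
      A (A v) i + - (ρ * ρ) * v i          ≈⟨ +-congʳ (trans (lin-cong A-self Av .at i) (trans (lin-· A-self μ v .at i) (*-congˡ (Av .at i)))) ⟩
      μ * (μ * v i) + - (ρ * ρ) * v i      ≈⟨ solve 3 (λ m r v → m :* (m :* v) :+ :- (r :* r) :* v := (m :* m :+ :- (r :* r)) :* v) refl μ ρ (v i) ⟩
      (μ * μ + - (ρ * ρ)) * v i            ≈⟨ *-congʳ (square-eq μ≈) ⟩
      0# * v i                             ∎
      where
      square-eq : μ ≈ ρ ⊎ μ ≈ - ρ → μ * μ + - (ρ * ρ) ≈ 0#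
      square-eq (inj₁ p) = trans (+-congʳ (*-cong p p)) (-‿inverseʳ _)
      square-eq (inj₂ p) = trans (+-congʳ (*-cong p p)) (solve 1 (λ r → :- r :* :- r :+ :- (r :* r) := con (ℤ.+ 0)) refl ρ)

    conclude : Decomposition Q 0# → A (A x) ≋ (ρ * ρ) · x
    conclude D = ptw λ i → x-y≈0⇒x≈y (trans (solve 3 (λ a r x → a :+ :- (r :* r :* x) := a :+ :- (r :* r) :* x) refl (A (A x) i) ρ (x i)) (Qx≋0 .at i))
      where
      open Decomposition D
      module IA = Invariance Q-self D A-self Q-A
      -- The range of `T` is the orthogonal complement of the kernel of `Q`. If t were positive,
      -- `spectral` would place an eigenvector of `A` there; its eigenvalue being ±ρ, it would also
      -- lie in that kernel.
      t-empty : ∀ t (T : V t → V d) (T* : V d → V t) → Adjoint T T* → (∀ {μ} {z : V t} → EigenPair (T* ∘ A ∘ T) μ z → ⊥) → (z : V t) → z ≋ 0v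
      t-empty zero    T T* T-adj none z = ptw λ ()
      t-empty (suc t) T T* T-adj none z = contradiction (λ (μ , z , pair) → none pair) (spectral t (restrict-self A-self T-adj))
      none : ∀ {μ z} → EigenPair (T* ∘ A ∘ T) μ z → ⊥
      none {μ} {z} pair@(z≠0 , _) with IA.lift-T pair
      ... | Tz≠0 , ATz = only μ (T z) (Tz≠0 , ATz) λ μ≈ →
        z≠0 (≋-trans (≋-sym (T-iso z)) (kernel (T z) (Q-eigen μ≈ ATz)))
      Qx≋0 : Q x ≋ 0v
      Qx≋0 = ≋-trans (lin-cong Q-self (≋-sym (complete x)))
        (≋-trans (lin-⊕ Q-self (S (S* x)) (T (T* x))) (ptw λ i →
          trans (+-cong (trans (eigen (S* x) .at i) (zeroˡ _))
                        (lin-0 Q-self (lin-0 T-adj (t-empty t T T* T-adj none (T* x))) .at i))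
                (+-identityˡ 0#)))

-- Signed graphs

module Σℕ = Algebra.Properties.Semiring.Sum ℕ.+-*-semiring
module Σℤ = Algebra.Properties.Semiring.Sum ℤ.+-*-semiring

foldr-allFin : ∀ {a} {A : Set a} (_∙_ : A → A → A) ε {m} (f : Fin (suc m) → A) →
  List.foldr _∙_ ε (List.map f (allFin (suc m))) ≡ f zero ∙ List.foldr _∙_ ε (List.map (f ∘ suc) (allFin m))
foldr-allFin _∙_ ε {m} f = ≡.cong (λ xs → f zero ∙ List.foldr _∙_ ε xs)
  (≡.trans (List.map-tabulate suc f) (≡.sym (List.map-tabulate id (f ∘ suc))))

sumℕ≡sum : ∀ {m} (f : Fin m → ℕ) → sumℕ f ≡ Σℕ.sum f
sumℕ≡sum {zero}  f = ≡.refl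
sumℕ≡sum {suc m} f = ≡.trans (foldr-allFin ℕ._+_ 0 f) (≡.cong (f zero ℕ.+_) (sumℕ≡sum (f ∘ suc)))

pos-sum : ∀ {m} (f : Fin m → ℕ) → + Σℕ.sum f ≡ Σℤ.sum (λ k → + f k)
pos-sum {zero}  f = ≡.refl
pos-sum {suc m} f = ≡.trans (ℤ.pos-+ (f zero) _) (≡.cong (λ t → (+ f zero) ℤ.+ t) (pos-sum (f ∘ suc)))

indicator : Bool → ℕ
indicator b = if b then 1 else 0

module _ {m} (G : SignedGraph m) where
  open SignedGraph G

  edge-square : ∀ i k → A i k ℤ.* A i k ≡ + indicator (isEdge G i k)
  edge-square i k with A i k | entries i k
  ... | _ | inj₁ ≡.refl        = ≡.refl
  ... | _ | inj₂ (inj₁ ≡.refl) = ≡.refl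
  ... | _ | inj₂ (inj₂ ≡.refl) = ≡.refl

  adj⇒edge : ∀ {i k} → Adj G i k → isEdge G i k ≡ true
  adj⇒edge {i} {k} adj with A i k
  ... | + zero   = contradiction ≡.refl adj
  ... | + suc _  = ≡.refl
  ... | -[1+ _ ] = ≡.refl

  edge⇒adj : ∀ {i k} → isEdge G i k ≡ true → Adj G i k
  edge⇒adj {i} {k} e with A i k
  ... | + suc _  = λ ()
  ... | -[1+ _ ] = λ ()

  nonadj⇒0 : ∀ {i k} → ¬ Adj G i k → A i k ≡ + 0
  nonadj⇒0 {i} {k} = decidable-stable (A i k ℤ.≟ + 0)

  nonadj⇒nonedge : ∀ {i k} → ¬ Adj G i k → isEdge G i k ≡ false
  nonadj⇒nonedge {i} {k} ¬adj rewrite nonadj⇒0 ¬adj = ≡.refl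

  edge-sym : ∀ i k → isEdge G i k ≡ isEdge G k i
  edge-sym i k rewrite symm i k = ≡.refl

  gram : Fin m → Fin m → ℤ
  gram i j = Σℤ.sum λ k → A i k ℤ.* A j k

  gram-diagonal : ∀ i → gram i i ≡ + degree G i
  gram-diagonal i = ≡.trans (Σℤ.sum-cong-≋ (edge-square i))
    (≡.trans (≡.sym (pos-sum f)) (≡.cong +_ (≡.sym (sumℕ≡sum f))))
    where
    f : Fin m → ℕ
    f k = indicator (isEdge G i k)

module Spectrum {c ℓ} (R : RealClosedField c ℓ) {m r} (G : SignedGraph m)
                (regular : Regular G r) (spectrum : HasSpectrumPM G R) where
  open SignedGraph G
  open DoubleNegation

  private
    R′ = Stabilisation.stableField R
    stable = stableField-stable R
    module K = RealClosedField R

  open RealClosedField R′ hiding (zero)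
  open OrderedField R′
  open Vectors R′ stable
  open SpectralTheorem R′ stable using (two-eigenvalues)
  open import Relation.Binary.Reasoning.Setoid setoid

  private
    a : Fin m → Fin m → Carrier
    a i j = embed (A i j)

    op : V m → V m
    op x i = dot (a i) x

    op-self : SelfAdjoint op
    op-self .adj x y = begin
      sum (λ i → dot (a i) x * y i)                 ≈⟨ sum-cong-≋ (λ i → *-distribʳ-sum (y i) (λ j → a i j * x j)) ⟩
      sum (λ i → sum λ j → a i j * x j * y i)       ≈⟨ ∑-comm (λ i j → a i j * x j * y i) ⟩
      sum (λ j → sum λ i → a i j * x j * y i)       ≈⟨ sum-cong-≋ (λ j → sum-cong-≋ λ i → trans
                                                        (solve 3 (λ a x y → a :* x :* y := x :* (a :* y)) refl (a i j) (x j) (y i))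
                                                        (*-congˡ (*-congʳ (reflexive (≡.cong embed (symm i j)))))) ⟩
      sum (λ j → sum λ i → x j * (a j i * y i))     ≈⟨ sum-cong-≋ (λ j → *-distribˡ-sum (x j) (λ i → a j i * y i)) ⟨
      sum (λ j → x j * dot (a j) y)                 ∎

    fromℕ≡embed : ∀ n → fromℕ G R n ≡ embed (+ n)
    fromℕ≡embed zero    = ≡.refl
    fromℕ≡embed (suc n) = ≡.cong (K._+_ K.1#) (fromℕ≡embed n)

    fromℤ≡embed : ∀ z → fromℤ G R z ≡ embed z
    fromℤ≡embed (+ n)    = fromℕ≡embed n
    fromℤ≡embed -[1+ n ] = ≡.cong K.-_ (fromℕ≡embed (suc n))

    sumK≡sum : ∀ {k} {f g : Fin k → Carrier} → (∀ i → f i ≡ g i) → sumK G R f ≡ sum g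
    sumK≡sum {zero}      f≗g = ≡.refl
    sumK≡sum {suc k} {f} f≗g = ≡.trans (foldr-allFin K._+_ K.0# f) (≡.cong₂ K._+_ (f≗g zero) (sumK≡sum (λ i → f≗g (suc i))))

    ρ : Carrier
    ρ = proj₁ spectrum

    -- The hypothesis on the spectrum uses the original equality and asks for an actual nonzero
    -- coordinate. The stable field gives these only under double negations, which `∀-Fin` gathers
    -- over the finitely many coordinates.
    eigen⇒eigenvalue : ∀ {μ x} → EigenPair op μ x → ¬ ¬ IsEigenvalue G R μ
    eigen⇒eigenvalue {μ} {x} (x≠0 , eq) = support >>= λ nz → ∀-Fin m equations >>= λ eqs → return (x , nz , eqs)
      where
      support : ¬ ¬ ∃ λ i → ¬ (x i K.≈ K.0#)
      support none = x≠0 (ptw λ i xᵢ≉0 → none (i , xᵢ≉0))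
      equations : ∀ i → ¬ ¬ (sumK G R (λ j → fromℤ G R (A i j) K.* x j) K.≈ (μ K.* x i))
      equations i = eq .at i >>= λ p → return (K.trans (K.reflexive (sumK≡sum (λ j → ≡.cong (K._* x j) (fromℤ≡embed (A i j))))) p)

    op-op : ∀ x → op (op x) ≋ (ρ * ρ) · x
    op-op = two-eigenvalues op-self ρ λ μ x pair → eigen⇒eigenvalue pair >>= λ ev →
      return (Sum.map return return (proj₂ (proj₂ (proj₂ (proj₂ spectrum))) μ ev))

    embed-sum : ∀ {k} (f : Fin k → ℤ) → embed (Σℤ.sum f) ≈ sum (λ i → embed (f i))
    embed-sum {zero}  f = refl
    embed-sum {suc k} f = trans (embed-+ (f zero) (Σℤ.sum (f ∘ suc))) (+-congˡ (embed-sum (f ∘ suc)))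

    -- As A is symmetric, AAᵀ is A², which `op-op` identifies with the scalar ρ².
    embed-gram : ∀ i j → embed (gram G i j) ≈ ρ * ρ * δ j i
    embed-gram i j = begin
      embed (gram G i j)                           ≈⟨ embed-sum (λ k → A i k ℤ.* A j k) ⟩
      sum (λ k → embed (A i k ℤ.* A j k))          ≈⟨ sum-cong-≋ (λ k → trans (embed-* (A i k) (A j k)) (*-congˡ (trans (reflexive (≡.cong embed (symm j k))) (sym (dot-δ (a k) j))))) ⟩
      op (op (δ j)) i                              ≈⟨ op-op (δ j) .at i ⟩
      ρ * ρ * δ j i                                ∎

    δ-diagonal : ∀ {d} (i : Fin d) → δ i i ≈ 1#
    δ-diagonal zero    = refl
    δ-diagonal (suc i) = δ-diagonal i

    δ-off-diagonal : ∀ {d} (i j : Fin d) → i ≢ j → δ i j ≈ 0#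
    δ-off-diagonal zero    zero    i≢j = contradiction ≡.refl i≢j
    δ-off-diagonal zero    (suc j) i≢j = refl
    δ-off-diagonal (suc i) zero    i≢j = refl
    δ-off-diagonal (suc i) (suc j) i≢j = δ-off-diagonal i j (i≢j ∘ ≡.cong suc)

    -- The way out of the double negation: the form of the integer decides, and a nonzero integer
    -- has a nonzero image.
    embed≈0⇒≡0 : ∀ z → embed z ≈ 0# → z ≡ + 0
    embed≈0⇒≡0 (+ zero)  eq = ≡.refl
    embed≈0⇒≡0 (+ suc n) eq = contradiction eq (embed-suc≉0 n)
    embed≈0⇒≡0 -[1+ n ]  eq = contradiction
      (trans (sym (-‿involutive _)) (trans (-‿cong eq) -0#≈0#)) (embed-suc≉0 n)
      where open import Algebra.Properties.Ring ring using (-‿involutive; -0#≈0#)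

  vertex : Fin m
  vertex = proj₁ (proj₁ (proj₂ (proj₁ (proj₂ (proj₂ spectrum)))))

  gram-same : ∀ i → gram G i i ≡ + r
  gram-same i = ≡.trans (gram-diagonal G i) (≡.cong +_ (regular i))

  gram-distinct : ∀ i j → i ≢ j → gram G i j ≡ + 0
  gram-distinct i j i≢j = embed≈0⇒≡0 _
    (trans (embed-gram i j) (trans (*-congˡ (δ-off-diagonal j i (i≢j ∘ ≡.sym))) (zeroʳ _)))

  -- If r = 0, the diagonal of A² = ρ² gives ρ = 0, contrary to ρ and -ρ being distinct.
  r≢0 : r ≢ 0
  r≢0 r≡0 = return ρ≈0 λ ρ≈′0 → ρ≈′0 λ p → ρ≉-ρ (K.trans p (K.sym (K.trans (K.-‿cong p) -0#≈0#)))
    where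
    open import Algebra.Properties.Ring K.ring using (-0#≈0#)
    ρ≉-ρ : ¬ (ρ K.≈ K.- ρ)
    ρ≉-ρ = proj₁ (proj₂ spectrum)
    ρ≈0 : ρ ≈ 0#
    ρ≈0 = square≈0 (begin
      ρ * ρ                          ≈⟨ *-identityʳ _ ⟨
      ρ * ρ * 1#                     ≈⟨ *-congˡ (δ-diagonal vertex) ⟨
      ρ * ρ * δ vertex vertex        ≈⟨ embed-gram vertex vertex ⟨
      embed (gram G vertex vertex)   ≡⟨ ≡.cong embed (≡.trans (gram-same vertex) (≡.cong +_ r≡0)) ⟩
      0#                             ∎)

-- Bipartite graphs and designs

-- An order-preserving partition of `Fin m` into classes of sizes a and b. In this inductive form,
-- sums and bijections split by recursion.
data Shuffle : ℕ → ℕ → ℕ → Set where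
  []    : Shuffle 0 0 0
  left  : ∀ {m a b} → Shuffle m a b → Shuffle (suc m) (suc a) b
  right : ∀ {m a b} → Shuffle m a b → Shuffle (suc m) a (suc b)

inL : ∀ {m a b} → Shuffle m a b → Fin a → Fin m
inL (left s)  zero    = zero
inL (left s)  (suc p) = suc (inL s p)
inL (right s) p       = suc (inL s p)

inR : ∀ {m a b} → Shuffle m a b → Fin b → Fin m
inR (left s)  q       = suc (inR s q)
inR (right s) zero    = zero
inR (right s) (suc q) = suc (inR s q)

join : ∀ {m a b} → Shuffle m a b → Fin a ⊎ Fin b → Fin m
join s = [ inL s , inR s ]′

split : ∀ {m a b} → Shuffle m a b → Fin m → Fin a ⊎ Fin b
split (left s)  zero    = inj₁ zero
split (left s)  (suc i) = Sum.map suc id (split s i)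
split (right s) zero    = inj₂ zero
split (right s) (suc i) = Sum.map id suc (split s i)

split-inL : ∀ {m a b} (s : Shuffle m a b) p → split s (inL s p) ≡ inj₁ p
split-inL (left s)  zero    = ≡.refl
split-inL (left s)  (suc p) rewrite split-inL s p = ≡.refl
split-inL (right s) p       rewrite split-inL s p = ≡.refl

split-inR : ∀ {m a b} (s : Shuffle m a b) q → split s (inR s q) ≡ inj₂ q
split-inR (left s)  q       rewrite split-inR s q = ≡.refl
split-inR (right s) zero    = ≡.refl
split-inR (right s) (suc q) rewrite split-inR s q = ≡.refl

split-join : ∀ {m a b} (s : Shuffle m a b) x → split s (join s x) ≡ x
split-join s (inj₁ p) = split-inL s p
split-join s (inj₂ q) = split-inR s q

join-split : ∀ {m a b} (s : Shuffle m a b) i → join s (split s i) ≡ i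
join-split (left s)  zero    = ≡.refl
join-split (left s)  (suc i) with split s i | join-split s i
... | inj₁ p | ≡.refl = ≡.refl
... | inj₂ q | ≡.refl = ≡.refl
join-split (right s) zero    = ≡.refl
join-split (right s) (suc i) with split s i | join-split s i
... | inj₁ p | ≡.refl = ≡.refl
... | inj₂ q | ≡.refl = ≡.refl

shuffle-size : ∀ {m a b} → Shuffle m a b → a ℕ.+ b ≡ m
shuffle-size []        = ≡.refl
shuffle-size (left s)  = ≡.cong suc (shuffle-size s)
shuffle-size (right {a = a} s) = ≡.trans (ℕ.+-suc a _) (≡.cong suc (shuffle-size s))

inL-injective : ∀ {m a b} (s : Shuffle m a b) {p p′} → inL s p ≡ inL s p′ → p ≡ p′
inL-injective s {p} {p′} eq = Data.Sum.Properties.inj₁-injective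
  (≡.trans (≡.sym (split-inL s p)) (≡.trans (≡.cong (split s) eq) (split-inL s p′)))
  where import Data.Sum.Properties

module _ {c ℓ} (M : CommutativeMonoid c ℓ) where
  open CommutativeMonoid M
  open Algebra.Properties.CommutativeMonoid.Sum M using (sum)

  sum-shuffle : ∀ {m a b} (s : Shuffle m a b) (f : Fin m → Carrier) →
                sum f ≈ sum (f ∘ inL s) ∙ sum (f ∘ inR s)
  sum-shuffle []        f = sym (identityˡ ε)
  sum-shuffle (left s)  f = trans (∙-congˡ (sum-shuffle s (f ∘ suc))) (sym (assoc _ _ _))
  sum-shuffle (right s) f = trans (∙-congˡ (sum-shuffle s (f ∘ suc)))
    (trans (sym (assoc _ _ _)) (trans (∙-congʳ (comm _ _)) (assoc _ _ _)))

colour-shuffle : ∀ {m} (col : Fin m → Bool) → ∃₂ λ a b → Σ (Shuffle m a b) λ s →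
                 (∀ p → col (inL s p) ≡ true) × (∀ q → col (inR s q) ≡ false)
colour-shuffle {zero}  col = 0 , 0 , [] , (λ ()) , (λ ())
colour-shuffle {suc m} col with colour-shuffle (col ∘ suc) | col zero in eq
... | a , b , s , L , R | true  = suc a , b , left s , (λ { zero → eq ; (suc p) → L p }) , R
... | a , b , s , L , R | false = a , suc b , right s , L , (λ { zero → eq ; (suc q) → R q })

sum-bound : ∀ {n k} (f : Fin n → ℕ) → (∀ i → f i ℕ.≤ k) → Σℕ.sum f ℕ.≤ n ℕ.* k
sum-bound {zero}  f f≤k = ℕ.z≤n
sum-bound {suc n} f f≤k = ℕ.+-mono-≤ (f≤k zero) (sum-bound (f ∘ suc) (f≤k ∘ suc))

sum-tight : ∀ {n k} (f : Fin n → ℕ) → (∀ i → f i ℕ.≤ k) → Σℕ.sum f ≡ n ℕ.* k → ∀ i → f i ≡ k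
sum-tight {suc n} {k} f f≤k eq zero = ℕ.≤-antisym (f≤k zero)
  (ℕ.+-cancelʳ-≤ (n ℕ.* k) _ _ (ℕ.≤-trans (ℕ.≤-reflexive (≡.sym eq)) (ℕ.+-monoʳ-≤ (f zero) (sum-bound (f ∘ suc) (f≤k ∘ suc)))))
sum-tight {suc n} {k} f f≤k eq (suc i) = sum-tight (f ∘ suc) (f≤k ∘ suc)
  (ℕ.≤-antisym (sum-bound (f ∘ suc) (f≤k ∘ suc))
    (ℕ.+-cancelˡ-≤ k _ _ (ℕ.≤-trans (ℕ.≤-reflexive (≡.sym eq)) (ℕ.+-monoˡ-≤ _ (f≤k zero))))) i

sum-const : ∀ n k → Σℕ.sum {n} (λ _ → k) ≡ n ℕ.* k
sum-const zero    k = ≡.refl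
sum-const (suc n) k = ≡.cong (k ℕ.+_) (sum-const n k)

indicator-∧ : ∀ a b → indicator (a ∧ b) ≡ indicator a ℕ.* indicator b
indicator-∧ true  true  = ≡.refl
indicator-∧ true  false = ≡.refl
indicator-∧ false b     = ≡.refl

indicator-idem : ∀ a → indicator (a ∧ a) ≡ indicator a
indicator-idem true  = ≡.refl
indicator-idem false = ≡.refl

2*choose : ∀ r → 2 ℕ.* (r C 2) ℕ.+ r ≡ r ℕ.* r
2*choose zero    = ≡.refl
2*choose (suc r) = begin
  2 ℕ.* (suc r C 2) ℕ.+ suc r            ≡⟨ ≡.cong (λ m → 2 ℕ.* m ℕ.+ suc r) (nCk+nC[k+1]≡[n+1]C[k+1] r 1) ⟨
  2 ℕ.* (r C 1 ℕ.+ r C 2) ℕ.+ suc r      ≡⟨ ≡.cong (λ m → 2 ℕ.* (m ℕ.+ r C 2) ℕ.+ suc r) (nC1≡n r) ⟩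
  2 ℕ.* (r ℕ.+ r C 2) ℕ.+ suc r          ≡⟨ rearrange r (r C 2) ⟩
  (2 ℕ.* (r C 2) ℕ.+ r) ℕ.+ r ℕ.+ suc r  ≡⟨ ≡.cong (λ m → m ℕ.+ r ℕ.+ suc r) (2*choose r) ⟩
  r ℕ.* r ℕ.+ r ℕ.+ suc r                ≡⟨ square r ⟩
  suc r ℕ.* suc r                        ∎
  where
  open ≡.≡-Reasoning
  rearrange : ∀ r c → 2 ℕ.* (r ℕ.+ c) ℕ.+ suc r ≡ (2 ℕ.* c ℕ.+ r) ℕ.+ r ℕ.+ suc r
  rearrange = solve-∀
  square : ∀ r → r ℕ.* r ℕ.+ r ℕ.+ suc r ≡ suc r ℕ.* suc r
  square = solve-∀

module Incidence {n r} (E : Fin (suc n) → Fin (suc n) → Bool)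
  (row    : ∀ p → Σℕ.sum (λ q → indicator (E p q)) ≡ r)
  (column : ∀ q → Σℕ.sum (λ p → indicator (E p q)) ≡ r)
  (pairs  : ∀ p p′ → p ≢ p′ → Σℕ.sum (λ q → indicator (E p q ∧ E p′ q)) ≡ 0 ⊎
                               Σℕ.sum (λ q → indicator (E p q ∧ E p′ q)) ≡ 2) where

  common : Fin (suc n) → Fin (suc n) → ℕ
  common p p′ = Σℕ.sum λ q → indicator (E p q ∧ E p′ q)

  common-self : ∀ p → common p p ≡ r
  common-self p = ≡.trans (Σℕ.sum-cong-≋ (λ q → indicator-idem (E p q))) (row p)

  -- Walks of length two from p are counted by their middle vertex: r choices for it, then r for the
  -- end.
  sum-common : ∀ p → Σℕ.sum (common p) ≡ r ℕ.* r
  sum-common p = begin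
    Σℕ.sum (λ p′ → Σℕ.sum λ q → e p′ q)                                        ≡⟨ Σℕ.∑-comm e ⟩
    Σℕ.sum (λ q → Σℕ.sum λ p′ → e p′ q)                                        ≡⟨ Σℕ.sum-cong-≋ inner ⟩
    Σℕ.sum (λ q → indicator (E p q) ℕ.* r)                                     ≡⟨ Σℕ.*-distribʳ-sum r (λ q → indicator (E p q)) ⟨
    Σℕ.sum (λ q → indicator (E p q)) ℕ.* r                                     ≡⟨ ≡.cong (ℕ._* r) (row p) ⟩
    r ℕ.* r                                                                    ∎
    where
    open ≡.≡-Reasoning
    e : Fin (suc n) → Fin (suc n) → ℕ
    e p′ q = indicator (E p q ∧ E p′ q)
    inner : ∀ q → Σℕ.sum (λ p′ → e p′ q) ≡ indicator (E p q) ℕ.* r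
    inner q = begin
      Σℕ.sum (λ p′ → e p′ q)                                          ≡⟨ Σℕ.sum-cong-≋ (λ p′ → indicator-∧ (E p q) (E p′ q)) ⟩
      Σℕ.sum (λ p′ → indicator (E p q) ℕ.* indicator (E p′ q))        ≡⟨ Σℕ.*-distribˡ-sum (indicator (E p q)) (λ p′ → indicator (E p′ q)) ⟨
      indicator (E p q) ℕ.* Σℕ.sum (λ p′ → indicator (E p′ q))        ≡⟨ ≡.cong (indicator (E p q) ℕ.*_) (column q) ⟩
      indicator (E p q) ℕ.* r                                         ∎

  others : Fin (suc n) → Fin n → ℕ
  others p j = common p (punchIn p j)

  others≤2 : ∀ p j → others p j ℕ.≤ 2
  others≤2 p j with pairs p (punchIn p j) (punchInᵢ≢i p j ∘ ≡.sym)
  ... | inj₁ eq = ℕ.≤-trans (ℕ.≤-reflexive eq) ℕ.z≤n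
  ... | inj₂ eq = ℕ.≤-reflexive eq

  sum-others : ∀ p → Σℕ.sum (others p) ≡ 2 ℕ.* (r C 2)
  sum-others p = ℕ.+-cancelˡ-≡ r _ _ (begin
    r ℕ.+ Σℕ.sum (others p)             ≡⟨ ≡.cong (ℕ._+ Σℕ.sum (others p)) (common-self p) ⟨
    common p p ℕ.+ Σℕ.sum (others p)    ≡⟨ Σℕ.sum-remove {i = p} (common p) ⟨
    Σℕ.sum (common p)                   ≡⟨ sum-common p ⟩
    r ℕ.* r                             ≡⟨ 2*choose r ⟨
    2 ℕ.* (r C 2) ℕ.+ r                 ≡⟨ ℕ.+-comm _ r ⟩
    r ℕ.+ 2 ℕ.* (r C 2)                 ∎)
    where open ≡.≡-Reasoning

  -- Each colour class has `suc n` vertices. The n vertices other than a fixed one receive r(r - 1)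
  -- walks in all, and each at most two.
  size-bound : (r C 2) ℕ.+ 1 ℕ.≤ suc n
  size-bound = ≡.subst (ℕ._≤ suc n) (ℕ.+-comm 1 (r C 2)) (ℕ.s≤s (ℕ.*-cancelˡ-≤ 2 (begin
    2 ℕ.* (r C 2)           ≡⟨ sum-others zero ⟨
    Σℕ.sum (others zero)    ≤⟨ sum-bound (others zero) (others≤2 zero) ⟩
    n ℕ.* 2                 ≡⟨ ℕ.*-comm n 2 ⟩
    2 ℕ.* n                 ∎)))
    where open ℕ.≤-Reasoning

  -- With equality in the bound every summand attains its maximum 2.
  common≡2 : suc n ≡ (r C 2) ℕ.+ 1 → ∀ p p′ → p ≢ p′ → common p p′ ≡ 2
  common≡2 eq p p′ p≢p′ = ≡.trans (≡.cong (common p) (≡.sym (punchIn-punchOut p≢p′)))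
    (sum-tight (others p) (others≤2 p) (≡.trans (sum-others p)
      (≡.trans (≡.cong (2 ℕ.*_) (≡.sym (ℕ.suc-injective (≡.trans eq (ℕ.+-comm (r C 2) 1))))) (ℕ.*-comm 2 n))) (punchOut p≢p′))

module Bipartition {m r} (G : SignedGraph m) (regular : Regular G r) (r≢0 : r ≢ 0)
                   {a b} (s : Shuffle m a b)
                   (L-L : ∀ p p′ → ¬ Adj G (inL s p) (inL s p′))
                   (R-R : ∀ q q′ → ¬ Adj G (inR s q) (inR s q′)) where
  open SignedGraph G

  E : Fin a → Fin b → Bool
  E p q = isEdge G (inL s p) (inR s q)

  N : Fin a → Fin b → ℤ
  N p q = A (inL s p) (inR s q)

  sum≡0 : ∀ {k} {f : Fin k → ℕ} → (∀ i → f i ≡ 0) → Σℕ.sum f ≡ 0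
  sum≡0 {k} f≡0 = ≡.trans (Σℕ.sum-cong-≋ f≡0) (Σℕ.sum-replicate-zero k)

  row : ∀ p → Σℕ.sum (λ q → indicator (E p q)) ≡ r
  row p = begin
    Σℕ.sum (λ q → e (inR s q))                                  ≡⟨ ≡.cong (ℕ._+ Σℕ.sum (λ q → e (inR s q))) (sum≡0 λ p′ → ≡.cong indicator (nonadj⇒nonedge G (L-L p p′))) ⟨
    Σℕ.sum (λ p′ → e (inL s p′)) ℕ.+ Σℕ.sum (λ q → e (inR s q))  ≡⟨ sum-shuffle ℕ.+-0-commutativeMonoid s e ⟨
    Σℕ.sum e                                                    ≡⟨ sumℕ≡sum e ⟨
    degree G (inL s p)                                          ≡⟨ regular (inL s p) ⟩
    r                                                           ∎
    where
    open ≡.≡-Reasoning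
    e : Fin m → ℕ
    e k = indicator (isEdge G (inL s p) k)

  column : ∀ q → Σℕ.sum (λ p → indicator (E p q)) ≡ r
  column q = begin
    Σℕ.sum (λ p → indicator (E p q))                             ≡⟨ Σℕ.sum-cong-≋ (λ p → ≡.cong indicator (edge-sym G (inL s p) (inR s q))) ⟩
    Σℕ.sum (λ p → e (inL s p))                                   ≡⟨ ℕ.+-identityʳ _ ⟨
    Σℕ.sum (λ p → e (inL s p)) ℕ.+ 0                             ≡⟨ ≡.cong (Σℕ.sum (λ p → e (inL s p)) ℕ.+_) (sum≡0 λ q′ → ≡.cong indicator (nonadj⇒nonedge G (R-R q q′))) ⟨
    Σℕ.sum (λ p → e (inL s p)) ℕ.+ Σℕ.sum (λ q′ → e (inR s q′))  ≡⟨ sum-shuffle ℕ.+-0-commutativeMonoid s e ⟨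
    Σℕ.sum e                                                     ≡⟨ sumℕ≡sum e ⟨
    degree G (inR s q)                                           ≡⟨ regular (inR s q) ⟩
    r                                                            ∎
    where
    open ≡.≡-Reasoning
    e : Fin m → ℕ
    e k = indicator (isEdge G (inR s q) k)

  -- The edges are counted from both sides and r ≠ 0 is cancelled.
  balanced : a ≡ b
  balanced = ℕ.*-cancelʳ-≡ a b r {{ℕ.≢-nonZero r≢0}} (begin
    a ℕ.* r                                                 ≡⟨ sum-const a r ⟨
    Σℕ.sum (λ (p : Fin a) → r)                              ≡⟨ Σℕ.sum-cong-≋ row ⟨
    Σℕ.sum (λ p → Σℕ.sum λ q → indicator (E p q))           ≡⟨ Σℕ.∑-comm (λ p q → indicator (E p q)) ⟩
    Σℕ.sum (λ q → Σℕ.sum λ p → indicator (E p q))           ≡⟨ Σℕ.sum-cong-≋ column ⟩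
    Σℕ.sum (λ (q : Fin b) → r)                              ≡⟨ sum-const b r ⟩
    b ℕ.* r                                                 ∎)
    where open ≡.≡-Reasoning

  common≡commonNeighbours : ∀ p p′ → Σℕ.sum (λ q → indicator (E p q ∧ E p′ q)) ≡ commonNeighbours G (inL s p) (inL s p′)
  common≡commonNeighbours p p′ = begin
    Σℕ.sum (λ q → e (inR s q))                                   ≡⟨ ≡.cong (ℕ._+ Σℕ.sum (λ q → e (inR s q))) (sum≡0 left-zero) ⟨
    Σℕ.sum (λ k → e (inL s k)) ℕ.+ Σℕ.sum (λ q → e (inR s q))    ≡⟨ sum-shuffle ℕ.+-0-commutativeMonoid s e ⟨
    Σℕ.sum e                                                     ≡⟨ sumℕ≡sum e ⟨
    commonNeighbours G (inL s p) (inL s p′)                      ∎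
    where
    open ≡.≡-Reasoning
    e : Fin m → ℕ
    e k = indicator (isEdge G (inL s p) k ∧ isEdge G (inL s p′) k)
    left-zero : ∀ k → e (inL s k) ≡ 0
    left-zero k rewrite nonadj⇒nonedge G (L-L p k) = ≡.refl

  -- The rows of left vertices are supported on the right vertices, so the orthogonality of rows
  -- passes from the adjacency matrix to `N`.
  N-gram : ∀ p p′ → Σℤ.sum (λ q → N p q ℤ.* N p′ q) ≡ gram G (inL s p) (inL s p′)
  N-gram p p′ = begin
    Σℤ.sum (λ q → e (inR s q))                                   ≡⟨ ℤ.+-identityˡ _ ⟨
    + 0 ℤ.+ Σℤ.sum (λ q → e (inR s q))                           ≡⟨ ≡.cong (ℤ._+ Σℤ.sum (λ q → e (inR s q))) (≡.trans (Σℤ.sum-cong-≋ left-zero) (Σℤ.sum-replicate-zero a)) ⟨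
    Σℤ.sum (λ k → e (inL s k)) ℤ.+ Σℤ.sum (λ q → e (inR s q))    ≡⟨ sum-shuffle ℤ.+-0-commutativeMonoid s e ⟨
    gram G (inL s p) (inL s p′)                                  ∎
    where
    open ≡.≡-Reasoning
    e : Fin m → ℤ
    e k = A (inL s p) k ℤ.* A (inL s p′) k
    left-zero : ∀ k → e (inL s k) ≡ + 0
    left-zero k rewrite nonadj⇒0 G (L-L p k) = ≡.refl

module Design {n r} (G : SignedGraph (2 ℕ.* n)) (regular : Regular G r) (r≢0 : r ≢ 0)
              (s : Shuffle (2 ℕ.* n) n n)
              (L-L : ∀ p p′ → ¬ Adj G (inL s p) (inL s p′))
              (R-R : ∀ q q′ → ¬ Adj G (inR s q) (inR s q′)) where
  open Bipartition G regular r≢0 s L-L R-R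

  incidence-graph : (∀ p p′ → p ≢ p′ → Σℕ.sum (λ q → indicator (E p q ∧ E p′ q)) ≡ 2) →
                    IsIncidenceGraphOfSBIBD G n r 2
  incidence-graph common≡2 = D , mk↔ₛ′ (split s) (join s) (split-join s) (join-split s) , λ i j →
      (λ adj → to (split s i) (split s j)
        (≡.subst₂ (Adj G) (≡.sym (join-split s i)) (≡.sym (join-split s j)) adj))
    , (λ inc → ≡.subst₂ (Adj G) (join-split s i) (join-split s j) (from (split s i) (split s j) inc))
    where
    D : SymmetricBIBD n r 2
    D = record
      { incidence   = E
      ; blockSize   = λ q → ≡.trans (sumℕ≡sum (λ p → indicator (E p q))) (column q)
      ; replication = λ p → ≡.trans (sumℕ≡sum (λ q → indicator (E p q))) (row p)
      ; pairCount   = λ p p′ p≢p′ → ≡.trans (sumℕ≡sum (λ q → indicator (E p q ∧ E p′ q))) (common≡2 p p′ p≢p′) }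
    to : ∀ x y → Adj G (join s x) (join s y) → IncAdj D x y
    to (inj₁ p) (inj₁ p′) adj = L-L p p′ adj
    to (inj₁ p) (inj₂ q)  adj = adj⇒edge G adj
    to (inj₂ q) (inj₁ p)  adj = ≡.trans (edge-sym G (inL s p) (inR s q)) (adj⇒edge G adj)
    to (inj₂ q) (inj₂ q′) adj = R-R q q′ adj
    from : ∀ x y → IncAdj D x y → Adj G (join s x) (join s y)
    from (inj₁ p) (inj₂ q) e = edge⇒adj G e
    from (inj₂ q) (inj₁ p) e = edge⇒adj G (≡.trans (edge-sym G (inR s q) (inL s p)) e)

-- Sums of squares

module Similarity where
  open import Data.Integer using (ℤ; +_; -[1+_]; _+_; _*_; -_; _-_)
  open import Algebra.Properties.AbelianGroup ℤ.+-0-abelianGroup using (∙-cancelˡ)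
  open ≡.≡-Reasoning

  infixl 6 _⊕_
  infixr 7 _⊙_
  _⊕_ : ∀ {n} → Vec ℤ n → Vec ℤ n → Vec ℤ n
  _⊕_ = Vec.zipWith _+_

  _⊙_ : ∀ {n} → ℤ → Vec ℤ n → Vec ℤ n
  k ⊙ x = Vec.map (k *_) x

  norm : ∀ {n} → Vec ℤ n → ℤ
  norm []       = + 0
  norm (x ∷ xs) = x * x + norm xs

  record Linear {m n} (f : Vec ℤ m → Vec ℤ n) : Set where
    field
      additive    : ∀ x y → f (x ⊕ y) ≡ f x ⊕ f y
      homogeneous : ∀ k x → f (k ⊙ x) ≡ k ⊙ f x
  open Linear

  id-linear : ∀ {n} → Linear {n} id
  id-linear .additive x y = ≡.refl
  id-linear .homogeneous k x = ≡.refl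

  ∘-linear : ∀ {l m n} {f : Vec ℤ m → Vec ℤ n} {g : Vec ℤ l → Vec ℤ m} →
             Linear f → Linear g → Linear (f ∘ g)
  ∘-linear {f = f} F G .additive x y = ≡.trans (≡.cong f (G .additive x y)) (F .additive _ _)
  ∘-linear {f = f} F G .homogeneous k x = ≡.trans (≡.cong f (G .homogeneous k x)) (F .homogeneous k _)

  ⊙-⊕ : ∀ {n} k (x y : Vec ℤ n) → k ⊙ (x ⊕ y) ≡ k ⊙ x ⊕ k ⊙ y
  ⊙-⊕ k []       []       = ≡.refl
  ⊙-⊕ k (x ∷ xs) (y ∷ ys) = ≡.cong₂ _∷_ (ℤ.*-distribˡ-+ k x y) (⊙-⊕ k xs ys)

  ⊙-⊙ : ∀ {n} j k (x : Vec ℤ n) → j ⊙ k ⊙ x ≡ k ⊙ j ⊙ x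
  ⊙-⊙ j k []       = ≡.refl
  ⊙-⊙ j k (x ∷ xs) = ≡.cong₂ _∷_ (swap j k x) (⊙-⊙ j k xs)
    where
    swap : ∀ j k x → j * (k * x) ≡ k * (j * x)
    swap = ℤ-solve-∀

  ⊕-interchange : ∀ {n} (a b c d : Vec ℤ n) → (a ⊕ b) ⊕ (c ⊕ d) ≡ (a ⊕ c) ⊕ (b ⊕ d)
  ⊕-interchange []       []       []       []       = ≡.refl
  ⊕-interchange (a ∷ as) (b ∷ bs) (c ∷ cs) (d ∷ ds) = ≡.cong₂ _∷_ (swap a b c d) (⊕-interchange as bs cs ds)
    where
    swap : ∀ a b c d → (a + b) + (c + d) ≡ (a + c) + (b + d)
    swap = ℤ-solve-∀

  ⊙-linear : ∀ {m n} k {f : Vec ℤ m → Vec ℤ n} → Linear f → Linear (λ x → k ⊙ f x)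
  ⊙-linear k F .additive x y = ≡.trans (≡.cong (k ⊙_) (F .additive x y)) (⊙-⊕ k _ _)
  ⊙-linear k F .homogeneous j x = ≡.trans (≡.cong (k ⊙_) (F .homogeneous j x)) (⊙-⊙ k j _)

  ⊕-linear : ∀ {m n} {f g : Vec ℤ m → Vec ℤ n} → Linear f → Linear g → Linear (λ x → f x ⊕ g x)
  ⊕-linear F G .additive x y = ≡.trans (≡.cong₂ _⊕_ (F .additive x y) (G .additive x y)) (⊕-interchange _ _ _ _)
  ⊕-linear F G .homogeneous k x = ≡.trans (≡.cong₂ _⊕_ (F .homogeneous k x) (G .homogeneous k x)) (≡.sym (⊙-⊕ k _ _))

  ++-⊕ : ∀ {m n} (a b : Vec ℤ m) (c d : Vec ℤ n) → (a ⊕ b) Vec.++ (c ⊕ d) ≡ (a Vec.++ c) ⊕ (b Vec.++ d)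
  ++-⊕ a b c d = ≡.sym (Vec.zipWith-++ _+_ a c b d)

  ++-linear : ∀ {l m n} {f : Vec ℤ l → Vec ℤ m} {g : Vec ℤ l → Vec ℤ n} →
              Linear f → Linear g → Linear (λ x → f x Vec.++ g x)
  ++-linear {f = f} {g} F G .additive x y = ≡.trans (≡.cong₂ Vec._++_ (F .additive x y) (G .additive x y)) (++-⊕ (f x) (f y) (g x) (g y))
  ++-linear {f = f} {g} F G .homogeneous k x = ≡.trans (≡.cong₂ Vec._++_ (F .homogeneous k x) (G .homogeneous k x)) (≡.sym (Vec.map-++ (k *_) (f x) (g x)))

  take-linear : ∀ m {n} → Linear {m ℕ.+ n} (Vec.take m)
  take-linear m .additive x y = Vec.take-zipWith _+_ x y
  take-linear m .homogeneous k x = Vec.take-map (k *_) m x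

  drop-linear : ∀ m {n} → Linear {m ℕ.+ n} (Vec.drop m)
  drop-linear m .additive x y = Vec.drop-zipWith _+_ x y
  drop-linear m .homogeneous k x = Vec.drop-map (k *_) m x

  tail-linear : ∀ {n} → Linear {suc n} Vec.tail
  tail-linear .additive (x ∷ xs) (y ∷ ys) = ≡.refl
  tail-linear .homogeneous k (x ∷ xs) = ≡.refl

  norm-⊙ : ∀ {n} k (x : Vec ℤ n) → norm (k ⊙ x) ≡ k * k * norm x
  norm-⊙ k []       = ≡.sym (ℤ.*-zeroʳ (k * k))
  norm-⊙ k (x ∷ xs) = ≡.trans (≡.cong (λ t → k * x * (k * x) + t) (norm-⊙ k xs)) (factor k x (norm xs))
    where
    factor : ∀ k x n → k * x * (k * x) + k * k * n ≡ k * k * (x * x + n)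
    factor = ℤ-solve-∀

  norm-++ : ∀ {m n} (x : Vec ℤ m) (y : Vec ℤ n) → norm (x Vec.++ y) ≡ norm x + norm y
  norm-++ []       y = ≡.sym (ℤ.+-identityˡ _)
  norm-++ (x ∷ xs) y = ≡.trans (≡.cong (λ t → x * x + t) (norm-++ xs y)) (≡.sym (ℤ.+-assoc (x * x) _ _))

  norm-take-drop : ∀ m {n} (x : Vec ℤ (m ℕ.+ n)) → norm x ≡ norm (Vec.take m x) + norm (Vec.drop m x)
  norm-take-drop m x = ≡.trans (≡.cong norm (≡.sym (Vec.take++drop≡id m x))) (norm-++ (Vec.take m x) _)

  -- ⟨p,q⟩ represents p + q, with orthogonal complement ⟨pq(p+q)⟩.
  norm-combine : ∀ {n} p q (x y : Vec ℤ n) →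
    norm (p ⊙ x ⊕ q ⊙ y) + p * q * norm (x ⊕ (- + 1) ⊙ y) ≡ (p + q) * (p * norm x + q * norm y)
  norm-combine p q [] [] = vanish p q
    where
    vanish : ∀ p q → + 0 + p * q * + 0 ≡ (p + q) * (p * + 0 + q * + 0)
    vanish = ℤ-solve-∀
  norm-combine p q (x ∷ xs) (y ∷ ys) =
    ≡.trans (collect p q x y _ _) (≡.trans (≡.cong (λ t → (p * x + q * y) * (p * x + q * y) + p * q * ((x - y) * (x - y)) + t) (norm-combine p q xs ys)) (distribute p q x y (norm xs) (norm ys)))
    where
    collect : ∀ p q x y a b →
      (p * x + q * y) * (p * x + q * y) + a + p * q * ((x + (- + 1) * y) * (x + (- + 1) * y) + b) ≡
      ((p * x + q * y) * (p * x + q * y) + p * q * ((x - y) * (x - y))) + (a + p * q * b)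
    collect = ℤ-solve-∀
    distribute : ∀ p q x y a b →
      ((p * x + q * y) * (p * x + q * y) + p * q * ((x - y) * (x - y))) + (p + q) * (p * a + q * b) ≡
      (p + q) * (p * (x * x + a) + q * (y * y + b))
    distribute = ℤ-solve-∀

  *-≢0 : ∀ {x y} → x ≢ + 0 → y ≢ + 0 → x * y ≢ + 0
  *-≢0 {x} x≢0 y≢0 xy≡0 with ℤ.i*j≡0⇒i≡0∨j≡0 x xy≡0
  ... | inj₁ x≡0 = x≢0 x≡0
  ... | inj₂ y≡0 = y≢0 y≡0

  -- Up to a rational scaling, the form r(x₁² + ⋯ + xₙ²) is isometric to x₁² + ⋯ + xₙ².
  record Similar (n : ℕ) (r : ℤ) : Set where
    field
      P      : Vec ℤ n → Vec ℤ n
      linear : Linear P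
      σ      : ℤ
      σ≢0    : σ ≢ + 0
      scales : ∀ x → r * norm (P x) ≡ σ * σ * norm x
  open Similar

  similar-0 : ∀ r → Similar 0 r
  similar-0 r .P = id
  similar-0 r .linear = id-linear
  similar-0 r .σ = + 1
  similar-0 r .σ≢0 ()
  similar-0 r .scales [] = ℤ.*-zeroʳ r

  similar-1 : ∀ n → Similar n (+ 1)
  similar-1 n .P = id
  similar-1 n .linear = id-linear
  similar-1 n .σ = + 1
  similar-1 n .σ≢0 ()
  similar-1 n .scales x = ≡.refl

  -- Each block is multiplied by the scale of the other one, so that both end up with the same σ.
  similar-+ : ∀ {m n r} → Similar m r → Similar n r → Similar (m ℕ.+ n) r
  similar-+ {m} S T .P x = (T .σ ⊙ S .P (Vec.take m x)) Vec.++ (S .σ ⊙ T .P (Vec.drop m x))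
  similar-+ {m} S T .linear = ++-linear (⊙-linear (T .σ) (∘-linear (S .linear) (take-linear m)))
                                        (⊙-linear (S .σ) (∘-linear (T .linear) (drop-linear m)))
  similar-+ S T .σ = S .σ * T .σ
  similar-+ S T .σ≢0 = *-≢0 (S .σ≢0) (T .σ≢0)
  similar-+ {m} {n} {r} S T .scales x = begin
    r * norm ((τ ⊙ S .P a) Vec.++ (ς ⊙ T .P b))                      ≡⟨ ≡.cong (r *_) (norm-++ (τ ⊙ S .P a) (ς ⊙ T .P b)) ⟩
    r * (norm (τ ⊙ S .P a) + norm (ς ⊙ T .P b))                      ≡⟨ ≡.cong (r *_) (≡.cong₂ _+_ (norm-⊙ τ (S .P a)) (norm-⊙ ς (T .P b))) ⟩
    r * (τ * τ * norm (S .P a) + ς * ς * norm (T .P b))              ≡⟨ regroup r τ ς _ _ ⟩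
    τ * τ * (r * norm (S .P a)) + ς * ς * (r * norm (T .P b))        ≡⟨ ≡.cong₂ (λ u v → τ * τ * u + ς * ς * v) (S .scales a) (T .scales b) ⟩
    τ * τ * (ς * ς * norm a) + ς * ς * (τ * τ * norm b)              ≡⟨ collect τ ς (norm a) (norm b) ⟩
    ς * τ * (ς * τ) * (norm a + norm b)                              ≡⟨ ≡.cong (ς * τ * (ς * τ) *_) (norm-take-drop m x) ⟨
    ς * τ * (ς * τ) * norm x                                         ∎
    where
    ς = S .σ
    τ = T .σ
    a = Vec.take m x
    b = Vec.drop m x
    regroup : ∀ r τ ς u v → r * (τ * τ * u + ς * ς * v) ≡ τ * τ * (r * u) + ς * ς * (r * v)
    regroup = ℤ-solve-∀
    collect : ∀ τ ς u v → τ * τ * (ς * ς * u) + ς * ς * (τ * τ * v) ≡ ς * τ * (ς * τ) * (u + v)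
    collect = ℤ-solve-∀

  similar-* : ∀ k {n r} → Similar n r → Similar (k ℕ.* n) r
  similar-* zero    S = similar-0 _
  similar-* (suc k) S = similar-+ S (similar-* k S)

  -- Pfister's theorem that the values of a Pfister form are similarity factors, for 2ⁿ⟨1⟩.
  similar-double : ∀ {n p q} → p + q ≢ + 0 → Similar n p → Similar n q → Similar (n ℕ.+ n) (p + q)
  similar-double {n} {p} {q} p+q≢0 S T = record
    { P = λ x → U x Vec.++ W x
    ; linear = ++-linear (⊙-linear (ς * τ) (⊕-linear (⊙-linear p X-linear) (⊙-linear q Y-linear)))
                 (⊙-linear (p * q) (∘-linear (S .linear) (∘-linear (T .linear) (⊕-linear X-linear (⊙-linear (- + 1) Y-linear)))))
    ; σ = (p + q) * (ς * τ * (ς * τ))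
    ; σ≢0 = *-≢0 p+q≢0 (*-≢0 ςτ≢0 ςτ≢0)
    ; scales = scales′ }
    where
    ς = S .σ
    τ = T .σ
    ςτ≢0 : ς * τ ≢ + 0
    ςτ≢0 = *-≢0 (S .σ≢0) (T .σ≢0)
    X Y Z U W : Vec ℤ (n ℕ.+ n) → Vec ℤ n
    X x = τ ⊙ S .P (Vec.take n x)
    Y x = ς ⊙ T .P (Vec.drop n x)
    Z x = X x ⊕ (- + 1) ⊙ Y x
    U x = (ς * τ) ⊙ (p ⊙ X x ⊕ q ⊙ Y x)
    -- `S .P` multiplies norms by ς²/p and `T .P` by τ²/q. The scalar pq, entering squared, makes
    -- the total factor pq(ςτ)², as the second term of `norm-combine` demands.
    W x = (p * q) ⊙ S .P (T .P (Z x))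
    X-linear = ⊙-linear τ (∘-linear (S .linear) (take-linear n))
    Y-linear = ⊙-linear ς (∘-linear (T .linear) (drop-linear n))
    norm-W : ∀ x → norm (W x) ≡ ς * τ * (ς * τ) * (p * q * norm (Z x))
    norm-W x = begin
      norm (W x)                                              ≡⟨ norm-⊙ (p * q) (S .P (T .P (Z x))) ⟩
      p * q * (p * q) * norm (S .P (T .P (Z x)))              ≡⟨ step₁ p q (norm (S .P (T .P (Z x)))) ⟩
      p * q * q * (p * norm (S .P (T .P (Z x))))              ≡⟨ ≡.cong (p * q * q *_) (S .scales (T .P (Z x))) ⟩
      p * q * q * (ς * ς * norm (T .P (Z x)))                 ≡⟨ step₂ p q ς (norm (T .P (Z x))) ⟩
      p * q * (ς * ς) * (q * norm (T .P (Z x)))               ≡⟨ ≡.cong (p * q * (ς * ς) *_) (T .scales (Z x)) ⟩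
      p * q * (ς * ς) * (τ * τ * norm (Z x))                  ≡⟨ step₃ p q ς τ (norm (Z x)) ⟩
      ς * τ * (ς * τ) * (p * q * norm (Z x))                  ∎
      where
      step₁ : ∀ p q m → p * q * (p * q) * m ≡ p * q * q * (p * m)
      step₁ = ℤ-solve-∀
      step₂ : ∀ p q ς m → p * q * q * (ς * ς * m) ≡ p * q * (ς * ς) * (q * m)
      step₂ = ℤ-solve-∀
      step₃ : ∀ p q ς τ m → p * q * (ς * ς) * (τ * τ * m) ≡ ς * τ * (ς * τ) * (p * q * m)
      step₃ = ℤ-solve-∀
    norm-XY : ∀ x → p * norm (X x) + q * norm (Y x) ≡ ς * τ * (ς * τ) * norm x
    norm-XY x = begin
      p * norm (X x) + q * norm (Y x)                                    ≡⟨ ≡.cong₂ (λ u v → p * u + q * v) (norm-⊙ τ (S .P a)) (norm-⊙ ς (T .P b)) ⟩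
      p * (τ * τ * norm (S .P a)) + q * (ς * ς * norm (T .P b))          ≡⟨ step₁ p q ς τ (norm (S .P a)) (norm (T .P b)) ⟩
      τ * τ * (p * norm (S .P a)) + ς * ς * (q * norm (T .P b))          ≡⟨ ≡.cong₂ (λ u v → τ * τ * u + ς * ς * v) (S .scales a) (T .scales b) ⟩
      τ * τ * (ς * ς * norm a) + ς * ς * (τ * τ * norm b)                ≡⟨ step₂ ς τ (norm a) (norm b) ⟩
      ς * τ * (ς * τ) * (norm a + norm b)                                ≡⟨ ≡.cong (ς * τ * (ς * τ) *_) (norm-take-drop n x) ⟨
      ς * τ * (ς * τ) * norm x                                           ∎
      where
      a = Vec.take n x
      b = Vec.drop n x
      step₁ : ∀ p q ς τ u v → p * (τ * τ * u) + q * (ς * ς * v) ≡ τ * τ * (p * u) + ς * ς * (q * v)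
      step₁ = ℤ-solve-∀
      step₂ : ∀ ς τ u v → τ * τ * (ς * ς * u) + ς * ς * (τ * τ * v) ≡ ς * τ * (ς * τ) * (u + v)
      step₂ = ℤ-solve-∀
    scales′ : ∀ x → (p + q) * norm (U x Vec.++ W x) ≡
                    (p + q) * (ς * τ * (ς * τ)) * ((p + q) * (ς * τ * (ς * τ))) * norm x
    scales′ x = begin
      (p + q) * norm (U x Vec.++ W x)                                            ≡⟨ ≡.cong ((p + q) *_) (norm-++ (U x) (W x)) ⟩
      (p + q) * (norm (U x) + norm (W x))                                        ≡⟨ ≡.cong ((p + q) *_) (≡.cong₂ _+_ (norm-⊙ (ς * τ) V) (norm-W x)) ⟩
      (p + q) * (k * norm V + k * (p * q * norm (Z x)))                          ≡⟨ step₁ (p + q) k (norm V) (p * q * norm (Z x)) ⟩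
      (p + q) * k * (norm V + p * q * norm (Z x))                                ≡⟨ ≡.cong ((p + q) * k *_) (≡.trans (norm-combine p q (X x) (Y x)) (≡.cong ((p + q) *_) (norm-XY x))) ⟩
      (p + q) * k * ((p + q) * (k * norm x))                                     ≡⟨ step₂ (p + q) k (norm x) ⟩
      (p + q) * k * ((p + q) * k) * norm x                                       ∎
      where
      V = p ⊙ X x ⊕ q ⊙ Y x
      k = ς * τ * (ς * τ)
      step₁ : ∀ r k u v → r * (k * u + k * v) ≡ r * k * (u + v)
      step₁ = ℤ-solve-∀
      step₂ : ∀ r k m → r * k * (r * (k * m)) ≡ r * k * (r * k) * m
      step₂ = ℤ-solve-∀

  -- If r ≤ 2^k, two copies of the smaller similarity suffice. Otherwise r is 2^k plus a positive
  -- excess of at most 2^k, and doubling applies to these two summands.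
  similar-2^ : ∀ k {r} → 1 ℕ.≤ r → r ℕ.≤ 2 ℕ.^ k → Similar (2 ℕ.^ k) (+ r)
  similar-2^ zero    1≤r r≤1 = ≡.subst (λ r → Similar 1 (+ r)) (ℕ.≤-antisym 1≤r r≤1) (similar-1 1)
  similar-2^ (suc k) {r} 1≤r r≤2^k+1 = ≡.subst (λ m → Similar (2 ℕ.^ k ℕ.+ m) (+ r)) (≡.sym (ℕ.+-identityʳ (2 ℕ.^ k))) doubled
    where
    doubled : Similar (2 ℕ.^ k ℕ.+ 2 ℕ.^ k) (+ r)
    doubled with r ℕ.≤? 2 ℕ.^ k
    ... | yes r≤2^k = similar-+ (similar-2^ k 1≤r r≤2^k) (similar-2^ k 1≤r r≤2^k)
    ... | no  r≰2^k = ≡.subst (Similar (2 ℕ.^ k ℕ.+ 2 ℕ.^ k)) sum≡r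
        (similar-double (λ eq → ℕ.<⇒≢ 1≤r (≡.sym (ℤ.+-injective (≡.trans (≡.sym sum≡r) eq))))
          (similar-2^ k (ℕ.m^n>0 2 k) ℕ.≤-refl)
          (similar-2^ k (ℕ.m<n⇒0<n∸m 2^k<r) excess≤2^k))
      where
      2^k<r = ℕ.≰⇒> r≰2^k
      sum≡r : + (2 ℕ.^ k) + + (r ℕ.∸ 2 ℕ.^ k) ≡ + r
      sum≡r = ≡.cong +_ (ℕ.m+[n∸m]≡n (ℕ.<⇒≤ 2^k<r))
      excess≤2^k : r ℕ.∸ 2 ℕ.^ k ℕ.≤ 2 ℕ.^ k
      excess≤2^k = ℕ.m≤n+o⇒m∸n≤o r (2 ℕ.^ k) (≡.subst (λ m → r ℕ.≤ 2 ℕ.^ k ℕ.+ m) (ℕ.+-identityʳ _) r≤2^k+1)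

  -- The diagonal form with t coefficients 1 followed by s coefficients r.
  mixed : ∀ r t {s} → Vec ℤ (t ℕ.+ s) → ℤ
  mixed r zero    x        = r * norm x
  mixed r (suc t) (x ∷ xs) = x * x + mixed r t xs

  mixed-⊙ : ∀ r t {s} k (x : Vec ℤ (t ℕ.+ s)) → mixed r t (k ⊙ x) ≡ k * k * mixed r t x
  mixed-⊙ r zero    k x = ≡.trans (≡.cong (r *_) (norm-⊙ k x)) (swap r k (norm x))
    where
    swap : ∀ r k n → r * (k * k * n) ≡ k * k * (r * n)
    swap = ℤ-solve-∀
  mixed-⊙ r (suc t) k (x ∷ xs) = ≡.trans (≡.cong (λ m → k * x * (k * x) + m) (mixed-⊙ r t k xs)) (factor k x (mixed r t xs))
    where
    factor : ∀ k x n → k * x * (k * x) + k * k * n ≡ k * k * (x * x + n)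
    factor = ℤ-solve-∀

  mixed-take-drop : ∀ r t {s} (x : Vec ℤ (t ℕ.+ s)) → mixed r t x ≡ norm (Vec.take t x) + r * norm (Vec.drop t x)
  mixed-take-drop r zero    x = ≡.sym (ℤ.+-identityˡ _)
  mixed-take-drop r (suc t) (x ∷ xs) = ≡.trans (≡.cong (λ m → x * x + m) (mixed-take-drop r t xs)) (≡.sym (ℤ.+-assoc (x * x) _ _))

  -- The state of the Witt cancellation: an isometry, up to the square ρ², from the mixed form to
  -- the sum of t + s squares.
  record Represents (r : ℤ) (t s : ℕ) : Set where
    field
      Y      : Vec ℤ (t ℕ.+ s) → Vec ℤ (t ℕ.+ s)
      linear : Linear Y
      ρ      : ℤ
      ρ≢0    : ρ ≢ + 0
      scales : ∀ x → norm (Y x) ≡ ρ * ρ * mixed r t x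

  module _ {r t s} (Rep : Represents r (suc t) s) where
    open Represents Rep renaming (linear to Y-linear; scales to Y-scales)

    private
      head-⊕ : ∀ {n} (x y : Vec ℤ (suc n)) → Vec.head (x ⊕ y) ≡ Vec.head x + Vec.head y
      head-⊕ (x ∷ xs) (y ∷ ys) = ≡.refl

      head-⊙ : ∀ {n} k (x : Vec ℤ (suc n)) → Vec.head (k ⊙ x) ≡ k * Vec.head x
      head-⊙ k (x ∷ xs) = ≡.refl

      cons-0-linear : ∀ {n} → Linear {n} (+ 0 ∷_)
      cons-0-linear .additive x y = ≡.refl
      cons-0-linear .homogeneous k x = ≡.cong (_∷ k ⊙ x) (≡.sym (ℤ.*-zeroʳ k))

      e : Vec ℤ (suc t ℕ.+ s)
      e = + 1 ∷ Vec.replicate _ (+ 0)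

      c : ℤ
      c = Vec.head (Y e)

      L : Vec ℤ (t ℕ.+ s) → ℤ
      L x = Vec.head (Y (+ 0 ∷ x))

      L-⊕ : ∀ x y → L (x ⊕ y) ≡ L x + L y
      L-⊕ x y = ≡.trans (≡.cong Vec.head (∘-linear Y-linear cons-0-linear .additive x y)) (head-⊕ (Y (+ 0 ∷ x)) (Y (+ 0 ∷ y)))

      L-⊙ : ∀ k x → L (k ⊙ x) ≡ k * L x
      L-⊙ k x = ≡.trans (≡.cong Vec.head (∘-linear Y-linear cons-0-linear .homogeneous k x)) (head-⊙ k (Y (+ 0 ∷ x)))

      0-⊕ : ∀ {n} k (x : Vec ℤ n) → k ⊙ Vec.replicate n (+ 0) ⊕ x ≡ x
      0-⊕ k []       = ≡.refl
      0-⊕ k (x ∷ xs) = ≡.cong₂ _∷_ (≡.trans (≡.cong (λ m → m + x) (ℤ.*-zeroʳ k)) (ℤ.+-identityˡ x)) (0-⊕ k xs)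

      head-Y : ∀ a x → Vec.head (Y (a ∷ x)) ≡ a * c + L x
      head-Y a x = begin
        Vec.head (Y (a ∷ x))                          ≡⟨ ≡.cong (λ v → Vec.head (Y v)) (≡.cong₂ _∷_ (unit a) (≡.sym (0-⊕ a x))) ⟩
        Vec.head (Y (a ⊙ e ⊕ (+ 0 ∷ x)))              ≡⟨ ≡.cong Vec.head (Y-linear .additive (a ⊙ e) (+ 0 ∷ x)) ⟩
        Vec.head (Y (a ⊙ e) ⊕ Y (+ 0 ∷ x))            ≡⟨ head-⊕ (Y (a ⊙ e)) (Y (+ 0 ∷ x)) ⟩
        Vec.head (Y (a ⊙ e)) + L x                    ≡⟨ ≡.cong (λ m → m + L x) (≡.trans (≡.cong Vec.head (Y-linear .homogeneous a e)) (head-⊙ a (Y e))) ⟩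
        a * c + L x                                   ∎
        where
        unit : ∀ a → a ≡ a * + 1 + + 0
        unit = ℤ-solve-∀

      -- On the hyperplane where Y₀ = ±ρ x₀ the first square cancels on both sides; the sign
      -- is chosen so that the hyperplane is a graph over the remaining coordinates.
      record Hyperplane : Set where
        field
          α β     : ℤ
          α²≡1    : α * α ≡ + 1
          β≢0     : β ≢ + 0
          αc+β≡±ρ : (α * c + β) * (α * c + β) ≡ ρ * ρ

      hyperplane : Hyperplane
      hyperplane with c ℤ.≟ ρ
      ... | no c≢ρ = record { α = + 1 ; β = ρ - c ; α²≡1 = ≡.refl
          ; β≢0 = λ eq → c≢ρ (≡.sym (ℤ.i-j≡0⇒i≡j ρ c eq)) ; αc+β≡±ρ = identity c ρ }
        where
        identity : ∀ c ρ → (+ 1 * c + (ρ - c)) * (+ 1 * c + (ρ - c)) ≡ ρ * ρ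
        identity = ℤ-solve-∀
      -- Here the previous β = ρ - c would vanish. With α = -1 the condition αc + β = ρ gives β = c
      -- + ρ = 2ρ instead.
      ... | yes c≡ρ = record { α = - + 1 ; β = c + ρ ; α²≡1 = ≡.refl
          ; β≢0 = λ eq → *-≢0 {+ 2} (λ ()) ρ≢0 (≡.trans (double ρ) (≡.trans (≡.cong (λ m → m + ρ) (≡.sym c≡ρ)) eq))
          ; αc+β≡±ρ = identity c ρ }
        where
        double : ∀ ρ → + 2 * ρ ≡ ρ + ρ
        double = ℤ-solve-∀
        identity : ∀ c ρ → (- + 1 * c + (c + ρ)) * (- + 1 * c + (c + ρ)) ≡ ρ * ρ
        identity = ℤ-solve-∀

    -- Over ℚ the hyperplane is x₀ = (α/β) L(x); `ι` parametrises it with the denominator cleared.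
    -- On it the head of the image squares to ρ² L(x)², which is also what x₀ contributes on the
    -- right, since α² = 1. Removing both leaves the form with one square less.
    cancel-one : Represents r t s
    cancel-one = record
      { Y = Vec.tail ∘ Y ∘ ι ; linear = ∘-linear tail-linear (∘-linear Y-linear ι-linear)
      ; ρ = ρ * β ; ρ≢0 = *-≢0 ρ≢0 β≢0 ; scales = scales′ }
      where
      open Hyperplane hyperplane
      ι : Vec ℤ (t ℕ.+ s) → Vec ℤ (suc t ℕ.+ s)
      ι x = α * L x ∷ β ⊙ x
      ι-linear : Linear ι
      ι-linear .additive x y = ≡.cong₂ _∷_ (≡.trans (≡.cong (α *_) (L-⊕ x y)) (ℤ.*-distribˡ-+ α (L x) (L y))) (⊙-⊕ β x y)
      ι-linear .homogeneous k x = ≡.cong₂ _∷_ (≡.trans (≡.cong (α *_) (L-⊙ k x)) (swap α k (L x))) (⊙-⊙ β k x)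
        where
        swap : ∀ α k l → α * (k * l) ≡ k * (α * l)
        swap = ℤ-solve-∀
      norm-head-tail : ∀ {n} (x : Vec ℤ (suc n)) → norm x ≡ Vec.head x * Vec.head x + norm (Vec.tail x)
      norm-head-tail (x ∷ xs) = ≡.refl
      head² : ∀ x → Vec.head (Y (ι x)) * Vec.head (Y (ι x)) ≡ ρ * ρ * (L x * L x)
      head² x = begin
        h * h                                              ≡⟨ ≡.cong (λ m → m * m) (≡.trans (head-Y (α * L x) (β ⊙ x)) (≡.cong (λ m → α * L x * c + m) (L-⊙ β x))) ⟩
        (α * L x * c + β * L x) * (α * L x * c + β * L x)  ≡⟨ factor α β c (L x) ⟩
        (α * c + β) * (α * c + β) * (L x * L x)            ≡⟨ ≡.cong (_* (L x * L x)) αc+β≡±ρ ⟩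
        ρ * ρ * (L x * L x)                                ∎
        where
        h = Vec.head (Y (ι x))
        factor : ∀ α β c l → (α * l * c + β * l) * (α * l * c + β * l) ≡ (α * c + β) * (α * c + β) * (l * l)
        factor = ℤ-solve-∀
      scales′ : ∀ x → norm (Vec.tail (Y (ι x))) ≡ ρ * β * (ρ * β) * mixed r t x
      scales′ x = ∙-cancelˡ (ρ * ρ * (L x * L x)) _ _ (begin
        ρ * ρ * (L x * L x) + norm (Vec.tail (Y (ι x)))                    ≡⟨ ≡.cong (λ m → m + norm (Vec.tail (Y (ι x)))) (head² x) ⟨
        Vec.head (Y (ι x)) * Vec.head (Y (ι x)) + norm (Vec.tail (Y (ι x)))  ≡⟨ norm-head-tail (Y (ι x)) ⟨
        norm (Y (ι x))                                                     ≡⟨ Y-scales (ι x) ⟩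
        ρ * ρ * (α * L x * (α * L x) + mixed r t (β ⊙ x))                  ≡⟨ ≡.cong (λ m → ρ * ρ * (α * L x * (α * L x) + m)) (mixed-⊙ r t β x) ⟩
        ρ * ρ * (α * L x * (α * L x) + β * β * mixed r t x)                ≡⟨ expand ρ α β (L x) (mixed r t x) ⟩
        ρ * ρ * (α * α * (L x * L x)) + ρ * β * (ρ * β) * mixed r t x      ≡⟨ ≡.cong (λ m → ρ * ρ * (m * (L x * L x)) + ρ * β * (ρ * β) * mixed r t x) α²≡1 ⟩
        ρ * ρ * (+ 1 * (L x * L x)) + ρ * β * (ρ * β) * mixed r t x        ≡⟨ ≡.cong (λ m → ρ * ρ * m + ρ * β * (ρ * β) * mixed r t x) (ℤ.*-identityˡ (L x * L x)) ⟩
        ρ * ρ * (L x * L x) + ρ * β * (ρ * β) * mixed r t x                ∎)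
        where
        expand : ∀ ρ α β l m → ρ * ρ * (α * l * (α * l) + β * β * m) ≡ ρ * ρ * (α * α * (l * l)) + ρ * β * (ρ * β) * m
        expand = ℤ-solve-∀

  witt : ∀ {r} t {s} → Represents r t s → Represents r 0 s
  witt zero    Rep = Rep
  witt (suc t) Rep = witt t (cancel-one Rep)

  -- With `M` equal to `T .P` on the first t coordinates, the factor r gained through `S` cancels
  -- the 1/r of `T` there and survives on the other s. This represents the mixed form by t + s
  -- squares, and Witt cancellation removes the t common ones.
  similar-cancel : ∀ {r} t {s} → r ≢ + 0 → Similar (t ℕ.+ s) r → Similar t r → Similar s r
  similar-cancel {r} t {s} r≢0 S T = record
    { P = Y ; linear = linear′ ; σ = ρ * r ; σ≢0 = *-≢0 ρ≢0 r≢0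
    ; scales = λ x → ≡.trans (≡.cong (r *_) (scales′ x)) (square r ρ (norm x)) }
    where
    square : ∀ r ρ m → r * (ρ * ρ * (r * m)) ≡ ρ * r * (ρ * r) * m
    square = ℤ-solve-∀
    ς = S .σ
    τ = T .σ
    M : Vec ℤ (t ℕ.+ s) → Vec ℤ (t ℕ.+ s)
    M x = T .P (Vec.take t x) Vec.++ τ ⊙ Vec.drop t x
    norm-rS : ∀ x → norm (r ⊙ S .P (M x)) ≡ ς * τ * (ς * τ) * mixed r t x
    norm-rS x = begin
      norm (r ⊙ S .P (M x))                                  ≡⟨ norm-⊙ r (S .P (M x)) ⟩
      r * r * norm (S .P (M x))                              ≡⟨ ℤ.*-assoc r r _ ⟩
      r * (r * norm (S .P (M x)))                            ≡⟨ ≡.cong (r *_) (S .scales (M x)) ⟩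
      r * (ς * ς * norm (M x))                               ≡⟨ ≡.cong (λ m → r * (ς * ς * m)) (≡.trans (norm-++ (T .P a) (τ ⊙ b)) (≡.cong (λ m → norm (T .P a) + m) (norm-⊙ τ b))) ⟩
      r * (ς * ς * (norm (T .P a) + τ * τ * norm b))         ≡⟨ expand r ς τ (norm (T .P a)) (norm b) ⟩
      ς * ς * (r * norm (T .P a) + τ * τ * (r * norm b))     ≡⟨ ≡.cong (λ m → ς * ς * (m + τ * τ * (r * norm b))) (T .scales a) ⟩
      ς * ς * (τ * τ * norm a + τ * τ * (r * norm b))        ≡⟨ collect ς τ (norm a) (r * norm b) ⟩
      ς * τ * (ς * τ) * (norm a + r * norm b)                ≡⟨ ≡.cong (ς * τ * (ς * τ) *_) (mixed-take-drop r t x) ⟨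
      ς * τ * (ς * τ) * mixed r t x                          ∎
      where
      a = Vec.take t x
      b = Vec.drop t x
      expand : ∀ r ς τ u v → r * (ς * ς * (u + τ * τ * v)) ≡ ς * ς * (r * u + τ * τ * (r * v))
      expand = ℤ-solve-∀
      collect : ∀ ς τ u v → ς * ς * (τ * τ * u + τ * τ * v) ≡ ς * τ * (ς * τ) * (u + v)
      collect = ℤ-solve-∀
    represents : Represents r t s
    represents = record
      { Y = λ x → r ⊙ S .P (M x)
      ; linear = ⊙-linear r (∘-linear (S .linear)
          (++-linear (∘-linear (T .linear) (take-linear t)) (⊙-linear τ (drop-linear t))))
      ; ρ = ς * τ ; ρ≢0 = *-≢0 (S .σ≢0) (T .σ≢0) ; scales = norm-rS }
    open Represents (witt t represents) renaming (linear to linear′; scales to scales′)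

  norm≡sum : ∀ {n} (x : Vec ℤ n) → norm x ≡ Σℤ.sum (λ i → lookup x i * lookup x i)
  norm≡sum []       = ≡.refl
  norm≡sum (x ∷ xs) = ≡.cong (λ m → x * x + m) (norm≡sum xs)

  sum-single : ∀ {n} (f : Fin n → ℤ) i → (∀ j → i ≢ j → f j ≡ + 0) → Σℤ.sum f ≡ f i
  sum-single {suc n} f zero    off = ≡.trans (≡.cong (λ m → f zero + m) (≡.trans (Σℤ.sum-cong-≋ (λ j → off (suc j) λ ())) (Σℤ.sum-replicate-zero n))) (ℤ.+-identityʳ _)
  sum-single {suc n} f (suc i) off = ≡.trans (≡.cong₂ _+_ (off zero λ ()) (sum-single (f ∘ suc) i (λ j i≢j → off (suc j) (i≢j ∘ suc-injective)))) (ℤ.+-identityˡ _)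

  -- The map is x ↦ xN, for which |xN|² = x N Nᵀ xᵀ = r |x|². Multiplying by r yields the scale σ =
  -- r.
  gram⇒similar : ∀ {n} {r} → r ≢ + 0 → (N : Fin n → Fin n → ℤ) →
    (∀ p → Σℤ.sum (λ q → N p q * N p q) ≡ r) →
    (∀ p p′ → p ≢ p′ → Σℤ.sum (λ q → N p q * N p′ q) ≡ + 0) → Similar n r
  gram⇒similar {n} {r} r≢0 N diagonal off-diagonal = record
    { P = f ; linear = f-linear ; σ = r ; σ≢0 = r≢0
    ; scales = λ x → ≡.trans (≡.cong (r *_) (norm-f x)) (≡.sym (ℤ.*-assoc r r (norm x))) }
    where
    form : Vec ℤ n → Fin n → ℤ
    form x q = Σℤ.sum λ p → lookup x p * N p q

    f : Vec ℤ n → Vec ℤ n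
    f x = tabulate (form x)

    tabulate-zipWith : ∀ {n} (g h : Fin n → ℤ) → tabulate (λ i → g i + h i) ≡ tabulate g ⊕ tabulate h
    tabulate-zipWith {zero}  g h = ≡.refl
    tabulate-zipWith {suc n} g h = ≡.cong (g zero + h zero ∷_) (tabulate-zipWith (g ∘ suc) (h ∘ suc))

    f-linear : Linear f
    f-linear .additive x y = ≡.trans (Vec.tabulate-cong λ q →
        ≡.trans (Σℤ.sum-cong-≋ λ p → ≡.trans (≡.cong (_* N p q) (Vec.lookup-zipWith _+_ p x y)) (ℤ.*-distribʳ-+ (N p q) (lookup x p) (lookup y p)))
                (Σℤ.∑-distrib-+ (λ p → lookup x p * N p q) (λ p → lookup y p * N p q)))
      (tabulate-zipWith (form x) (form y))
    f-linear .homogeneous k x = ≡.trans (Vec.tabulate-cong λ q →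
        ≡.trans (Σℤ.sum-cong-≋ λ p → ≡.trans (≡.cong (_* N p q) (Vec.lookup-map p (k *_) x)) (ℤ.*-assoc k (lookup x p) (N p q)))
                (≡.sym (Σℤ.*-distribˡ-sum k (λ p → lookup x p * N p q))))
      (Vec.tabulate-∘ (k *_) (form x))

    norm-f : ∀ x → norm (f x) ≡ r * norm x
    norm-f x = begin
      norm (f x)
        ≡⟨ norm≡sum (f x) ⟩
      Σℤ.sum (λ q → lookup (f x) q * lookup (f x) q)
        ≡⟨ Σℤ.sum-cong-≋ (λ q → ≡.trans (≡.cong (λ m → m * m) (Vec.lookup∘tabulate (form x) q)) (Σℤ.*-distribʳ-sum (form x q) (λ p → lookup x p * N p q))) ⟩
      Σℤ.sum (λ q → Σℤ.sum λ p → lookup x p * N p q * form x q)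
        ≡⟨ Σℤ.∑-comm (λ q p → lookup x p * N p q * form x q) ⟩
      Σℤ.sum (λ p → Σℤ.sum λ q → lookup x p * N p q * form x q)
        ≡⟨ Σℤ.sum-cong-≋ row ⟩
      Σℤ.sum (λ p → r * (lookup x p * lookup x p))
        ≡⟨ Σℤ.*-distribˡ-sum r (λ p → lookup x p * lookup x p) ⟨
      r * Σℤ.sum (λ p → lookup x p * lookup x p)
        ≡⟨ ≡.cong (r *_) (norm≡sum x) ⟨
      r * norm x ∎
      where
      pull : ∀ x n y m → x * n * (y * m) ≡ x * y * (n * m)
      pull = ℤ-solve-∀
      row : ∀ p → Σℤ.sum (λ q → lookup x p * N p q * form x q) ≡ r * (lookup x p * lookup x p)
      row p = begin
        Σℤ.sum (λ q → lookup x p * N p q * form x q)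
          ≡⟨ Σℤ.sum-cong-≋ (λ q → Σℤ.*-distribˡ-sum (lookup x p * N p q) (λ p′ → lookup x p′ * N p′ q)) ⟩
        Σℤ.sum (λ q → Σℤ.sum λ p′ → lookup x p * N p q * (lookup x p′ * N p′ q))
          ≡⟨ Σℤ.∑-comm (λ q p′ → lookup x p * N p q * (lookup x p′ * N p′ q)) ⟩
        Σℤ.sum (λ p′ → Σℤ.sum λ q → lookup x p * N p q * (lookup x p′ * N p′ q))
          ≡⟨ Σℤ.sum-cong-≋ (λ p′ → ≡.trans (Σℤ.sum-cong-≋ λ q → pull (lookup x p) (N p q) (lookup x p′) (N p′ q)) (≡.sym (Σℤ.*-distribˡ-sum (lookup x p * lookup x p′) (λ q → N p q * N p′ q)))) ⟩
        Σℤ.sum (λ p′ → lookup x p * lookup x p′ * Σℤ.sum λ q → N p q * N p′ q)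
          ≡⟨ sum-single _ p (λ p′ p≢p′ → ≡.trans (≡.cong (lookup x p * lookup x p′ *_) (off-diagonal p p′ p≢p′)) (ℤ.*-zeroʳ (lookup x p * lookup x p′))) ⟩
        lookup x p * lookup x p * Σℤ.sum (λ q → N p q * N p q)
          ≡⟨ ≡.cong (lookup x p * lookup x p *_) (diagonal p) ⟩
        lookup x p * lookup x p * r
          ≡⟨ ℤ.*-comm _ r ⟩
        r * (lookup x p * lookup x p) ∎

-- Davenport–Cassels descent: a sum of two rational squares that is an integer is a sum of two
-- integer squares. The second coordinate stays zero, which covers single squares too.
module Descent where
  open import Data.Integer using (ℤ; +_; -[1+_]; _+_; _*_; -_; _-_; ∣_∣)

  square-abs : ∀ x → x * x ≡ + (∣ x ∣ ℕ.* ∣ x ∣)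
  square-abs (+ n)    = ≡.sym (ℤ.pos-* n n)
  square-abs -[1+ n ] = ≡.refl

  -- The remainder has absolute value at most z/2; a remainder merely below z would not guarantee
  -- that the descent shrinks. The last clause keeps a zero coordinate zero.
  nearest : ∀ z .{{_ : ℕ.NonZero z}} x → ∃₂ λ X u → x ≡ + z * X + u × 2 ℕ.* ∣ u ∣ ℕ.≤ z × (x ≡ + 0 → X ≡ + 0)
  nearest z x with x ℤ.≟ + 0
  ... | yes ≡.refl = + 0 , + 0 , ≡.sym (≡.trans (ℤ.+-identityʳ _) (ℤ.*-zeroʳ (+ z))) , ℕ.z≤n , λ _ → ≡.refl
  ... | no x≢0 with 2 ℕ.* (x %ℕ z) ℕ.≤? z
  ...   | yes small = x /ℕ z , + (x %ℕ z) , ≡.trans (a≡a%ℕn+[a/ℕn]*n x z) (rearrange (+ (x %ℕ z)) (x /ℕ z) (+ z)) , small , λ x≡0 → contradiction x≡0 x≢0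
    where
    rearrange : ∀ u q z → u + q * z ≡ z * q + u
    rearrange = ℤ-solve-∀
  ...   | no large = x /ℕ z + + 1 , ρ ℤ.⊖ z
        , ≡.trans (a≡a%ℕn+[a/ℕn]*n x z) (≡.trans (rearrange (+ ρ) (x /ℕ z) (+ z)) (≡.cong (λ u → + z * (x /ℕ z + + 1) + u) (ℤ.m-n≡m⊖n ρ z)))
        , ≡.subst (λ u → 2 ℕ.* u ℕ.≤ z) (≡.sym (ℤ.∣⊖∣-< (n%ℕd<d x z))) bound , λ x≡0 → contradiction x≡0 x≢0
    where
    ρ = x %ℕ z
    rearrange : ∀ u q z → u + q * z ≡ z * (q + + 1) + (u - z)
    rearrange = ℤ-solve-∀
    bound : 2 ℕ.* (z ℕ.∸ ρ) ℕ.≤ z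
    bound = ≡.subst (ℕ._≤ z) (≡.sym (ℕ.*-distribˡ-∸ 2 z ρ)) (ℕ.m≤n+o⇒m∸n≤o (2 ℕ.* z) (2 ℕ.* ρ)
      (≡.subst (ℕ._≤ 2 ℕ.* ρ ℕ.+ z) (≡.cong (z ℕ.+_) (≡.sym (ℕ.+-identityʳ z))) (ℕ.+-monoˡ-≤ z (ℕ.<⇒≤ (ℕ.≰⇒> large)))))

  SumOfSquares : ℤ → ℤ → Set
  SumOfSquares r y = ∃₂ λ X Y → X * X + Y * Y ≡ r × (y ≡ + 0 → Y ≡ + 0)

  -- From u² + v² ≤ z²/2 the new denominator is at most z/2.
  shrink : ∀ {U V Z W} → 2 ℕ.* U ℕ.≤ Z → 2 ℕ.* V ℕ.≤ Z → 1 ℕ.≤ Z → U ℕ.* U ℕ.+ V ℕ.* V ≡ Z ℕ.* suc W → suc W ℕ.< Z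
  shrink {U} {V} {Z} {W} 2U≤Z 2V≤Z 1≤Z eq = ℕ.<-≤-trans (ℕ.m<m+n (suc W) (ℕ.s≤s ℕ.z≤n)) (ℕ.*-cancelˡ-≤ (2 ℕ.* Z) {{ℕ.≢-nonZero λ { 2Z≡0 → ℕ.<⇒≢ 1≤Z (≡.sym (ℕ.m+n≡0⇒m≡0 Z 2Z≡0)) }}} (begin
    2 ℕ.* Z ℕ.* (suc W ℕ.+ suc W)                      ≡⟨ regroup Z (suc W) ⟩
    4 ℕ.* (Z ℕ.* suc W)                                ≡⟨ ≡.cong (4 ℕ.*_) eq ⟨
    4 ℕ.* (U ℕ.* U ℕ.+ V ℕ.* V)                        ≡⟨ expand U V ⟩
    2 ℕ.* U ℕ.* (2 ℕ.* U) ℕ.+ 2 ℕ.* V ℕ.* (2 ℕ.* V)    ≤⟨ ℕ.+-mono-≤ (ℕ.*-mono-≤ 2U≤Z 2U≤Z) (ℕ.*-mono-≤ 2V≤Z 2V≤Z) ⟩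
    Z ℕ.* Z ℕ.+ Z ℕ.* Z                                ≡⟨ collect Z ⟩
    2 ℕ.* Z ℕ.* Z                                      ∎))
    where
    open ℕ.≤-Reasoning
    regroup : ∀ Z W → 2 ℕ.* Z ℕ.* (W ℕ.+ W) ≡ 4 ℕ.* (Z ℕ.* W)
    regroup = solve-∀
    expand : ∀ U V → 4 ℕ.* (U ℕ.* U ℕ.+ V ℕ.* V) ≡ 2 ℕ.* U ℕ.* (2 ℕ.* U) ℕ.+ 2 ℕ.* V ℕ.* (2 ℕ.* V)
    expand = solve-∀
    collect : ∀ Z → Z ℕ.* Z ℕ.+ Z ℕ.* Z ≡ 2 ℕ.* Z ℕ.* Z
    collect = solve-∀

  -- The line through (x/z, y/z) and the integer point (X, Y) meets the circle again at (x′/z′, y′/z′).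
  record SecondPoint (r z x y X Y u v : ℤ) : Set where
    field
      x′ y′ z′  : ℤ
      solution  : x′ * x′ + y′ * y′ ≡ r * (z′ * z′)
      remainder : u * u + v * v ≡ z * z′
      y′-zero   : y ≡ + 0 → Y ≡ + 0 → y′ ≡ + 0

  second-point : ∀ r z x y X Y u v → x ≡ z * X + u → y ≡ z * Y + v → x * x + y * y ≡ r * (z * z) →
                 SecondPoint r z x y X Y u v
  second-point r z x y X Y u v x≡ y≡ eq = record
    { x′ = a * x + b * X ; y′ = a * y + b * Y ; z′ = a * z + b
    ; solution = solution ; remainder = remainder ; y′-zero = λ { ≡.refl ≡.refl → vanish a b } }
    where
    open ≡.≡-Reasoning
    -- Let Q = (X, Y) and c = xX + yY. The point (a(x, y) + bQ) / (az + b) lies on the circle as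
    -- soon as b(|Q|² - r) = 2a(rz - c); this is the evident solution.
    a b : ℤ
    a = X * X + Y * Y - r
    b = + 2 * (r * z - (x * X + y * Y))

    vanish : ∀ a b → a * + 0 + b * + 0 ≡ + 0
    vanish = ℤ-solve-∀

    expand-remainder : ∀ u v z X Y → u * u + v * v ≡
      (z * X + u) * (z * X + u) + (z * Y + v) * (z * Y + v)
      - + 2 * z * ((z * X + u) * X + (z * Y + v) * Y) + z * z * (X * X + Y * Y)
    expand-remainder = ℤ-solve-∀

    factor-remainder : ∀ r z X Y c → r * (z * z) - + 2 * z * c + z * z * (X * X + Y * Y) ≡
      z * ((X * X + Y * Y - r) * z + + 2 * (r * z - c))
    factor-remainder = ℤ-solve-∀

    remainder : u * u + v * v ≡ z * (a * z + b)
    remainder = begin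
      u * u + v * v
        ≡⟨ expand-remainder u v z X Y ⟩
      (z * X + u) * (z * X + u) + (z * Y + v) * (z * Y + v)
        - + 2 * z * ((z * X + u) * X + (z * Y + v) * Y) + z * z * (X * X + Y * Y)
        ≡⟨ ≡.cong₂ (λ x y → x * x + y * y - + 2 * z * (x * X + y * Y) + z * z * (X * X + Y * Y)) x≡ y≡ ⟨
      x * x + y * y - + 2 * z * (x * X + y * Y) + z * z * (X * X + Y * Y)
        ≡⟨ ≡.cong (λ m → m - + 2 * z * (x * X + y * Y) + z * z * (X * X + Y * Y)) eq ⟩
      r * (z * z) - + 2 * z * (x * X + y * Y) + z * z * (X * X + Y * Y)
        ≡⟨ factor-remainder r z X Y (x * X + y * Y) ⟩
      z * (a * z + b) ∎

    expand-solution : ∀ a b x y X Y → (a * x + b * X) * (a * x + b * X) + (a * y + b * Y) * (a * y + b * Y) ≡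
      a * a * (x * x + y * y) + + 2 * a * b * (x * X + y * Y) + b * b * (X * X + Y * Y)
    expand-solution = ℤ-solve-∀

    factor-solution : ∀ r z X Y c →
      let a = X * X + Y * Y - r
          b = + 2 * (r * z - c) in
      a * a * (r * (z * z)) + + 2 * a * b * c + b * b * (X * X + Y * Y) ≡ r * ((a * z + b) * (a * z + b))
    factor-solution = ℤ-solve-∀

    solution : (a * x + b * X) * (a * x + b * X) + (a * y + b * Y) * (a * y + b * Y) ≡ r * ((a * z + b) * (a * z + b))
    solution = begin
      (a * x + b * X) * (a * x + b * X) + (a * y + b * Y) * (a * y + b * Y)
        ≡⟨ expand-solution a b x y X Y ⟩
      a * a * (x * x + y * y) + + 2 * a * b * (x * X + y * Y) + b * b * (X * X + Y * Y)
        ≡⟨ ≡.cong (λ m → a * a * m + + 2 * a * b * (x * X + y * Y) + b * b * (X * X + Y * Y)) eq ⟩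
      a * a * (r * (z * z)) + + 2 * a * b * (x * X + y * Y) + b * b * (X * X + Y * Y)
        ≡⟨ factor-solution r z X Y (x * X + y * Y) ⟩
      r * ((a * z + b) * (a * z + b)) ∎

  abs-remainder : ∀ {u v z w} → u * u + v * v ≡ + z * + w → ∣ u ∣ ℕ.* ∣ u ∣ ℕ.+ ∣ v ∣ ℕ.* ∣ v ∣ ≡ z ℕ.* w
  abs-remainder {u} {v} {z} {w} eq = ℤ.+-injective (begin
    + (∣ u ∣ ℕ.* ∣ u ∣ ℕ.+ ∣ v ∣ ℕ.* ∣ v ∣)    ≡⟨ ≡.cong₂ _+_ (square-abs u) (square-abs v) ⟨
    u * u + v * v                              ≡⟨ eq ⟩
    + z * + w                                  ≡⟨ ℤ.pos-* z w ⟨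
    + (z ℕ.* w)                                ∎)
    where open ≡.≡-Reasoning

  abs²≡0 : ∀ {u} → ∣ u ∣ ℕ.* ∣ u ∣ ≡ 0 → u ≡ + 0
  abs²≡0 {u} p = ℤ.∣i∣≡0⇒i≡0 ([ id , id ]′ (ℕ.m*n≡0⇒m≡0∨n≡0 ∣ u ∣ p))

  integral : ∀ {r z x y X Y u v} → z ≢ + 0 → x ≡ z * X + u → y ≡ z * Y + v → u ≡ + 0 → v ≡ + 0 →
             x * x + y * y ≡ r * (z * z) → X * X + Y * Y ≡ r
  integral {r} {z} {x} {y} {X} {Y} z≢0 ≡.refl ≡.refl ≡.refl ≡.refl eq =
    ℤ.*-cancelʳ-≡ (X * X + Y * Y) r (z * z) {{ℤ.≢-nonZero (Similarity.*-≢0 z≢0 z≢0)}} (≡.trans (expand X Y z) eq)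
    where
    expand : ∀ X Y z → (X * X + Y * Y) * (z * z) ≡ (z * X + + 0) * (z * X + + 0) + (z * Y + + 0) * (z * Y + + 0)
    expand = ℤ-solve-∀

  squares≢negative : ∀ {u v k w} → u * u + v * v ≢ + suc k * -[1+ w ]
  squares≢negative {u} {v} eq = contradiction (≡.trans (≡.sym (≡.cong₂ _+_ (square-abs u) (square-abs v))) eq) λ ()

  -- Everything depends on z z′ = u² + v². If z′ = 0, both remainders vanish and the point was
  -- integral; if z′ > 0, it is a smaller denominator; a negative z′ is impossible.
  descend : ∀ {r} z → Acc ℕ._<_ z → .{{_ : ℕ.NonZero z}} → ∀ x y →
            x * x + y * y ≡ r * (+ z * + z) → SumOfSquares r y
  descend {r} (suc k) (acc rs) x y eq with nearest (suc k) x | nearest (suc k) y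
  ... | X , u , x≡ , 2u≤z , _ | Y , v , y≡ , 2v≤z , Y≡0 with second-point r (+ suc k) x y X Y u v x≡ y≡ eq
  ...   | record { z′ = + zero ; remainder = remainder } =
          X , Y , integral {r} {+ suc k} {x} {y} {X} {Y} {u} {v} (λ ()) x≡ y≡
            (abs²≡0 {u} (ℕ.m+n≡0⇒m≡0 _ squares≡0))
            (abs²≡0 {v} (ℕ.m+n≡0⇒n≡0 (∣ u ∣ ℕ.* ∣ u ∣) squares≡0)) eq
          , Y≡0
    where
    squares≡0 : ∣ u ∣ ℕ.* ∣ u ∣ ℕ.+ ∣ v ∣ ℕ.* ∣ v ∣ ≡ 0
    squares≡0 = ≡.trans (abs-remainder {u} {v} {suc k} {0} remainder) (ℕ.*-zeroʳ (suc k))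
  ...   | record { x′ = x′ ; y′ = y′ ; z′ = + suc w ; solution = solution ; remainder = remainder ; y′-zero = y′-zero }
          with descend (suc w) (rs (shrink {∣ u ∣} {∣ v ∣} {suc k} {w} 2u≤z 2v≤z (ℕ.s≤s ℕ.z≤n) (abs-remainder {u} {v} {suc k} {suc w} remainder))) x′ y′ solution
  ...     | X₁ , Y₁ , sum , Y₁≡0 = X₁ , Y₁ , sum , λ y≡0 → Y₁≡0 (y′-zero y≡0 (Y≡0 y≡0))
  descend {r} (suc k) (acc rs) x y eq | X , u , x≡ , 2u≤z , _ | Y , v , y≡ , 2v≤z , Y≡0
        | record { z′ = -[1+ w ] ; remainder = remainder } = contradiction remainder (squares≢negative {u} {v} {k} {w})

  sum-of-squares : ∀ {r x y z} → z ≢ + 0 → x * x + y * y ≡ r * (z * z) → SumOfSquares r y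
  sum-of-squares {r} {x} {y} {z} z≢0 eq = descend ∣ z ∣ (<-wellFounded ∣ z ∣) {{ℕ.≢-nonZero (z≢0 ∘ ℤ.∣i∣≡0⇒i≡0)}} x y
    (≡.trans eq (≡.cong (r *_) (≡.trans (square-abs z) (ℤ.pos-* ∣ z ∣ ∣ z ∣))))

  -- The image y of the unit vector satisfies r y² = σ², so (ry)² + 0² = r σ². The descent preserves
  -- the zero and leaves a single square.
  similar-1⇒square : ∀ {r} → Similarity.Similar 1 (+ r) → ∃ λ a → r ≡ a ℕ.* a
  similar-1⇒square {r} S with P (+ 1 ∷ []) | scales (+ 1 ∷ [])
    where open Similarity.Similar S
  ... | y ∷ [] | eq = from (sum-of-squares {+ r} {+ r * y} {+ 0} {σ} σ≢0 (≡.trans (multiply (+ r) y) (≡.cong (+ r *_) (≡.trans eq (unit (σ * σ))))))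
    where
    open Similarity.Similar S
    multiply : ∀ r y → r * y * (r * y) + + 0 * + 0 ≡ r * (r * (y * y + + 0))
    multiply = ℤ-solve-∀
    unit : ∀ s → s * (+ 1 * + 1 + + 0) ≡ s
    unit = ℤ-solve-∀
    from : SumOfSquares (+ r) (+ 0) → ∃ λ a → r ≡ a ℕ.* a
    from (X , Y , X²+Y²≡r , Y≡0) = ∣ X ∣ , ℤ.+-injective (≡.sym (≡.trans (≡.sym (square-abs X))
      (≡.trans (≡.sym (ℤ.+-identityʳ _)) (≡.trans (≡.cong (λ m → X * X + m * m) (≡.sym (Y≡0 ≡.refl))) X²+Y²≡r))))

  similar-2⇒two-squares : ∀ {r} → Similarity.Similar 2 r → ∃₂ λ a b → r ≡ a * a + b * b
  similar-2⇒two-squares {r} S with P (+ 1 ∷ + 0 ∷ []) | scales (+ 1 ∷ + 0 ∷ [])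
    where open Similarity.Similar S
  ... | x ∷ y ∷ [] | eq = from (sum-of-squares {r} {r * x} {r * y} {σ} σ≢0 (≡.trans (multiply r x y) (≡.cong (r *_) (≡.trans eq (unit (σ * σ))))))
    where
    open Similarity.Similar S
    multiply : ∀ r x y → r * x * (r * x) + r * y * (r * y) ≡ r * (r * (x * x + (y * y + + 0)))
    multiply = ℤ-solve-∀
    unit : ∀ s → s * (+ 1 * + 1 + (+ 0 * + 0 + + 0)) ≡ s
    unit = ℤ-solve-∀
    from : SumOfSquares r (r * y) → ∃₂ λ a b → r ≡ a * a + b * b
    from (X , Y , X²+Y²≡r , _) = X , Y , ≡.sym X²+Y²≡r

-- Arithmetic restrictions on n and r, and the theorem

open import Data.Nat using (_+_; _*_; _≤_; _∸_; _%_)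

open Similarity
open Descent

-- By Bézout d is the difference of a multiple of m and a multiple of n, or the reverse. Multiples
-- inherit the similarity as orthogonal sums, and `similar-cancel` performs the subtraction.
similar-gcd : ∀ {m n d r} → r ≢ + 0 → GCD m n d → Similar m r → Similar n r → Similar d r
similar-gcd {m} {n} {d} {r} r≢0 gcd S T with Bézout.identity gcd
... | Bézout.+- x y eq = similar-cancel (y * n) r≢0
      (≡.subst (λ k → Similar k r) (≡.trans (≡.sym eq) (ℕ.+-comm d (y * n))) (similar-* x S)) (similar-* y T)
... | Bézout.-+ x y eq = similar-cancel (x * m) r≢0
      (≡.subst (λ k → Similar k r) (≡.trans (≡.sym eq) (ℕ.+-comm d (x * m))) (similar-* y T)) (similar-* x S)

odd-coprime-2 : ∀ {d} → ¬ (2 ∣ d) → Coprime d 2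
odd-coprime-2 ∤d {zero}                (_   , ∣2) = contradiction (0∣⇒≡0 ∣2) λ ()
odd-coprime-2 ∤d {suc zero}            _          = ≡.refl
odd-coprime-2 ∤d {suc (suc zero)}      (∣d  , _)  = contradiction ∣d ∤d
odd-coprime-2 ∤d {suc (suc (suc k))}   (_   , ∣2) = contradiction (∣⇒≤ ∣2) λ { (ℕ.s≤s (ℕ.s≤s ())) }

odd-∣2^k⇒≡1 : ∀ k {d} → ¬ (2 ∣ d) → d ∣ 2 ℕ.^ k → d ≡ 1
odd-∣2^k⇒≡1 zero    ∤d ∣1    = ∣1⇒≡1 ∣1
odd-∣2^k⇒≡1 (suc k) ∤d ∣2^k+1 = odd-∣2^k⇒≡1 k ∤d (coprime-divisor (odd-coprime-2 ∤d) ∣2^k+1)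

odd-gcd-2^k : ∀ k {j} → ¬ (2 ∣ j) → gcd j (2 ℕ.^ k) ≡ 1
odd-gcd-2^k k {j} ∤j = odd-∣2^k⇒≡1 k (λ 2∣g → ∤j (∣-trans 2∣g (gcd[m,n]∣m j (2 ℕ.^ k)))) (gcd[m,n]∣n j (2 ℕ.^ k))

∤2 : ∀ {n} → n % 2 ≡ 1 → ¬ (2 ∣ n)
∤2 {n} n%2≡1 2∣n with ≡.trans (≡.sym n%2≡1) (n∣m⇒m%n≡0 n 2 2∣n)
... | ()

-- Any power of two not below r would serve; 2^r is one by `n<2^n`.
similar-2^r : ∀ {r} → r ≢ 0 → Similar (2 ℕ.^ r) (+ r)
similar-2^r {r} r≢0 = similar-2^ r (ℕ.n≢0⇒n>0 r≢0) (ℕ.<⇒≤ (n<2^n r))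

+≢0 : ∀ {r} → r ≢ 0 → + r ≢ + 0
+≢0 r≢0 = r≢0 ∘ ℤ.+-injective

odd⇒square : ∀ {n r} → r ≢ 0 → Similar n (+ r) → n % 2 ≡ 1 → ∃ λ a → r ≡ a * a
odd⇒square {n} {r} r≢0 S n%2≡1 = similar-1⇒square (similar-gcd (+≢0 r≢0)
  (≡.subst (GCD n (2 ℕ.^ r)) (odd-gcd-2^k r {n} (∤2 n%2≡1)) (gcd-GCD n (2 ℕ.^ r))) S (similar-2^r r≢0))

2mod4⇒two-squares : ∀ {n r} → r ≢ 0 → Similar n (+ r) → n % 4 ≡ 2 → ∃₂ λ (a b : ℤ) → + r ≡ (a ℤ.* a) ℤ.+ (b ℤ.* b)
2mod4⇒two-squares {n} {r} r≢0 S n%4≡2 = similar-2⇒two-squares (similar-gcd (+≢0 r≢0)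
    (≡.subst (GCD n (2 ℕ.^ suc r)) gcd≡2 (gcd-GCD n (2 ℕ.^ suc r))) S (similar-+ T (≡.subst (λ m → Similar m (+ r)) (≡.sym (ℕ.+-identityʳ _)) T)))
  where
  T = similar-2^r r≢0
  j = 1 + n ℕ./ 4 * 2
  n≡2j : n ≡ 2 * j
  n≡2j = ≡.trans (m≡m%n+[m/n]*n n 4) (≡.trans (≡.cong (_+ n ℕ./ 4 * 4) n%4≡2) (double (n ℕ./ 4)))
    where
    double : ∀ q → 2 + q * 4 ≡ 2 * (1 + q * 2)
    double = solve-∀
  ∤j : ¬ (2 ∣ j)
  ∤j = λ { (divides q eq) → ℕ.even≢odd q (n ℕ./ 4) (≡.trans (ℕ.*-comm 2 q) (≡.trans (≡.sym eq) (≡.cong suc (ℕ.*-comm (n ℕ./ 4) 2)))) }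
  -- The exponent `suc r` lets a factor 2 be pulled out: gcd(2j, 2·2^r) = 2 gcd(j, 2^r), and j is
  -- odd.
  gcd≡2 : gcd n (2 ℕ.^ suc r) ≡ 2
  gcd≡2 = ≡.trans (≡.cong (λ m → gcd m (2 ℕ.^ suc r)) n≡2j)
    (≡.trans (≡.sym (c*gcd[m,n]≡gcd[cm,cn] 2 j (2 ℕ.^ r))) (≡.cong (2 *_) (odd-gcd-2^k r {j} ∤j)))

-- Ensures r ≤ n, so that `size≤excess` can work with the natural number n - r.
r≤choose+1 : ∀ r → r ≤ (r C 2) + 1
r≤choose+1 zero    = ℕ.z≤n
r≤choose+1 (suc r) = ≡.subst (suc r ≤_) (ℕ.+-comm 1 (suc r C 2)) (ℕ.s≤s (begin
  r                 ≡⟨ nC1≡n r ⟨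
  r C 1             ≤⟨ ℕ.m≤m+n (r C 1) (r C 2) ⟩
  r C 1 + r C 2     ≡⟨ nCk+nC[k+1]≡[n+1]C[k+1] r 1 ⟩
  suc r C 2         ∎))
  where open ℕ.≤-Reasoning

-- With e = n - r, the bound on n reads (r-1)(r-2) ≤ 2e, whence r - 1 ≤ e as soon as r ≥ 4.
excess-large : ∀ t e → ((4 + t) C 2) + 1 ≤ 4 + t + e → 3 + t ≤ e
excess-large t e bound = ℕ.*-cancelˡ-≤ 2 (ℕ.+-cancelˡ-≤ (12 + 3 * t) _ _ (begin
  12 + 3 * t + 2 * (3 + t)            ≤⟨ ℕ.m≤m+n _ (3 * t + t * t) ⟩
  12 + 3 * t + 2 * (3 + t) + (3 * t + t * t)
                                      ≡⟨ square t ⟩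
  (4 + t) * (4 + t) + 2               ≡⟨ ≡.cong (_+ 2) (2*choose (4 + t)) ⟨
  2 * ((4 + t) C 2) + (4 + t) + 2     ≡⟨ regroup ((4 + t) C 2) t ⟩
  2 * (((4 + t) C 2) + 1) + (4 + t)   ≤⟨ ℕ.+-monoˡ-≤ (4 + t) (ℕ.*-monoʳ-≤ 2 bound) ⟩
  2 * (4 + t + e) + (4 + t)           ≡⟨ collect t e ⟩
  12 + 3 * t + 2 * e                  ∎))
  where
  open ℕ.≤-Reasoning
  square : ∀ t → 12 + 3 * t + 2 * (3 + t) + (3 * t + t * t) ≡ (4 + t) * (4 + t) + 2
  square = solve-∀
  regroup : ∀ c t → 2 * c + (4 + t) + 2 ≡ 2 * (c + 1) + (4 + t)
  regroup = solve-∀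
  collect : ∀ t e → 2 * (4 + t + e) + (4 + t) ≡ 12 + 3 * t + 2 * e
  collect = solve-∀

-- A square other than 0 and 1 is at least 4, where `excess-large` applies, and 1 satisfies the
-- inequality for every e. That r is a square matters: r = 2 with e = 0 and r = 3 with e = 1 meet
-- the bound but violate the conclusion.
excess-bound : ∀ a e → a * a ≢ 0 → ((a * a) C 2) + 1 ≤ a * a + e → a * a ≤ e * e + 1
excess-bound zero          e r≢0 _     = contradiction ≡.refl r≢0
excess-bound (suc zero)    e r≢0 _     = ℕ.m≤n+m 1 (e * e)
excess-bound a@(suc (suc b)) e r≢0 bound = ≡.subst (_≤ e * e + 1) 4+t≡r
  (ℕ.≤-trans (ℕ.≤-reflexive (ℕ.+-comm 1 (3 + t))) (ℕ.+-monoˡ-≤ 1 (ℕ.≤-trans 3+t≤e e≤e²)))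
  where
  t = a * a ∸ 4
  4+t≡r : 4 + t ≡ a * a
  4+t≡r = ℕ.m+[n∸m]≡n (ℕ.*-mono-≤ {2} {a} {2} {a} (ℕ.s≤s (ℕ.s≤s ℕ.z≤n)) (ℕ.s≤s (ℕ.s≤s ℕ.z≤n)))
  3+t≤e : 3 + t ≤ e
  3+t≤e = excess-large t e (≡.subst (λ r → (r C 2) + 1 ≤ r + e) (≡.sym 4+t≡r) bound)
  e≤e² : e ≤ e * e
  e≤e² = ℕ.m≤m*n e e {{ℕ.>-nonZero (ℕ.≤-trans (ℕ.s≤s ℕ.z≤n) 3+t≤e)}}

size≤excess : ∀ {n r} a → r ≡ a * a → r ≢ 0 → (r C 2) + 1 ≤ n →
  (+ n) ℤ.≤ ((+ n ℤ.- + r) ℤ.* (+ n ℤ.- + r)) ℤ.+ (+ n ℤ.- + r) ℤ.+ + 1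
size≤excess {n} {r} a ≡.refl r≢0 bound = ≡.subst (λ d → + n ℤ.≤ d ℤ.* d ℤ.+ d ℤ.+ + 1) (≡.sym n-r≡e)
  (≡.subst (λ s → + n ℤ.≤ s ℤ.+ + e ℤ.+ + 1) (ℤ.pos-* e e) (ℤ.+≤+ (begin
    n                  ≡⟨ r+e≡n ⟨
    r + e              ≤⟨ ℕ.+-monoˡ-≤ e (excess-bound a e r≢0 (≡.subst ((r C 2) + 1 ≤_) (≡.sym r+e≡n) bound)) ⟩
    e * e + 1 + e      ≡⟨ rearrange e ⟩
    e * e + e + 1      ∎)))
  where
  open ℕ.≤-Reasoning
  e = n ∸ r
  r≤n : r ≤ n
  r≤n = ℕ.≤-trans (r≤choose+1 r) bound
  r+e≡n : r + e ≡ n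
  r+e≡n = ℕ.m+[n∸m]≡n r≤n
  n-r≡e : + n ℤ.- + r ≡ + e
  n-r≡e = ≡.trans (ℤ.m-n≡m⊖n n r) (ℤ.⊖-≥ r≤n)
  rearrange : ∀ e → e * e + 1 + e ≡ e * e + e + 1
  rearrange = solve-∀

even⊎odd : ∀ a → ∃ λ b → a ≡ 2 * b ⊎ a ≡ 1 + 2 * b
even⊎odd zero    = 0 , inj₁ ≡.refl
even⊎odd (suc a) with even⊎odd a
... | b , inj₁ eq = b , inj₂ (≡.cong suc eq)
... | b , inj₂ eq = suc b , inj₁ (≡.trans (≡.cong suc eq) (≡.cong suc (≡.sym (ℕ.+-suc b (b + 0)))))

-- 4 divides a² for even a and a² - 1 for odd a.
4∣square*pred : ∀ a → 4 ∣ (a * a) * (a * a ∸ 1)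
4∣square*pred a with even⊎odd a
... | b , inj₁ ≡.refl = ∣m⇒∣m*n (2 * b * (2 * b) ∸ 1) (divides (b * b) (square b))
  where
  square : ∀ b → 2 * b * (2 * b) ≡ b * b * 4
  square = solve-∀
... | b , inj₂ ≡.refl = ∣n⇒∣m*n ((1 + 2 * b) * (1 + 2 * b)) (divides (b * b + b) (≡.cong (_∸ 1) (square b)))
  where
  square : ∀ b → (1 + 2 * b) * (1 + 2 * b) ≡ 1 + (b * b + b) * 4
  square = solve-∀

square-consequences : ∀ {n r} → r ≢ 0 → (r C 2) + 1 ≤ n → (∃ λ a → r ≡ a * a) →
  (∃ λ a → r ≡ a * a) ×
  ((+ n) ℤ.≤ ((+ n ℤ.- + r) ℤ.* (+ n ℤ.- + r)) ℤ.+ (+ n ℤ.- + r) ℤ.+ + 1) ×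
  (4 ∣ r * (r ∸ 1))
square-consequences r≢0 bound (a , ≡.refl) = (a , ≡.refl) , size≤excess a ≡.refl r≢0 bound , 4∣square*pred a

BalancedSplit : ∀ n → SignedGraph (2 * n) → Set
BalancedSplit n G = ∃ λ (s : Shuffle (2 * n) n n) →
  (∀ p p′ → ¬ Adj G (inL s p) (inL s p′)) × (∀ q q′ → ¬ Adj G (inR s q) (inR s q′))

balanced-split : ∀ {n r} {G : SignedGraph (2 * n)} → Regular G r → r ≢ 0 → Bipartite G → BalancedSplit n G
balanced-split {n} {r} {G} regular r≢0 (col , proper) with colour-shuffle col
... | a , b , s , L , Q = cast a≡b a≡n s L-L R-R
  where
  L-L : ∀ p p′ → ¬ Adj G (inL s p) (inL s p′)
  L-L p p′ adj = proper _ _ adj (≡.trans (L p) (≡.sym (L p′)))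
  R-R : ∀ q q′ → ¬ Adj G (inR s q) (inR s q′)
  R-R q q′ adj = proper _ _ adj (≡.trans (Q q) (≡.sym (Q q′)))
  a≡b : a ≡ b
  a≡b = Bipartition.balanced G regular r≢0 s L-L R-R
  a≡n : a ≡ n
  a≡n = ℕ.*-cancelˡ-≡ a n 2 (≡.trans (≡.cong (λ m → a + m) (≡.trans (ℕ.+-identityʳ a) a≡b)) (shuffle-size s))
  cast : ∀ {a b} → a ≡ b → a ≡ n → (s : Shuffle (2 * n) a b) →
         (∀ p p′ → ¬ Adj G (inL s p) (inL s p′)) → (∀ q q′ → ¬ Adj G (inR s q) (inR s q′)) → BalancedSplit n G
  cast ≡.refl ≡.refl s L-L R-R = s , L-L , R-R

module Conclusion {m r} (G : SignedGraph (2 * suc m)) (regular : Regular G r) (r≢0 : r ≢ 0)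
  (common : ∀ i j → i ≢ j → commonNeighbours G i j ≡ 0 ⊎ commonNeighbours G i j ≡ 2)
  (gram-same : ∀ i → gram G i i ≡ + r) (gram-distinct : ∀ i j → i ≢ j → gram G i j ≡ + 0)
  (s : Shuffle (2 * suc m) (suc m) (suc m))
  (L-L : ∀ p p′ → ¬ Adj G (inL s p) (inL s p′)) (R-R : ∀ q q′ → ¬ Adj G (inR s q) (inR s q′)) where
  open Bipartition G regular r≢0 s L-L R-R
  open Design G regular r≢0 s L-L R-R

  distinct : ∀ {p p′} → p ≢ p′ → inL s p ≢ inL s p′
  distinct p≢p′ = p≢p′ ∘ inL-injective s

  pairs : ∀ p p′ → p ≢ p′ → Σℕ.sum (λ q → indicator (E p q Bool.∧ E p′ q)) ≡ 0 ⊎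
                            Σℕ.sum (λ q → indicator (E p q Bool.∧ E p′ q)) ≡ 2
  pairs p p′ p≢p′ = ≡.subst (λ k → k ≡ 0 ⊎ k ≡ 2) (≡.sym (common≡commonNeighbours p p′)) (common _ _ (distinct p≢p′))

  open Incidence E row column pairs

  design : suc m ≡ (r C 2) + 1 → IsIncidenceGraphOfSBIBD G (suc m) r 2
  design eq = incidence-graph (common≡2 eq)

  size : (r C 2) + 1 ≤ suc m
  size = size-bound

  similar : Similar (suc m) (+ r)
  similar = gram⇒similar (+≢0 r≢0) N (λ p → ≡.trans (N-gram p p) (gram-same (inL s p)))
    (λ p p′ p≢p′ → ≡.trans (N-gram p p′) (gram-distinct _ _ (distinct p≢p′)))

theorem3p6 : ∀ {c ℓ} (R : RealClosedField c ℓ) (n r : ℕ) (G : SignedGraph (2 * n)) →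
    IsSR2SE R n r G → Bipartite G →
    ((r C 2) + 1 ≤ n × (n ≡ (r C 2) + 1 → IsIncidenceGraphOfSBIBD G n r 2)) ×
    ((n % 2 ≡ 1 →
    (∃ λ a → r ≡ a * a) ×
    ((+ n) ℤ.≤ ((+ n ℤ.- + r) ℤ.* (+ n ℤ.- + r)) ℤ.+ (+ n ℤ.- + r) ℤ.+ + 1) ×
    (4 ∣ r * (r ∸ 1))) ×
    (n % 4 ≡ 2 → ∃₂ λ (a b : ℤ) → + r ≡ (a ℤ.* a) ℤ.+ (b ℤ.* b)))
-- Without vertices there is no eigenvector, since one must have a nonzero coordinate.
theorem3p6 R zero r G (_ , regular , spectrum) _ = contradiction (Spectrum.vertex R G regular spectrum) ¬Fin0
theorem3p6 R (suc m) r G (((_ , common) , _) , regular , spectrum) bipartite =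
    (size , design)
  , (λ odd → square-consequences r≢0 size (odd⇒square r≢0 similar odd))
  , 2mod4⇒two-squares r≢0 similar
  where
  open Spectrum R G regular spectrum
  split-G : BalancedSplit (suc m) G
  split-G = balanced-split {suc m} {G = G} regular r≢0 bipartite
  open Conclusion G regular r≢0 common gram-same gram-distinct
    (proj₁ split-G) (proj₁ (proj₂ split-G)) (proj₂ (proj₂ split-G))
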